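{- There exists a positive integer $\kappa$ such that if a graph $G$ satisfies the following conditions: (i) $d(x)>\kappa$ holds for all $x\in V(G)$; (ii) $\bar d(G_x)\le d(x)-\kappa$ holds for all $x\in V(G)$; (iii) $\lambda_{\min}(G)\ge -3$; then $G$ is the slim graph of a $2$-fat $\{\mathfrak{f}_1,\mathfrak{f}_2,\mathfrak{f}_3\}$-line Hoffman graph.
   Context: All graphs are finite, undirected and simple. $d(x)$ is the degree of $x$ in $G$, $G_x$ is the subgraph of $G$ induced on the set of neighbors of $x$, $\bar d(G_x)$ is the average degree of the graph $G_x$, and $\lambda_{\min}(G)$ is the smallest eigenvalue of the adjacency matrix of $G$. A Hoffman graph $\mathfrak{h}$ is a pair $(H,\ell)$ where $H=(V,E)$ is a graph and $\ell:V\to\{\text{fat},\text{slim}\}$ is a labeling such that no two fat vertices are adjacent and every fat vertex has at least one slim neighbor. The slim graph of $\mathfrak{h}$ is the subgraph of $H$ induced on the slim vertices (an ordinary graph). $\mathfrak{h}$ is $t$-fat if every slim vertex has at least $t$ fat neighbors. An induced Hoffman subgraph of $\mathfrak{h}$ is a Hoffman graph $(H_1,\ell_1)$ with $H_1$ an induced subgraph of $H$ and $\ell_1$ the restriction of $\ell$. For a set $W$ of slim vertices, the induced Hoffman subgraph generated by $W$ is the one induced on $W$ together with all fat vertices having a neighbor in $W$. Isomorphisms of Hoffman graphs are graph isomorphisms preserving labels. The special matrix $S(\mathfrak{h})$ is indexed by slim vertices: $S(\mathfrak{h})=A_{\rm slim}-CC^T$, where $A_{\rm slim}$ is the adjacency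 matrix of the slim graph and $C$ is the slim-by-fat $0/1$ adjacency block. A family $\{\mathfrak{h}^i\}_{i=1}^r$ is a decomposition of $\mathfrak{h}$, written $\mathfrak{h}=\uplus_{i=1}^r\mathfrak{h}^i$, if there is a partition of the slim vertex set of $\mathfrak{h}$ into $r$ parts such that $\mathfrak{h}^i$ is the induced Hoffman subgraph generated by the $i$-th part and $S(\mathfrak{h})$ is block diagonal with blocks $S(\mathfrak{h}^1),\dots,S(\mathfrak{h}^r)$ with respect to this partition. For a family $\mathfrak{H}$ of pairwise non-isomorphic Hoffman graphs, a Hoffman graph $\mathfrak{h}$ is an $\mathfrak{H}$-line Hoffman graph if there is a Hoffman graph $\mathfrak{h}'$ such that $\mathfrak{h}'$ has $\mathfrak{h}$ as an induced Hoffman subgraph, $\mathfrak{h}'$ has the same slim graph as $\mathfrak{h}$, and $\mathfrak{h}'=\uplus_{i=1}^r\mathfrak{h}'_i$ where each $\mathfrak{h}'_i$ is isomorphic to an induced Hoffman subgraph of some member of $\mathfrak{H}$. The Hoffman graphs $\mathfrak{f}_1,\mathfrak{f}_2,\mathfrak{f}_3$: - $\mathfrak{f}_1$ has one slim vertex adjacent to three fat vertices. - $\mathfrak{f}_2$ has four slim vertices $x_1,x_2,y_1,y_2$ and four fat vertices $F_{ij}$ ($i,j\in\{1,2\}$); the slim-slim edges are exactly $x_1x_2$ and $y_1y_2$; $x_i$ is adjacent to exactly the fat vertices $F_{i1},F_{i2}$ and $y_j$ to exactly $F_{1j},F_{2j}$. - $\mathfrak{f}_3$ has two adjacent slim vertices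 and two fat vertices, each slim vertex being adjacent to both fat vertices. -}

module Defs where

open import Data.Bool as Bool using (Bool; true; false; T; T?; if_then_else_; _∨_)
open import Data.Bool.Properties using (∨-comm)
open import Data.Fin using (Fin; zero; suc; toℕ; #_)
import Data.Fin.Properties as Fin
open import Data.Fin.Subset using (Subset; _∈_; _∪_; _∩_; ∣_∣; Nonempty)
open import Data.Fin.Subset.Properties using (_∈?_; x∈p∪q⁺; x∈p∪q⁻)
import Data.Integer as ℤ
open ℤ using (ℤ)
open import Data.List using (List; []; _∷_; allFin; filter; length; lookup)
import Data.List.Membership.DecPropositional as DecMembership
open import Data.List.Membership.Propositional.Properties
  using (∈-filter⁺; ∈-filter⁻; ∈-allFin; ∈-lookup)
open import Data.List.Relation.Unary.Any using (index)
open import Data.List.Relation.Unary.Any.Properties using (lookup-index)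
open import Data.Nat as ℕ using (ℕ; zero; suc; _⊔_)
import Data.Nat.Properties as ℕ
open import Data.Product using (Σ; ∃-syntax; _×_; _,_; proj₁; proj₂)
open import Data.Product.Properties using (≡-dec)
open import Data.Rational as ℚ using (ℚ; 0ℚ; 1ℚ; ½; _/_)
import Data.Rational.Properties as ℚ
open import Data.Rational.Solver using (module +-*-Solver)
open import Data.Sum using (inj₁; inj₂)
open import Data.Vec using (tabulate)
open import Data.Vec.Properties using (lookup⇒[]=; []=⇒lookup; lookup∘tabulate)
import Data.Vec.Functional as Vector
open import Function using (_↔_; _∘_; Inverse)
open import Relation.Binary using (DecidableEquality)
open import Relation.Binary.PropositionalEquality
  using (_≡_; _≢_; refl; sym; trans; cong; subst)
open import Relation.Nullary using (¬_; yes; no; does; contradiction)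
open import Relation.Nullary.Decidable using (True; toWitness; _×-dec_; _→-dec_; ¬?; ⌊_⌋)
open import Relation.Unary using (Decidable)

-- Real numbers as Cauchy sequences of rationals; equality of reals is `≈ᵣ`, not `≡`.
record ℝ : Set where
  field
    seq    : ℕ → ℚ
    cauchy : ∀ ε → 0ℚ ℚ.< ε →
             ∃[ N ] ∀ m n → N ℕ.≤ m → N ℕ.≤ n → ℚ.∣ seq m ℚ.- seq n ∣ ℚ.< ε
open ℝ public

infix 4 _≈ᵣ_ _≤ᵣ_

_≈ᵣ_ : ℝ → ℝ → Set
x ≈ᵣ y = ∀ ε → 0ℚ ℚ.< ε → ∃[ N ] ∀ n → N ℕ.≤ n → ℚ.∣ seq x n ℚ.- seq y n ∣ ℚ.< ε

_≤ᵣ_ : ℝ → ℝ → Set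
x ≤ᵣ y = ∀ ε → 0ℚ ℚ.< ε → ∃[ N ] ∀ n → N ℕ.≤ n → seq x n ℚ.< seq y n ℚ.+ ε

fromℚ : ℚ → ℝ
fromℚ q .seq _ = q
fromℚ q .cauchy ε ε>0 = 0 , λ _ _ _ _ →
  subst (ℚ._< ε) (sym (cong ℚ.∣_∣ (ℚ.+-inverseʳ q))) ε>0

fromℤ : ℤ → ℝ
fromℤ z = fromℚ (z / 1)

private
  half>0 : ∀ {ε} → 0ℚ ℚ.< ε → 0ℚ ℚ.< ε ℚ.* ½
  half>0 {ε} ε>0 = subst (ℚ._< ε ℚ.* ½) (ℚ.*-zeroˡ ½) (ℚ.*-monoˡ-<-pos ½ ε>0)

  half+half : ∀ ε → ε ℚ.* ½ ℚ.+ ε ℚ.* ½ ≡ ε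
  half+half ε = trans (sym (ℚ.*-distribˡ-+ ε ½ ½)) (ℚ.*-identityʳ ε)

  sum-diff : ∀ a b c d → (a ℚ.+ b) ℚ.- (c ℚ.+ d) ≡ (a ℚ.- c) ℚ.+ (b ℚ.- d)
  sum-diff = solve 4 (λ a b c d → (a :+ b) :- (c :+ d) := (a :- c) :+ (b :- d)) refl
    where open +-*-Solver

  prod-diff : ∀ a b c d → a ℚ.* b ℚ.- c ℚ.* d ≡ a ℚ.* (b ℚ.- d) ℚ.+ d ℚ.* (a ℚ.- c)
  prod-diff = solve 4 (λ a b c d → a :* b :- c :* d := a :* (b :- d) :+ d :* (a :- c)) refl
    where open +-*-Solver

  sub-add : ∀ a b → (a ℚ.- b) ℚ.+ b ≡ a
  sub-add = solve 2 (λ a b → (a :- b) :+ b := a) refl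
    where open +-*-Solver

  eventually-bounded : ∀ x → ∃[ B ] 0ℚ ℚ.< B × ∃[ N ] ∀ n → N ℕ.≤ n → ℚ.∣ seq x n ∣ ℚ.≤ B
  eventually-bounded x with cauchy x 1ℚ (ℚ.positive⁻¹ 1ℚ)
  ... | N , close = 1ℚ ℚ.+ ℚ.∣ seq x N ∣
      , ℚ.+-mono-<-≤ (ℚ.positive⁻¹ 1ℚ) (ℚ.0≤∣p∣ (seq x N))
      , N , bound
    where
    bound : ∀ n → N ℕ.≤ n → ℚ.∣ seq x n ∣ ℚ.≤ 1ℚ ℚ.+ ℚ.∣ seq x N ∣
    bound n N≤n = begin
      ℚ.∣ seq x n ∣                                   ≡⟨ cong ℚ.∣_∣ (sub-add (seq x n) (seq x N)) ⟨
      ℚ.∣ (seq x n ℚ.- seq x N) ℚ.+ seq x N ∣          ≤⟨ ℚ.∣p+q∣≤∣p∣+∣q∣ (seq x n ℚ.- seq x N) (seq x N) ⟩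
      ℚ.∣ seq x n ℚ.- seq x N ∣ ℚ.+ ℚ.∣ seq x N ∣      ≤⟨ ℚ.+-monoˡ-≤ ℚ.∣ seq x N ∣ (ℚ.<⇒≤ (close n N N≤n ℕ.≤-refl)) ⟩
      1ℚ ℚ.+ ℚ.∣ seq x N ∣                            ∎
      where open ℚ.≤-Reasoning

  *-bound : ∀ {B δ} a d → 0ℚ ℚ.< B → ℚ.∣ a ∣ ℚ.≤ B → ℚ.∣ d ∣ ℚ.< δ → ℚ.∣ a ℚ.* d ∣ ℚ.< B ℚ.* δ
  *-bound {B} {δ} a d B>0 a≤B d<δ = begin-strict
    ℚ.∣ a ℚ.* d ∣          ≡⟨ ℚ.∣p*q∣≡∣p∣*∣q∣ a d ⟩
    ℚ.∣ a ∣ ℚ.* ℚ.∣ d ∣    ≤⟨ ℚ.*-monoʳ-≤-nonNeg ℚ.∣ d ∣ {{ℚ.∣-∣-nonNeg d}} a≤B ⟩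
    B ℚ.* ℚ.∣ d ∣          <⟨ ℚ.*-monoʳ-<-pos B {{ℚ.positive B>0}} d<δ ⟩
    B ℚ.* δ                ∎
    where open ℚ.≤-Reasoning

  prod-close : ∀ {A B δ} a b c d → 0ℚ ℚ.< A → 0ℚ ℚ.< B → ℚ.∣ a ∣ ℚ.≤ A → ℚ.∣ d ∣ ℚ.≤ B →
               ℚ.∣ a ℚ.- c ∣ ℚ.< δ → ℚ.∣ b ℚ.- d ∣ ℚ.< δ →
               ℚ.∣ a ℚ.* b ℚ.- c ℚ.* d ∣ ℚ.< (A ℚ.+ B) ℚ.* δ
  prod-close {A} {B} {δ} a b c d A>0 B>0 a≤A d≤B a-c<δ b-d<δ = begin-strict
    ℚ.∣ a ℚ.* b ℚ.- c ℚ.* d ∣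
      ≡⟨ cong ℚ.∣_∣ (prod-diff a b c d) ⟩
    ℚ.∣ a ℚ.* (b ℚ.- d) ℚ.+ d ℚ.* (a ℚ.- c) ∣
      ≤⟨ ℚ.∣p+q∣≤∣p∣+∣q∣ (a ℚ.* (b ℚ.- d)) (d ℚ.* (a ℚ.- c)) ⟩
    ℚ.∣ a ℚ.* (b ℚ.- d) ∣ ℚ.+ ℚ.∣ d ℚ.* (a ℚ.- c) ∣
      <⟨ ℚ.+-mono-< (*-bound a (b ℚ.- d) A>0 a≤A b-d<δ) (*-bound d (a ℚ.- c) B>0 d≤B a-c<δ) ⟩
    A ℚ.* δ ℚ.+ B ℚ.* δ
      ≡⟨ ℚ.*-distribʳ-+ δ A B ⟨
    (A ℚ.+ B) ℚ.* δ ∎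
    where open ℚ.≤-Reasoning

  quotient : ∀ {C ε} → 0ℚ ℚ.< C → 0ℚ ℚ.< ε → ∃[ δ ] 0ℚ ℚ.< δ × C ℚ.* δ ≡ ε
  quotient {C} {ε} C>0 ε>0 = ℚ.1/ C ℚ.* ε
    , subst (ℚ._< ℚ.1/ C ℚ.* ε) (ℚ.*-zeroʳ (ℚ.1/ C))
        (ℚ.*-monoʳ-<-pos (ℚ.1/ C) {{ℚ.1/pos⇒pos C}} ε>0)
    , trans (sym (ℚ.*-assoc C (ℚ.1/ C) ε))
        (trans (cong (ℚ._* ε) (ℚ.*-inverseʳ C)) (ℚ.*-identityˡ ε))
    where
    instance
      C-positive : ℚ.Positive C
      C-positive = ℚ.positive C>0
      C-nonZero : ℚ.NonZero C
      C-nonZero = ℚ.pos⇒nonZero C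

  prod-cauchy : ∀ x y ε → 0ℚ ℚ.< ε → ∃[ N ] ∀ m n → N ℕ.≤ m → N ℕ.≤ n →
                ℚ.∣ seq x m ℚ.* seq y m ℚ.- seq x n ℚ.* seq y n ∣ ℚ.< ε
  prod-cauchy x y ε ε>0 =
    let A , A>0 , K , x≤A = eventually-bounded x
        B , B>0 , L , y≤B = eventually-bounded y
        δ , δ>0 , eq = quotient (ℚ.+-mono-< A>0 B>0) ε>0
        M , closeˣ = cauchy x δ δ>0
        N , closeʸ = cauchy y δ δ>0
    in K ⊔ L ⊔ (M ⊔ N) , λ m n m≥ n≥ →
      let m≥KL = ℕ.m⊔n≤o⇒m≤o (K ⊔ L) (M ⊔ N) m≥
          n≥KL = ℕ.m⊔n≤o⇒m≤o (K ⊔ L) (M ⊔ N) n≥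
          m≥MN = ℕ.m⊔n≤o⇒n≤o (K ⊔ L) (M ⊔ N) m≥
          n≥MN = ℕ.m⊔n≤o⇒n≤o (K ⊔ L) (M ⊔ N) n≥
      in subst (ℚ.∣ seq x m ℚ.* seq y m ℚ.- seq x n ℚ.* seq y n ∣ ℚ.<_) eq
           (prod-close (seq x m) (seq y m) (seq x n) (seq y n) A>0 B>0
             (x≤A m (ℕ.m⊔n≤o⇒m≤o K L m≥KL)) (y≤B n (ℕ.m⊔n≤o⇒n≤o K L n≥KL))
             (closeˣ m n (ℕ.m⊔n≤o⇒m≤o M N m≥MN) (ℕ.m⊔n≤o⇒m≤o M N n≥MN))
             (closeʸ m n (ℕ.m⊔n≤o⇒n≤o M N m≥MN) (ℕ.m⊔n≤o⇒n≤o M N n≥MN)))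

infixl 6 _+ᵣ_
infixl 7 _*ᵣ_

_+ᵣ_ : ℝ → ℝ → ℝ
(x +ᵣ y) .seq n = seq x n ℚ.+ seq y n
(x +ᵣ y) .cauchy ε ε>0 with cauchy x (ε ℚ.* ½) (half>0 ε>0) | cauchy y (ε ℚ.* ½) (half>0 ε>0)
... | M , closeˣ | N , closeʸ = M ⊔ N , λ m n m≥ n≥ → begin-strict
    ℚ.∣ (seq x m ℚ.+ seq y m) ℚ.- (seq x n ℚ.+ seq y n) ∣
      ≡⟨ cong ℚ.∣_∣ (sum-diff (seq x m) (seq y m) (seq x n) (seq y n)) ⟩
    ℚ.∣ (seq x m ℚ.- seq x n) ℚ.+ (seq y m ℚ.- seq y n) ∣
      ≤⟨ ℚ.∣p+q∣≤∣p∣+∣q∣ (seq x m ℚ.- seq x n) (seq y m ℚ.- seq y n) ⟩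
    ℚ.∣ seq x m ℚ.- seq x n ∣ ℚ.+ ℚ.∣ seq y m ℚ.- seq y n ∣
      <⟨ ℚ.+-mono-< (closeˣ m n (ℕ.m⊔n≤o⇒m≤o M N m≥) (ℕ.m⊔n≤o⇒m≤o M N n≥))
                    (closeʸ m n (ℕ.m⊔n≤o⇒n≤o M N m≥) (ℕ.m⊔n≤o⇒n≤o M N n≥)) ⟩
    ε ℚ.* ½ ℚ.+ ε ℚ.* ½
      ≡⟨ half+half ε ⟩
    ε ∎
  where open ℚ.≤-Reasoning

_*ᵣ_ : ℝ → ℝ → ℝ
(x *ᵣ y) .seq n = seq x n ℚ.* seq y n
(x *ᵣ y) .cauchy = prod-cauchy x y

Matrix : Set → ℕ → Set
Matrix A n = Fin n → Fin n → A

∑ᵣ : ∀ {n} → (Fin n → ℝ) → ℝ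
∑ᵣ = Vector.foldr _+ᵣ_ (fromℚ 0ℚ)

∑ℤ : ∀ {n} → (Fin n → ℤ) → ℤ
∑ℤ = Vector.foldr ℤ._+_ ℤ.0ℤ

∑ℕ : ∀ {n} → (Fin n → ℕ) → ℕ
∑ℕ = Vector.foldr ℕ._+_ 0

IsEigenvalue : ∀ {n} → Matrix ℝ n → ℝ → Set
IsEigenvalue {n} M μ = Σ (Fin n → ℝ) λ v →
  ¬ (∀ i → v i ≈ᵣ fromℚ 0ℚ) × (∀ i → ∑ᵣ (λ j → M i j *ᵣ v j) ≈ᵣ μ *ᵣ v i)

IsSmallestEigenvalue : ∀ {n} → Matrix ℝ n → ℝ → Set
IsSmallestEigenvalue M μ = IsEigenvalue M μ × (∀ ν → IsEigenvalue M ν → μ ≤ᵣ ν)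

⟪_⟫ : ∀ {n} {P : Fin n → Set} → Decidable P → Subset n
⟪ P? ⟫ = tabulate (does ∘ P?)

∈⟪⟫⁺ : ∀ {n} {P : Fin n → Set} (P? : Decidable P) {x} → P x → x ∈ ⟪ P? ⟫
∈⟪⟫⁺ P? {x} px with P? x in eq
... | yes _  = lookup⇒[]= x _ (trans (lookup∘tabulate (does ∘ P?) x) (cong does eq))
... | no ¬px = contradiction px ¬px

∈⟪⟫⁻ : ∀ {n} {P : Fin n → Set} (P? : Decidable P) {x} → x ∈ ⟪ P? ⟫ → P x
∈⟪⟫⁻ P? {x} x∈ with P? x | trans (sym (lookup∘tabulate (does ∘ P?) x)) ([]=⇒lookup x∈)
... | yes px | _ = px
... | no _   | ()

elements : ∀ {n} → Subset n → List (Fin n)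
elements W = filter (_∈? W) (allFin _)

-- `Index W` serves as the vertex set of the subgraph induced on `W`; `at W`
-- identifies it with `W`.
Index : ∀ {n} → Subset n → Set
Index W = Fin (length (elements W))

at : ∀ {n} (W : Subset n) → Index W → Fin n
at W = lookup (elements W)

at-∈ : ∀ {n} (W : Subset n) (i : Index W) → at W i ∈ W
at-∈ W i = ∈-filter⁻ (_∈? W) {xs = allFin _} (∈-lookup i) .proj₂

at-surjective : ∀ {n} (W : Subset n) {x} → x ∈ W → ∃[ i ] x ≡ at W i
at-surjective W {x} x∈W = index x∈ , lookup-index x∈
  where x∈ = ∈-filter⁺ (_∈? W) (∈-allFin x) x∈W

record Graph : Set where
  field
    order       : ℕ
    adj         : Fin order → Fin order → Bool
    symmetric   : ∀ x y → adj x y ≡ adj y x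
    irreflexive : ∀ x → adj x x ≡ false

  V : Set
  V = Fin order

  Adj : V → V → Set
  Adj x y = T (adj x y)

  neighbours : V → Subset order
  neighbours x = ⟪ (λ y → T? (adj x y)) ⟫

  degree : V → ℕ
  degree x = ∣ neighbours x ∣

  adjacencyMatrix : Matrix ℤ order
  adjacencyMatrix x y = if adj x y then ℤ.1ℤ else ℤ.0ℤ

  realAdjacencyMatrix : Matrix ℝ order
  realAdjacencyMatrix x y = fromℤ (adjacencyMatrix x y)

record _≅_ (G H : Graph) : Set where
  private
    module G = Graph G
    module H = Graph H
  field
    bijection : G.V ↔ H.V
    preserves : ∀ x y → G.adj x y ≡ H.adj (Inverse.to bijection x) (Inverse.to bijection y)

induced : (G : Graph) → Subset (Graph.order G) → Graph
induced G W = record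
  { order       = length (elements W)
  ; adj         = λ i j → adj (at W i) (at W j)
  ; symmetric   = λ i j → symmetric (at W i) (at W j)
  ; irreflexive = λ i → irreflexive (at W i)
  }
  where open Graph G

-- The local graph G_x.
localGraph : (G : Graph) → Graph.V G → Graph
localGraph G x = induced G (Graph.neighbours G x)

fromℕ : ℕ → ℚ
fromℕ n = ℤ.+ n / 1

-- The value for the graph with no vertices is a convention.
averageDegree : Graph → ℚ
averageDegree G with Graph.order G | ∑ℕ (Graph.degree G)
... | zero  | _ = 0ℚ
... | suc n | s = ℤ.+ s / suc n

IsλMin : Graph → ℝ → Set
IsλMin G = IsSmallestEigenvalue (Graph.realAdjacencyMatrix G)

data Label : Set where
  fat slim : Label

_≟ˡ_ : DecidableEquality Label
fat  ≟ˡ fat  = yes refl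
fat  ≟ˡ slim = no λ ()
slim ≟ˡ fat  = no λ ()
slim ≟ˡ slim = yes refl

record HoffmanGraph : Set where
  field
    graph : Graph
  open Graph graph public
  field
    label    : V → Label
    fat-fat  : ∀ x y → label x ≡ fat → label y ≡ fat → ¬ Adj x y
    fat-slim : ∀ x → label x ≡ fat → ∃[ y ] label y ≡ slim × Adj x y

  slimVertices fatVertices : Subset order
  slimVertices = ⟪ (λ x → label x ≟ˡ slim) ⟫
  fatVertices  = ⟪ (λ x → label x ≟ˡ fat) ⟫

  Slim : Set
  Slim = ∃[ x ] label x ≡ slim

  Fat : Set
  Fat = Index fatVertices

  slimGraph : Graph
  slimGraph = induced graph slimVertices

  A-slim : Slim → Slim → ℤ
  A-slim (x , _) (y , _) = adjacencyMatrix x y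

  C : Slim → Fat → ℤ
  C (x , _) F = adjacencyMatrix x (at fatVertices F)

  specialMatrix : Slim → Slim → ℤ
  specialMatrix x y = A-slim x y ℤ.- ∑ℤ (λ F → C x F ℤ.* C y F)

  IsFat : ℕ → Set
  IsFat t = ∀ x → label x ≡ slim → t ℕ.≤ ∣ neighbours x ∩ fatVertices ∣

open HoffmanGraph public using (slimGraph; IsFat)

record _≅ᴴ_ (𝔤 𝔥 : HoffmanGraph) : Set where
  private
    module 𝔤 = HoffmanGraph 𝔤
    module 𝔥 = HoffmanGraph 𝔥
  field
    isomorphism : 𝔤.graph ≅ 𝔥.graph
  open _≅_ isomorphism public
  field
    preservesLabel : ∀ x → 𝔤.label x ≡ 𝔥.label (Inverse.to bijection x)

module _ (𝔥 : HoffmanGraph) where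
  open HoffmanGraph 𝔥

  -- The vertex sets inducing a Hoffman graph: the other axiom is inherited.
  Inducing : Subset order → Set
  Inducing W = ∀ x → x ∈ W → label x ≡ fat → ∃[ y ] y ∈ W × label y ≡ slim × Adj x y

  inducedHoffman : (W : Subset order) → Inducing W → HoffmanGraph
  inducedHoffman W inducing = record
    { graph    = induced graph W
    ; label    = λ i → label (at W i)
    ; fat-fat  = λ i j → fat-fat (at W i) (at W j)
    ; fat-slim = fs
    }
    where
    fs : ∀ i → label (at W i) ≡ fat → ∃[ j ] label (at W j) ≡ slim × Adj (at W i) (at W j)
    fs i isFat with inducing (at W i) (at-∈ W i) isFat
    ... | y , y∈W , isSlim , adjacent with at-surjective W y∈W
    ...   | j , refl = j , isSlim , adjacent

  fatNeighboursOf? : (W : Subset order) →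
                     Decidable (λ F → label F ≡ fat × ∃[ x ] x ∈ W × Adj F x)
  fatNeighboursOf? W F =
    (label F ≟ˡ fat) ×-dec Fin.any? (λ x → (x ∈? W) ×-dec T? (adj F x))

  generatedSet : Subset order → Subset order
  generatedSet W = W ∪ ⟪ fatNeighboursOf? W ⟫

  generatedSet-inducing : (W : Subset order) → (∀ x → x ∈ W → label x ≡ slim) →
                          Inducing (generatedSet W)
  generatedSet-inducing W W-slim F F∈ isFat with x∈p∪q⁻ W ⟪ fatNeighboursOf? W ⟫ F∈
  ... | inj₁ F∈W = contradiction (trans (sym isFat) (W-slim F F∈W)) λ ()
  ... | inj₂ F∈N with ∈⟪⟫⁻ (fatNeighboursOf? W) F∈N
  ...   | _ , x , x∈W , adjacent = x , x∈p∪q⁺ (inj₁ x∈W) , W-slim x x∈W , adjacent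

  generated : (W : Subset order) → (∀ x → x ∈ W → label x ≡ slim) → HoffmanGraph
  generated W W-slim = inducedHoffman (generatedSet W) (generatedSet-inducing W W-slim)

-- 𝔤 is isomorphic to an induced Hoffman subgraph of 𝔥.
_≲_ : HoffmanGraph → HoffmanGraph → Set
𝔤 ≲ 𝔥 = ∃[ W ] Σ (Inducing 𝔥 W) λ inducing → 𝔤 ≅ᴴ inducedHoffman 𝔥 W inducing

-- A decomposition 𝔥 = ⊎ 𝔥ⁱ.  The 𝔥ⁱ are the `component`s, determined by the
-- partition of the slim vertices.
record Decomposition (𝔥 : HoffmanGraph) : Set where
  open HoffmanGraph 𝔥
  field
    r         : ℕ
    part      : Fin r → Subset order
    part-slim : ∀ i x → x ∈ part i → label x ≡ slim
    nonempty  : ∀ i → Nonempty (part i)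
    covering  : ∀ x → label x ≡ slim → ∃[ i ] x ∈ part i
    disjoint  : ∀ i j x → x ∈ part i → x ∈ part j → i ≡ j

  component : Fin r → HoffmanGraph
  component i = generated 𝔥 (part i) (part-slim i)

  inclusion : ∀ i → HoffmanGraph.Slim (component i) → Slim
  inclusion i (x , isSlim) = at (generatedSet 𝔥 (part i)) x , isSlim

  field
    diagonal-blocks : ∀ i x y →
      specialMatrix (inclusion i x) (inclusion i y) ≡ HoffmanGraph.specialMatrix (component i) x y
    off-diagonal-blocks : ∀ i j → i ≢ j → ∀ (x y : Slim) →
      proj₁ x ∈ part i → proj₁ y ∈ part j → specialMatrix x y ≡ ℤ.0ℤ

-- 𝔥 is, up to isomorphism, the induced Hoffman subgraph of 𝔥′ on a vertex set W;
-- it has the same slim graph as 𝔥′ when W contains all slim vertices of 𝔥′.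
record IsLineHoffmanGraph {I : Set} (ℌ : I → HoffmanGraph) (𝔥 : HoffmanGraph) : Set where
  field
    𝔥′         : HoffmanGraph
  open HoffmanGraph 𝔥′ using (order; label)
  field
    W             : Subset order
    inducing      : Inducing 𝔥′ W
    subgraph      : 𝔥 ≅ᴴ inducedHoffman 𝔥′ W inducing
    sameSlimGraph : ∀ x → label x ≡ slim → x ∈ W
    decomposition : Decomposition 𝔥′
  open Decomposition decomposition using (r; component)
  field
    components    : (i : Fin r) → ∃[ k ] component i ≲ ℌ k

edge : ∀ {n} → List (Fin n × Fin n) → Fin n → Fin n → Bool
edge edges x y = ⌊ (x , y) ∈ᴸ? edges ⌋ ∨ ⌊ (y , x) ∈ᴸ? edges ⌋
  where open DecMembership (≡-dec Fin._≟_ Fin._≟_) renaming (_∈?_ to _∈ᴸ?_)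

slimBelow : ∀ {n} → ℕ → Fin n → Label
slimBelow s x = if ⌊ toℕ x ℕ.<? s ⌋ then slim else fat

-- Vertices 0, …, s - 1 are slim, the others are fat.  The implicit arguments
-- check the axioms by evaluation.
fromEdges : ∀ {n} (s : ℕ) (edges : List (Fin n × Fin n)) →
  {True (Fin.all? {n} λ x → edge edges x x Bool.≟ false)} →
  {True (Fin.all? {n} λ x → Fin.all? λ y →
    (slimBelow s x ≟ˡ fat) →-dec (slimBelow s y ≟ˡ fat) →-dec ¬? (T? (edge edges x y)))} →
  {True (Fin.all? {n} λ x →
    (slimBelow s x ≟ˡ fat) →-dec
    Fin.any? λ y → (slimBelow s y ≟ˡ slim) ×-dec T? (edge edges x y))} →
  HoffmanGraph
fromEdges {n} s edges {loopless} {ff} {fs} = record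
  { graph    = record
    { order       = n
    ; adj         = edge edges
    ; symmetric   = λ x y → ∨-comm ⌊ (x , y) ∈ᴸ? edges ⌋ ⌊ (y , x) ∈ᴸ? edges ⌋
    ; irreflexive = toWitness loopless
    }
  ; label    = slimBelow s
  ; fat-fat  = toWitness ff
  ; fat-slim = toWitness fs
  }
  where open DecMembership (≡-dec Fin._≟_ Fin._≟_) renaming (_∈?_ to _∈ᴸ?_)

𝔣₁ : HoffmanGraph
𝔣₁ = fromEdges 1 ((x , F₁) ∷ (x , F₂) ∷ (x , F₃) ∷ [])
  where
  x F₁ F₂ F₃ : Fin 4
  x = # 0
  F₁ = # 1 ; F₂ = # 2 ; F₃ = # 3

𝔣₂ : HoffmanGraph
𝔣₂ = fromEdges 4
  ( (x₁ , x₂) ∷ (y₁ , y₂)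
  ∷ (x₁ , F₁₁) ∷ (x₁ , F₁₂) ∷ (x₂ , F₂₁) ∷ (x₂ , F₂₂)
  ∷ (y₁ , F₁₁) ∷ (y₁ , F₂₁) ∷ (y₂ , F₁₂) ∷ (y₂ , F₂₂) ∷ [])
  where
  x₁ x₂ y₁ y₂ F₁₁ F₁₂ F₂₁ F₂₂ : Fin 8
  x₁ = # 0 ; x₂ = # 1 ; y₁ = # 2 ; y₂ = # 3
  F₁₁ = # 4 ; F₁₂ = # 5 ; F₂₁ = # 6 ; F₂₂ = # 7

𝔣₃ : HoffmanGraph
𝔣₃ = fromEdges 2
  ( (x , y) ∷ (x , F) ∷ (x , F′) ∷ (y , F) ∷ (y , F′) ∷ [])
  where
  x y F F′ : Fin 4
  x = # 0 ; y = # 1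
  F = # 2 ; F′ = # 3

𝔣 : Fin 3 → HoffmanGraph
𝔣 zero             = 𝔣₁
𝔣 (suc zero)       = 𝔣₂
𝔣 (suc (suc zero)) = 𝔣₃

{-# OPTIONS --safe #-}
-- A + 3I is positive semidefinite: otherwise the supremum t of the rationals for which A - t is
-- positive semidefinite would be an eigenvalue of A below -3.  Semidefiniteness of rational matrices
-- is decided by Schur complements, and the same elimination, carried out on matrices converging to
-- A - t, yields a real kernel vector up to double negation, which suffices for a contradiction.
--
-- Let n be large.  Evaluating the form A + 3I at small vectors shows that a neighbourhood contains no
-- coclique of size 10 and that a vertex is adjacent either to all but 12 or to at most 12 members of an
-- n-clique; call it near to the clique in the first case.  Up to an error linear in n, the indicator
-- vectors of n-cliques behave like n times unit vectors, equal if the cliques have the same near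
-- vertices and orthogonal otherwise.  The classes of n-cliques are the fat vertices: subtracting from
-- each vertex its fat neighbours shows that the special matrix is nonnegative on vectors of small
-- weight, and that a vertex has at most 3 fat neighbours.  Since a large neighbourhood contains
-- n-cliques by Ramsey's theorem, (i) and (ii) force at least 2 of them.
--
-- So the diagonal entries of the special matrix are 0 or 1, and all other entries are 0, 1 or -1.  The
-- vertices with diagonal entry 1 fall into classes with entries ±1.  A class without entry -1 receives
-- a new common fat neighbour, which turns its members into copies of 𝔣₁; the other classes generate
-- 𝔣₃ or induced subgraphs of 𝔣₂.

module Submission where

open import Defs
open import Data.Bool using (Bool; true; false; T; T?; not; _∧_; _∨_; if_then_else_)
import Data.Bool.Properties as Bool
open import Data.Fin using (Fin; zero; suc; #_)
import Data.Fin.Properties as Fin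
open import Data.List using (List; []; _∷_; length; map; filter; allFin; lookup)
open import Data.List.Relation.Unary.All as All using (All; []; _∷_)
open import Data.List.Relation.Unary.AllPairs as AllPairs using (AllPairs; []; _∷_)
import Data.List.Relation.Unary.AllPairs.Properties as AllPairs
open import Data.List.Relation.Unary.Any using (here; there)
open import Data.Nat as ℕ using (ℕ; zero; suc)
import Data.Nat.Properties as ℕ
open import Data.Product using (Σ; ∃-syntax; _×_; _,_; proj₁; proj₂)
open import Data.Sum using (_⊎_; inj₁; inj₂; [_,_]′)
open import Function using (_∘_; id)
open import Relation.Binary.PropositionalEquality
open import Relation.Nullary using (Dec; yes; no; ¬_; contradiction; does)

-- Every estimate evaluates A + 3I at an integer combination of vertices and clique indicators. With
-- vertices scaled by n, each inner product is n² times a small integer up to an error of 38n. A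
-- combination of weight w then has value n² times an integer up to 38 w² n, and a negative integer
-- is impossible once n exceeds 38 w². Integrality thus replaces a limit argument, but only for
-- bounded weight. The bound w = 20 arises as 5 · 4: a combination of weight 5 in which each vertex
-- is replaced by itself minus at most 3 cliques. Hence the special matrix is never shown to be
-- semidefinite; tests on two or three vertices suffice, because its entries are integers and its
-- diagonal is at most 1.
--
-- The special matrix of the overview, `special` in the code, is S(𝔥) + 3I: its diagonal entry is 3
-- minus the number of fat neighbours. It behaves like a Gram matrix of vectors of length 0 or 1, so
-- that an entry 1 means equal vectors and an entry -1 opposite ones.

-- Rational quadratic forms and their elimination by Schur complements

module Quad where
  open import Data.Rational using (ℚ; 0ℚ; 1ℚ; _+_; _*_; -_; _-_; _<_; _≤_; positive; nonNegative; negative; _≟_)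
  open import Data.Rational.Properties as ℚ hiding (_≟_)
  open import Data.Rational.Solver using (module +-*-Solver)
  import Data.Vec.Functional as Vector
  open import Relation.Binary.Definitions using (tri<; tri≈; tri>)
  open import Relation.Nullary.Decidable using (¬?; decidable-stable)
  open +-*-Solver

  ∑ : ∀ {n} → (Fin n → ℚ) → ℚ
  ∑ = Vector.foldr _+_ 0ℚ

  ∑-cong : ∀ {n} {f g : Fin n → ℚ} → (∀ i → f i ≡ g i) → ∑ f ≡ ∑ g
  ∑-cong {zero}  eq = refl
  ∑-cong {suc n} eq = cong₂ _+_ (eq zero) (∑-cong (eq ∘ suc))

  ∑-zero : ∀ n → ∑ {n} (λ _ → 0ℚ) ≡ 0ℚ
  ∑-zero zero    = refl
  ∑-zero (suc n) = trans (ℚ.+-identityˡ _) (∑-zero n)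

  ∑-+ : ∀ {n} (f g : Fin n → ℚ) → ∑ (λ i → f i + g i) ≡ ∑ f + ∑ g
  ∑-+ {zero}  f g = refl
  ∑-+ {suc n} f g = trans (cong (f zero + g zero +_) (∑-+ (f ∘ suc) (g ∘ suc)))
    (solve 4 (λ a b c d → (a :+ b) :+ (c :+ d) := (a :+ c) :+ (b :+ d)) refl
      (f zero) (g zero) (∑ (f ∘ suc)) (∑ (g ∘ suc)))

  ∑-* : ∀ {n} c (f : Fin n → ℚ) → ∑ (λ i → c * f i) ≡ c * ∑ f
  ∑-* {zero}  c f = sym (ℚ.*-zeroʳ c)
  ∑-* {suc n} c f = trans (cong (c * f zero +_) (∑-* c (f ∘ suc)))
    (sym (ℚ.*-distribˡ-+ c (f zero) (∑ (f ∘ suc))))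

  ∑-mono : ∀ {n} {f g : Fin n → ℚ} → (∀ i → f i ≤ g i) → ∑ f ≤ ∑ g
  ∑-mono {zero}  le = ℚ.≤-refl
  ∑-mono {suc n} le = ℚ.+-mono-≤ (le zero) (∑-mono (le ∘ suc))

  ∑-nonneg : ∀ {n} {f : Fin n → ℚ} → (∀ i → 0ℚ ≤ f i) → 0ℚ ≤ ∑ f
  ∑-nonneg {n} {f} f≥0 = subst (_≤ ∑ f) (∑-zero n) (∑-mono f≥0)

  single : ∀ {n} → Fin n → ℚ → Fin n → ℚ
  single zero    t zero    = t
  single zero    t (suc i) = 0ℚ
  single (suc j) t zero    = 0ℚ
  single (suc j) t (suc i) = single j t i

  ∑-single : ∀ {n} (f : Fin n → ℚ) j t → ∑ (λ i → f i * single j t i) ≡ f j * t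
  ∑-single {suc n} f zero t = trans
    (cong (f zero * t +_) (trans (∑-cong (λ i → ℚ.*-zeroʳ (f (suc i)))) (∑-zero n)))
    (ℚ.+-identityʳ _)
  ∑-single f (suc j) t = trans
    (cong₂ _+_ (ℚ.*-zeroʳ (f zero)) (∑-single (f ∘ suc) j t))
    (ℚ.+-identityˡ _)

  dot : ∀ {n} → (Fin n → ℚ) → (Fin n → ℚ) → ℚ
  dot x y = ∑ λ i → x i * y i

  apply : ∀ {n} → Matrix ℚ n → (Fin n → ℚ) → Fin n → ℚ
  apply M x i = dot (M i) x

  quad : ∀ {n} → Matrix ℚ n → (Fin n → ℚ) → ℚ
  quad M x = dot x (apply M x)

  Symmetric : ∀ {n} {A : Set} → Matrix A n → Set
  Symmetric M = ∀ i j → M i j ≡ M j i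

  PSD : ∀ {n} → Matrix ℚ n → Set
  PSD M = ∀ x → 0ℚ ≤ quad M x

  sq-nonneg : ∀ p → 0ℚ ≤ p * p
  sq-nonneg p with ℚ.≤-total 0ℚ p
  ... | inj₁ 0≤p = subst (_≤ p * p) (ℚ.*-zeroʳ p) (ℚ.*-monoˡ-≤-nonNeg p ⦃ nonNegative 0≤p ⦄ 0≤p)
  ... | inj₂ p≤0 = subst (_≤ p * p) (ℚ.*-zeroʳ p) (ℚ.*-monoˡ-≤-nonPos p ⦃ ℚ.nonPositive p≤0 ⦄ p≤0)
    where import Data.Rational as ℚ

  *-positive : ∀ {p q} → 0ℚ < p → 0ℚ < q → 0ℚ < p * q
  *-positive {p} {q} p>0 q>0 = subst (_< p * q) (ℚ.*-zeroʳ p) (ℚ.*-monoʳ-<-pos p ⦃ positive p>0 ⦄ q>0)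

  *-nonneg : ∀ {p q} → 0ℚ ≤ p → 0ℚ ≤ q → 0ℚ ≤ p * q
  *-nonneg {p} {q} p≥0 q≥0 = subst (_≤ p * q) (ℚ.*-zeroʳ p) (ℚ.*-monoˡ-≤-nonNeg p ⦃ nonNegative p≥0 ⦄ q≥0)

  module _ {n} (M : Matrix ℚ (suc n)) where
    corner : ℚ
    corner = M zero zero

    row : Fin n → ℚ
    row j = M zero (suc j)

    block : Matrix ℚ n
    block i j = M (suc i) (suc j)

    -- The usual Schur complement multiplied by the corner entry. Being free of division, the
    -- formula can be copied for real entries, whose inverses would require a bound away from zero.
    schur : Matrix ℚ n
    schur i j = corner * block i j + (- 1ℚ) * (row i * row j)

  _∷ᵛ_ : ∀ {n} {A : Set} → A → (Fin n → A) → Fin (suc n) → A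
  _∷ᵛ_ = Vector._∷_

  quad-split : ∀ {n} (M : Matrix ℚ (suc n)) → Symmetric M → ∀ x₀ y →
    quad M (x₀ ∷ᵛ y) ≡ corner M * (x₀ * x₀) + (1ℚ + 1ℚ) * (x₀ * dot (row M) y) + quad (block M) y
  quad-split M symM x₀ y = begin
    x₀ * (corner M * x₀ + dot (row M) y) + ∑ (λ i → y i * (M (suc i) zero * x₀ + apply (block M) y i))
      ≡⟨ cong (x₀ * (corner M * x₀ + dot (row M) y) +_) (trans (∑-cong expand) (∑-+ (λ i → x₀ * (row M i * y i)) (λ i → y i * apply (block M) y i))) ⟩
    x₀ * (corner M * x₀ + dot (row M) y) + (∑ (λ i → x₀ * (row M i * y i)) + quad (block M) y)
      ≡⟨ cong (λ t → x₀ * (corner M * x₀ + dot (row M) y) + (t + quad (block M) y)) (∑-* x₀ (λ i → row M i * y i)) ⟩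
    x₀ * (corner M * x₀ + dot (row M) y) + (x₀ * dot (row M) y + quad (block M) y)
      ≡⟨ solve 4 (λ x a b q → x :* (a :* x :+ b) :+ (x :* b :+ q)
            := a :* (x :* x) :+ (con 1ℚ :+ con 1ℚ) :* (x :* b) :+ q) refl
            x₀ (corner M) (dot (row M) y) (quad (block M) y) ⟩
    _ ∎
    where
    open ≡-Reasoning
    expand : ∀ i → y i * (M (suc i) zero * x₀ + apply (block M) y i) ≡
                   x₀ * (row M i * y i) + y i * apply (block M) y i
    expand i = trans (cong (λ t → y i * (t * x₀ + apply (block M) y i)) (symM (suc i) zero))
      (solve 4 (λ y m x c → y :* (m :* x :+ c) := x :* (m :* y) :+ y :* c) refl
        (y i) (row M i) x₀ (apply (block M) y i))

  apply-schur : ∀ {n} (M : Matrix ℚ (suc n)) y i →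
    apply (schur M) y i ≡ corner M * apply (block M) y i - row M i * dot (row M) y
  apply-schur M y i = begin
    ∑ (λ j → schur M i j * y j)
      ≡⟨ trans (∑-cong λ j → solve 5 (λ a c r s y → (a :* c :+ con (- 1ℚ) :* (r :* s)) :* y
                := a :* (c :* y) :+ (:- r) :* (s :* y)) refl
                (corner M) (block M i j) (row M i) (row M j) (y j))
            (∑-+ (λ j → corner M * (block M i j * y j)) (λ j → - row M i * (row M j * y j))) ⟩
    ∑ (λ j → corner M * (block M i j * y j)) + ∑ (λ j → - row M i * (row M j * y j))
      ≡⟨ cong₂ _+_ (∑-* (corner M) (λ j → block M i j * y j)) (∑-* (- row M i) (λ j → row M j * y j)) ⟩
    corner M * apply (block M) y i + - row M i * dot (row M) y
      ≡⟨ cong (corner M * apply (block M) y i +_) (ℚ.neg-distribˡ-* (row M i) _) ⟨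
    _ ∎
    where open ≡-Reasoning

  quad-schur : ∀ {n} (M : Matrix ℚ (suc n)) y →
    quad (schur M) y ≡ corner M * quad (block M) y - dot (row M) y * dot (row M) y
  quad-schur M y = begin
    ∑ (λ i → y i * apply (schur M) y i)
      ≡⟨ trans (∑-cong λ i → trans (cong (y i *_) (apply-schur M y i))
            (solve 5 (λ y a c r s → y :* (a :* c :- r :* s) := a :* (y :* c) :+ (:- s) :* (r :* y)) refl
                (y i) (corner M) (apply (block M) y i) (row M i) (dot (row M) y)))
            (∑-+ (λ i → corner M * (y i * apply (block M) y i)) (λ i → - dot (row M) y * (row M i * y i))) ⟩
    ∑ (λ i → corner M * (y i * apply (block M) y i)) + ∑ (λ i → - dot (row M) y * (row M i * y i))
      ≡⟨ cong₂ _+_ (∑-* (corner M) (λ i → y i * apply (block M) y i)) (∑-* (- dot (row M) y) (λ i → row M i * y i)) ⟩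
    corner M * quad (block M) y + - dot (row M) y * dot (row M) y
      ≡⟨ cong (corner M * quad (block M) y +_) (ℚ.neg-distribˡ-* (dot (row M) y) _) ⟨
    _ ∎
    where open ≡-Reasoning

  -- The factor `corner M` turns the completion of the square into a polynomial identity. For a
  -- positive corner it shows that M and its Schur complement are semidefinite together.
  complete-square : ∀ {n} (M : Matrix ℚ (suc n)) → Symmetric M → ∀ x₀ y →
    let u = corner M * x₀ + dot (row M) y in
    corner M * quad M (x₀ ∷ᵛ y) ≡ u * u + quad (schur M) y
  complete-square M symM x₀ y = begin
    corner M * quad M (x₀ ∷ᵛ y)
      ≡⟨ cong (corner M *_) (quad-split M symM x₀ y) ⟩
    corner M * (corner M * (x₀ * x₀) + (1ℚ + 1ℚ) * (x₀ * dot (row M) y) + quad (block M) y)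
      ≡⟨ solve 4 (λ a x b q → a :* (a :* (x :* x) :+ (con 1ℚ :+ con 1ℚ) :* (x :* b) :+ q)
           := (a :* x :+ b) :* (a :* x :+ b) :+ (a :* q :- b :* b)) refl
           (corner M) x₀ (dot (row M) y) (quad (block M) y) ⟩
    _
      ≡⟨ cong ((corner M * x₀ + dot (row M) y) * (corner M * x₀ + dot (row M) y) +_) (quad-schur M y) ⟨
    _ ∎
    where open ≡-Reasoning

  -- The point over `y` where the square `u` of `complete-square` vanishes, scaled by the corner to
  -- avoid a division.
  lift : ∀ {n} → Matrix ℚ (suc n) → (Fin n → ℚ) → Fin (suc n) → ℚ
  lift M y = (- 1ℚ * dot (row M) y) ∷ᵛ (λ i → corner M * y i)

  dot-scale : ∀ {n} c (f y : Fin n → ℚ) → dot f (λ i → c * y i) ≡ c * dot f y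
  dot-scale c f y = trans (∑-cong λ i → solve 3 (λ f c y → f :* (c :* y) := c :* (f :* y)) refl (f i) c (y i))
    (∑-* c (λ i → f i * y i))

  quad-scale : ∀ {n} (M : Matrix ℚ n) c y → quad M (λ i → c * y i) ≡ c * (c * quad M y)
  quad-scale M c y = trans
    (∑-cong λ i → trans (cong (c * y i *_) (dot-scale c (M i) y))
      (solve 3 (λ c y m → c :* y :* (c :* m) := c :* (c :* (y :* m))) refl c (y i) (apply M y i)))
    (trans (∑-* c (λ i → c * (y i * apply M y i))) (cong (c *_) (∑-* c (λ i → y i * apply M y i))))

  quad-lift : ∀ {n} (M : Matrix ℚ (suc n)) → Symmetric M → ∀ y →
    quad M (lift M y) ≡ corner M * quad (schur M) y
  quad-lift M symM y = begin
    quad M (lift M y)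
      ≡⟨ quad-split M symM (- 1ℚ * b) (λ i → a * y i) ⟩
    a * (- 1ℚ * b * (- 1ℚ * b)) + (1ℚ + 1ℚ) * (- 1ℚ * b * dot (row M) (λ i → a * y i)) + quad (block M) (λ i → a * y i)
      ≡⟨ cong₂ (λ s t → a * (- 1ℚ * b * (- 1ℚ * b)) + (1ℚ + 1ℚ) * (- 1ℚ * b * s) + t)
           (dot-scale a (row M) y) (quad-scale (block M) a y) ⟩
    a * (- 1ℚ * b * (- 1ℚ * b)) + (1ℚ + 1ℚ) * (- 1ℚ * b * (a * b)) + a * (a * q)
      ≡⟨ solve 3 (λ a b q → a :* (con (- 1ℚ) :* b :* (con (- 1ℚ) :* b)) :+ (con 1ℚ :+ con 1ℚ) :* (con (- 1ℚ) :* b :* (a :* b)) :+ a :* (a :* q)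
           := a :* (a :* q :- b :* b)) refl a b q ⟩
    a * (a * q - b * b)
      ≡⟨ cong (a *_) (quad-schur M y) ⟨
    _ ∎
    where
    open ≡-Reasoning
    a = corner M
    b = dot (row M) y
    q = quad (block M) y

  schur-symmetric : ∀ {n} (M : Matrix ℚ (suc n)) → Symmetric M → Symmetric (schur M)
  schur-symmetric M symM i j = cong₂ (λ s t → corner M * s + (- 1ℚ) * t)
    (symM (suc i) (suc j)) (ℚ.*-comm (row M i) (row M j))

  quad-single : ∀ {n} (M : Matrix ℚ n) i t → quad M (single i t) ≡ M i i * (t * t)
  quad-single M i t = begin
    ∑ (λ k → single i t k * apply M (single i t) k)
      ≡⟨ ∑-cong (λ k → trans (cong (single i t k *_) (∑-single (M k) i t)) (ℚ.*-comm (single i t k) _)) ⟩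
    ∑ (λ k → M k i * t * single i t k)
      ≡⟨ ∑-single (λ k → M k i * t) i t ⟩
    M i i * t * t
      ≡⟨ ℚ.*-assoc (M i i) t t ⟩
    _ ∎
    where open ≡-Reasoning

  quad-pair : ∀ {n} (M : Matrix ℚ (suc n)) → Symmetric M → ∀ s j t →
    quad M (s ∷ᵛ single j t) ≡ corner M * (s * s) + (1ℚ + 1ℚ) * (s * (row M j * t)) + block M j j * (t * t)
  quad-pair M symM s j t = trans (quad-split M symM s (single j t))
    (cong₂ (λ u v → corner M * (s * s) + (1ℚ + 1ℚ) * (s * u) + v) (∑-single (row M) j t) (quad-single (block M) j t))

  private
    negate : ∀ {p} → p < 0ℚ → ∀ {q} → 0ℚ < q → q * p < 0ℚ
    negate {p} p<0 {q} q>0 = subst (q * p <_) (ℚ.*-zeroʳ q) (ℚ.*-monoʳ-<-pos q ⦃ positive q>0 ⦄ p<0)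

    cancel : ∀ {a p} → 0ℚ < a → 0ℚ ≤ a * p → 0ℚ ≤ p
    cancel {a} {p} a>0 le = ℚ.*-cancelˡ-≤-pos a ⦃ positive a>0 ⦄ (subst (_≤ a * p) (sym (ℚ.*-zeroʳ a)) le)

  schur-psd : ∀ {n} (M : Matrix ℚ (suc n)) → Symmetric M → 0ℚ < corner M → PSD M → PSD (schur M)
  schur-psd M symM a>0 psd y = cancel a>0 (subst (0ℚ ≤_) (quad-lift M symM y) (psd (lift M y)))

  psd-from-schur : ∀ {n} (M : Matrix ℚ (suc n)) → Symmetric M → 0ℚ < corner M → PSD (schur M) → ∀ x₀ y → 0ℚ ≤ quad M (x₀ ∷ᵛ y)
  psd-from-schur M symM a>0 psd x₀ y = cancel a>0 (subst (0ℚ ≤_) (sym (complete-square M symM x₀ y))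
    (ℚ.+-mono-≤ (sq-nonneg (corner M * x₀ + dot (row M) y)) (psd y)))

  -- Vectors are functions, so `x` agrees with `x zero ∷ᵛ (x ∘ suc)` only pointwise, and the form
  -- has to be carried along this agreement.
  psd-∷ : ∀ {n} (M : Matrix ℚ (suc n)) → (∀ x₀ y → 0ℚ ≤ quad M (x₀ ∷ᵛ y)) → PSD M
  psd-∷ M h x = subst (0ℚ ≤_)
    (∑-cong λ i → cong₂ _*_ (η i) (∑-cong λ j → cong (M i j *_) (η j)))
    (h (x zero) (x ∘ suc))
    where
    η : ∀ i → (x zero ∷ᵛ (x ∘ suc)) i ≡ x i
    η zero    = refl
    η (suc i) = refl

  -- The sign of the corner decides how to go on: a negative corner is itself a witness, a positive
  -- one reduces the question to `schur`, and a zero corner either yields a witness from a nonzero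
  -- entry of its row or can be deleted.
  psd? : ∀ {n} (M : Matrix ℚ n) → Symmetric M → PSD M ⊎ ∃[ x ] quad M x < 0ℚ
  psd? {zero}  M symM = inj₁ λ x → ℚ.≤-refl
  psd? {suc n} M symM with ℚ.<-cmp (corner M) 0ℚ
  ... | tri< a<0 _ _ = inj₂ (single zero 1ℚ , subst (_< 0ℚ) (sym (trans (quad-single M zero 1ℚ) (ℚ.*-identityʳ _))) a<0)
  ... | tri> _ _ a>0 with psd? (schur M) (schur-symmetric M symM)
  ...   | inj₁ psd      = inj₁ (psd-∷ M (psd-from-schur M symM a>0 psd))
  ...   | inj₂ (y , lt) = inj₂ (lift M y , subst (_< 0ℚ) (sym (quad-lift M symM y)) (negate lt a>0))
  psd? {suc n} M symM | tri≈ _ a≡0 _ with Fin.any? (λ j → ¬? (row M j ≟ 0ℚ))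
  ... | yes (j , b≢0) = inj₂ (s ∷ᵛ single j b , subst (_< 0ℚ) (sym eq) (negate (ℚ.negative⁻¹ (- 1ℚ)) positive-b²))
    where
    b = row M j
    c = block M j j
    -- On the span of e₀ and eⱼ the form is 2 b s t + c t², which is -b² at this point.
    s = - ((c + 1ℚ) * ½)
      where open import Data.Rational using (½)
    positive-b² : 0ℚ < b * b
    positive-b² with ℚ.<-cmp b 0ℚ
    ... | tri< b<0 _ _ = subst (_< b * b) (ℚ.*-zeroʳ b) (ℚ.*-monoʳ-<-neg b ⦃ negative b<0 ⦄ b<0)
    ... | tri≈ _ b≡0 _ = contradiction b≡0 b≢0
    ... | tri> _ _ b>0 = *-positive b>0 b>0
    eq : quad M (s ∷ᵛ single j b) ≡ b * b * (- 1ℚ)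
    eq = trans (quad-pair M symM s j b)
      (trans (cong (λ a → a * (s * s) + (1ℚ + 1ℚ) * (s * (b * b)) + c * (b * b)) a≡0)
        (solve 2 (λ b c → con 0ℚ :* ((:- ((c :+ con 1ℚ) :* con ½)) :* (:- ((c :+ con 1ℚ) :* con ½)))
            :+ (con 1ℚ :+ con 1ℚ) :* ((:- ((c :+ con 1ℚ) :* con ½)) :* (b :* b)) :+ c :* (b :* b)
            := b :* b :* con (- 1ℚ)) refl b c))
      where open import Data.Rational using (½)
  ... | no all-zero with psd? (block M) (λ i j → symM (suc i) (suc j))
  ...   | inj₁ psd = inj₁ (psd-∷ M λ x₀ y → subst (0ℚ ≤_) (sym (quad-degenerate x₀ y)) (psd y))
    where
    row≡0 : ∀ j → row M j ≡ 0ℚ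
    row≡0 j = decidable-stable (row M j ≟ 0ℚ) λ ne → all-zero (j , ne)
    quad-degenerate : ∀ x₀ y → quad M (x₀ ∷ᵛ y) ≡ quad (block M) y
    quad-degenerate x₀ y = trans (quad-split M symM x₀ y)
      (trans (cong₂ (λ a b → a * (x₀ * x₀) + (1ℚ + 1ℚ) * (x₀ * b) + quad (block M) y) a≡0
        (trans (∑-cong λ j → trans (cong (_* y j) (row≡0 j)) (ℚ.*-zeroˡ (y j))) (∑-zero n)))
        (solve 2 (λ x q → con 0ℚ :* (x :* x) :+ (con 1ℚ :+ con 1ℚ) :* (x :* con 0ℚ) :+ q := q) refl x₀ (quad (block M) y)))
  ...   | inj₂ (y , lt) = inj₂ (0ℚ ∷ᵛ y , subst (_< 0ℚ) (sym (trans (quad-split M symM 0ℚ y)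
          (solve 3 (λ a b q → a :* (con 0ℚ :* con 0ℚ) :+ (con 1ℚ :+ con 1ℚ) :* (con 0ℚ :* b) :+ q := q) refl
            (corner M) (dot (row M) y) (quad (block M) y)))) lt)

-- Convergent sequences of semidefinite matrices and real kernel vectors

module Limit where
  open Quad
  open import Data.Nat using (_⊔_)
  open import Data.Rational using (ℚ; 0ℚ; 1ℚ; ½; _+_; _*_; -_; _-_; _<_; _≤_; ∣_∣; Positive; NonZero; positive; nonNegative; 1/_; _<?_; _≤?_)
  open import Data.Rational.Properties as ℚ hiding (_<?_; _≤?_)
  open import Data.Rational.Solver using (module +-*-Solver)
  open +-*-Solver

  Eventually : (ℕ → Set) → Set
  Eventually P = ∃[ N ] ∀ k → N ℕ.≤ k → P k

  ev-map : ∀ {P Q : ℕ → Set} → (∀ k → P k → Q k) → Eventually P → Eventually Q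
  ev-map f (N , h) = N , λ k N≤k → f k (h k N≤k)

  ev-× : ∀ {P Q : ℕ → Set} → Eventually P → Eventually Q → Eventually (λ k → P k × Q k)
  ev-× (M , p) (N , q) = M ⊔ N , λ k le →
    p k (ℕ.m⊔n≤o⇒m≤o M N le) , q k (ℕ.m⊔n≤o⇒n≤o M N le)

  ev-map₂ : ∀ {P Q R : ℕ → Set} → (∀ k → P k → Q k → R k) →
            Eventually P → Eventually Q → Eventually R
  ev-map₂ f p q = ev-map (λ k (a , b) → f k a b) (ev-× p q)

  ev-Fin : ∀ {n} {P : Fin n → ℕ → Set} → (∀ i → Eventually (P i)) → Eventually (λ k → ∀ i → P i k)
  ev-Fin {zero}  h = 0 , λ _ _ ()
  ev-Fin {suc n} {P} h = ev-map₂ both (h zero) (ev-Fin (h ∘ suc))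
    where
    both : ∀ k → P zero k → (∀ i → P (suc i) k) → ∀ i → P i k
    both k p q zero    = p
    both k p q (suc i) = q i

  from-diff : ∀ {p q} → 0ℚ ≤ q - p → p ≤ q
  from-diff {p} {q} le = subst₂ _≤_ (ℚ.+-identityˡ p)
    (solve 2 (λ q p → q :- p :+ p := q) refl q p) (ℚ.+-monoˡ-≤ p le)

  to-diff : ∀ {p q} → p ≤ q → 0ℚ ≤ q - p
  to-diff {p} {q} le = subst (_≤ q - p) (ℚ.+-inverseʳ p) (ℚ.+-monoˡ-≤ (- p) le)

  from-diff-< : ∀ {p q} → 0ℚ < q - p → p < q
  from-diff-< {p} {q} lt = subst₂ _<_ (ℚ.+-identityˡ p)
    (solve 2 (λ q p → q :- p :+ p := q) refl q p) (ℚ.+-monoˡ-< p lt)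

  to-diff-< : ∀ {p q} → p < q → 0ℚ < q - p
  to-diff-< {p} {q} lt = subst (_< q - p) (ℚ.+-inverseʳ p) (ℚ.+-monoˡ-< (- p) lt)

  +-nonneg : ∀ {p q} → 0ℚ ≤ p → 0ℚ ≤ q → 0ℚ ≤ p + q
  +-nonneg p≥0 q≥0 = ℚ.+-mono-≤ p≥0 q≥0

  +-positive : ∀ {p q} → 0ℚ < p → 0ℚ < q → 0ℚ < p + q
  +-positive p>0 q>0 = ℚ.+-mono-< p>0 q>0

  ≤∣∣ : ∀ p → p ≤ ∣ p ∣
  ≤∣∣ p with ℚ.≤-total 0ℚ p
  ... | inj₁ 0≤p = ℚ.≤-reflexive (sym (ℚ.0≤p⇒∣p∣≡p 0≤p))
  ... | inj₂ p≤0 = ℚ.≤-trans p≤0 (ℚ.0≤∣p∣ p)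

  ∣∣<⇒< : ∀ {p q ε} → ∣ p - q ∣ < ε → p < q + ε
  ∣∣<⇒< {p} {q} {ε} lt = from-diff-< (subst (0ℚ <_)
    (solve 3 (λ p q ε → ε :- (p :- q) := q :+ ε :- p) refl p q ε)
    (to-diff-< (ℚ.≤-<-trans (≤∣∣ (p - q)) lt)))

  ∣-∣-sym : ∀ p q → ∣ p - q ∣ ≡ ∣ q - p ∣
  ∣-∣-sym p q = trans (cong ∣_∣ (solve 2 (λ p q → p :- q := :- (q :- p)) refl p q)) (ℚ.∣-p∣≡∣p∣ (q - p))

  ∣∣<⇒> : ∀ {p q ε} → ∣ p - q ∣ < ε → q < p + ε
  ∣∣<⇒> {p} {q} {ε} lt = ∣∣<⇒< (subst (_< ε) (∣-∣-sym p q) lt)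

  abstract
    inverse : ∀ {p} → 0ℚ < p → ∃[ q ] 0ℚ < q × p * q ≡ 1ℚ
    inverse {p} p>0 = 1/ p , ℚ.positive⁻¹ (1/ p) ⦃ ℚ.1/pos⇒pos p ⦄ , ℚ.*-inverseʳ p
      where
      instance
        p-positive : Positive p
        p-positive = positive p>0
        p-nonZero : NonZero p
        p-nonZero = ℚ.pos⇒nonZero p

  *-monoˡ : ∀ {p q r} → 0ℚ ≤ r → p ≤ q → r * p ≤ r * q
  *-monoˡ {r = r} r≥0 le = ℚ.*-monoˡ-≤-nonNeg r ⦃ nonNegative r≥0 ⦄ le

  ∣∣<-from-sq : ∀ {p ε} → 0ℚ < ε → p * p < ε * ε → ∣ p ∣ < ε
  ∣∣<-from-sq {p} {ε} ε>0 lt with ∣ p ∣ <? ε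
  ... | yes <ε = <ε
  ... | no ≮ε = contradiction (ℚ.<-≤-trans lt (subst (ε * ε ≤_) sq bound)) (ℚ.<-irrefl refl)
    where
    ε≤ = ℚ.≮⇒≥ ≮ε
    bound : ε * ε ≤ ∣ p ∣ * ∣ p ∣
    bound = ℚ.≤-trans (*-monoˡ (ℚ.<⇒≤ ε>0) ε≤)
      (ℚ.*-monoʳ-≤-nonNeg ∣ p ∣ ⦃ nonNegative (ℚ.0≤∣p∣ p) ⦄ ε≤)
    sq : ∣ p ∣ * ∣ p ∣ ≡ p * p
    sq = trans (sym (ℚ.∣p*q∣≡∣p∣*∣q∣ p p)) (ℚ.0≤p⇒∣p∣≡p (sq-nonneg p))

  zeroᵣ : ℝ
  zeroᵣ = fromℚ 0ℚ

  null-cong : ∀ {x y} → (∀ k → seq x k ≡ seq y k) → x ≈ᵣ zeroᵣ → y ≈ᵣ zeroᵣ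
  null-cong eq null ε ε>0 = ev-map (λ k → subst (λ t → ∣ t - 0ℚ ∣ < ε) (eq k)) (null ε ε>0)

  minus-zero : ∀ p → p - 0ℚ ≡ p
  minus-zero p = ℚ.+-identityʳ p

  seq-∑ : ∀ {n} (f : Fin n → ℝ) k → seq (∑ᵣ f) k ≡ ∑ (λ i → seq (f i) k)
  seq-∑ {zero}  f k = refl
  seq-∑ {suc n} f k = cong (seq (f zero) k +_) (seq-∑ (f ∘ suc) k)

  abstract
    upper : ∀ x → ∃[ B ] 0ℚ < B × Eventually (λ k → seq x k < B)
    upper x with cauchy x 1ℚ (ℚ.positive⁻¹ 1ℚ)
    ... | N , close = ∣ seq x N ∣ + 1ℚ , ℚ.+-mono-≤-< (ℚ.0≤∣p∣ (seq x N)) (ℚ.positive⁻¹ 1ℚ) ,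
      N , λ k N≤k → ℚ.<-≤-trans (∣∣<⇒< {seq x k} {seq x N} (close k N N≤k ℕ.≤-refl)) (ℚ.+-monoˡ-≤ 1ℚ (≤∣∣ (seq x N)))

  BoundedAway : ℝ → Set
  BoundedAway x = ∃[ c ] 0ℚ < c × Eventually (λ k → c ≤ seq x k)

  abstract
    quarter : ∀ ε → 0ℚ < ε → ∃[ δ ] 0ℚ < δ × δ + δ + (δ + δ) ≡ ε
    quarter ε ε>0 = ε * ½ * ½ , *-positive (*-positive ε>0 (ℚ.positive⁻¹ ½)) (ℚ.positive⁻¹ ½) ,
      solve 1 (λ ε → ε :* con ½ :* con ½ :+ ε :* con ½ :* con ½ :+ (ε :* con ½ :* con ½ :+ ε :* con ½ :* con ½) := ε) refl ε

  -- Vanishing of a real number is not decidable, hence the double negation. If both alternatives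
  -- are refuted, each tolerance ε = 4δ can be tested at one late index: a value below 2δ there
  -- keeps all later values below ε, while a value of at least 2δ would keep them above δ.
  null-or-away : ∀ x → Eventually (λ k → 0ℚ ≤ seq x k) → ¬ ¬ (x ≈ᵣ zeroᵣ ⊎ BoundedAway x)
  null-or-away x x≥0 neither = neither (inj₁ λ ε ε>0 → small ε ε>0)
    where
    small : ∀ ε → 0ℚ < ε → Eventually (λ k → ∣ seq x k - 0ℚ ∣ < ε)
    small ε ε>0 with quarter ε ε>0
    ... | δ , δ>0 , 4δ≡ε with cauchy x δ δ>0
    ... | N , close with seq x N <? δ + δ
    ...   | yes lt = ev-map₂ (λ k nonneg lt′ → subst (_< ε)
              (sym (trans (cong ∣_∣ (minus-zero (seq x k))) (ℚ.0≤p⇒∣p∣≡p nonneg))) lt′) x≥0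
            (N , λ k N≤k → ℚ.<-trans (∣∣<⇒< {seq x k} {seq x N} (close k N N≤k ℕ.≤-refl))
              (subst (seq x N + δ <_) 4δ≡ε (ℚ.+-mono-<-≤ lt
                (subst (_≤ δ + δ) (ℚ.+-identityʳ δ) (ℚ.+-monoʳ-≤ δ (ℚ.<⇒≤ δ>0))))))
    ...   | no ≮ = contradiction (inj₂ (δ , δ>0 , N , λ k N≤k → from-diff (subst (0ℚ ≤_)
              (solve 3 (λ x y d → (y :- (d :+ d)) :+ (x :+ d :- y) := x :- d) refl (seq x k) (seq x N) δ)
              (+-nonneg (to-diff (ℚ.≮⇒≥ ≮)) (ℚ.<⇒≤ (to-diff-< (∣∣<⇒> {seq x k} {seq x N} (close k N N≤k ℕ.≤-refl)))))))) neither

  atTime : ∀ {n} → Matrix ℝ n → ℕ → Matrix ℚ n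
  atTime M k i j = seq (M i j) k

  mulᵣ : ∀ {n} → Matrix ℝ n → (Fin n → ℝ) → Fin n → ℝ
  mulᵣ M v i = ∑ᵣ λ j → M i j *ᵣ v j

  Kernel : ∀ {n} → Matrix ℝ n → Set
  Kernel {n} M = Σ (Fin n → ℝ) λ v → ¬ (∀ i → v i ≈ᵣ zeroᵣ) × (∀ i → mulᵣ M v i ≈ᵣ zeroᵣ)

  -- Positive definiteness with one constant for all late approximations. Bounding the coordinates
  -- separately, instead of the norm, suits an induction on the dimension.
  Coercive : ∀ {n} → Matrix ℝ n → Set
  Coercive M = ∃[ K ] 0ℚ < K × Eventually (λ k → ∀ x i → x i * x i ≤ K * quad (atTime M k) x)

  schurᵣ : ∀ {n} → Matrix ℝ (suc n) → Matrix ℝ n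
  schurᵣ M i j = M zero zero *ᵣ M (suc i) (suc j) +ᵣ fromℚ (- 1ℚ) *ᵣ (M zero (suc i) *ᵣ M zero (suc j))

  apply-lift-zero : ∀ {n} (M : Matrix ℚ (suc n)) y → apply M (lift M y) zero ≡ 0ℚ
  apply-lift-zero M y = trans (cong (corner M * (- 1ℚ * dot (row M) y) +_) (dot-scale (corner M) (row M) y))
    (solve 2 (λ a b → a :* (con (- 1ℚ) :* b) :+ a :* b := con 0ℚ) refl (corner M) (dot (row M) y))

  apply-lift-suc : ∀ {n} (M : Matrix ℚ (suc n)) → Symmetric M → ∀ y i →
    apply M (lift M y) (suc i) ≡ apply (schur M) y i
  apply-lift-suc M symM y i = trans
    (cong₂ (λ s t → s * (- 1ℚ * dot (row M) y) + t) (symM (suc i) zero) (dot-scale (corner M) (block M i) y))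
    (trans (solve 4 (λ r b a c → r :* (con (- 1ℚ) :* b) :+ a :* c := a :* c :- r :* b) refl
        (row M i) (dot (row M) y) (corner M) (apply (block M) y i))
      (sym (apply-schur M y i)))

  two = 1ℚ + 1ℚ

  square-sum : ∀ s t → (s + t) * (s + t) ≤ two * (s * s) + two * (t * t)
  square-sum s t = from-diff (subst (0ℚ ≤_)
    (solve 2 (λ s t → (s :- t) :* (s :- t) := con two :* (s :* s) :+ con two :* (t :* t) :- (s :+ t) :* (s :+ t)) refl s t)
    (sq-nonneg (s - t)))

  two≥0 : 0ℚ ≤ two
  two≥0 = ℚ.<⇒≤ (ℚ.positive⁻¹ two)

  -- A substitute for the Cauchy–Schwarz inequality.
  abstract
    dot-bound : ∀ {n} (β : Fin n → ℚ) → (∀ i → 0ℚ ≤ β i) → ∃[ L ] 0ℚ ≤ L ×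
      (∀ b y Q → 0ℚ ≤ Q → (∀ j → b j * b j ≤ β j) → (∀ j → y j * y j ≤ Q) → dot b y * dot b y ≤ L * Q)
    dot-bound {zero} β β≥0 = 0ℚ , ℚ.≤-refl , λ b y Q _ _ _ → ℚ.≤-reflexive (sym (ℚ.*-zeroˡ Q))
    dot-bound {suc n} β β≥0 with dot-bound (β ∘ suc) (β≥0 ∘ suc)
    ... | L , L≥0 , ih = two * β zero + two * L , +-nonneg (*-nonneg two≥0 (β≥0 zero)) (*-nonneg two≥0 L≥0) , bound
      where
      bound : ∀ b y Q → 0ℚ ≤ Q → (∀ j → b j * b j ≤ β j) → (∀ j → y j * y j ≤ Q) →
              dot b y * dot b y ≤ (two * β zero + two * L) * Q
      bound b y Q Q≥0 b≤ y≤ = ℚ.≤-trans (square-sum (b zero * y zero) (dot (b ∘ suc) (y ∘ suc))) (begin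
        two * (b zero * y zero * (b zero * y zero)) + two * (t * t)
          ≤⟨ ℚ.+-mono-≤ (*-monoˡ two≥0 first) (*-monoˡ two≥0 (ih (b ∘ suc) (y ∘ suc) Q Q≥0 (b≤ ∘ suc) (y≤ ∘ suc))) ⟩
        two * (β zero * Q) + two * (L * Q)
          ≡⟨ solve 3 (λ b l q → con two :* (b :* q) :+ con two :* (l :* q) := (con two :* b :+ con two :* l) :* q) refl (β zero) L Q ⟩
        _ ∎)
        where
        open ℚ.≤-Reasoning
        t : ℚ
        t = dot (b ∘ suc) (y ∘ suc)
        first : b zero * y zero * (b zero * y zero) ≤ β zero * Q
        first = ℚ.≤-trans (ℚ.≤-reflexive (solve 2 (λ b y → b :* y :* (b :* y) := b :* b :* (y :* y)) refl (b zero) (y zero)))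
          (ℚ.≤-trans (*-monoˡ (sq-nonneg (b zero)) (y≤ zero))
            (ℚ.*-monoʳ-≤-nonNeg Q ⦃ nonNegative Q≥0 ⦄ (b≤ zero)))

  -- Carries a coercivity bound from the Schur complement back to `M`. Both summands of
  -- `complete-square` are nonnegative, so each is at most A q; this controls the coordinates of `y`
  -- directly. The first coordinate is recovered from a x₀ = u - d, where d is bounded by the
  -- substitute for the Cauchy-Schwarz inequality and a by its lower bound `c`.
  module SchurBound {n} (M : Matrix ℚ (suc n)) (symM : Symmetric M) (p : PSD M) {A K L c c⁻² : ℚ}
    (A>0 : 0ℚ < A) (K>0 : 0ℚ < K) (L≥0 : 0ℚ ≤ L) (c>0 : 0ℚ < c) (c⁻²>0 : 0ℚ < c⁻²) (c²c⁻²≡1 : c * c * c⁻² ≡ 1ℚ)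
    (c≤aₖ : c ≤ corner M) (aₖ≤A : corner M ≤ A)
    (y≤ : ∀ y i → y i * y i ≤ K * quad (schur M) y)
    (dot≤ : ∀ y Q → 0ℚ ≤ Q → (∀ j → y j * y j ≤ Q) → dot (row M) y * dot (row M) y ≤ L * Q) where
    R K′ : ℚ
    R = two * A + two * (L * (K * A))
    K′ = K * A + c⁻² * R
    R>0 : 0ℚ < R
    R>0 = ℚ.+-mono-<-≤ (*-positive (ℚ.positive⁻¹ two) A>0)
            (*-nonneg two≥0 (*-nonneg L≥0 (ℚ.<⇒≤ (*-positive K>0 A>0))))
    module _ (x : Fin (suc n) → ℚ) where
      y : Fin n → ℚ
      y = x ∘ suc
      q u d s : ℚ
      q = quad M x
      d = dot (row M) y
      u = corner M * x zero + d
      s = quad (schur M) y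
      aq≡ : corner M * q ≡ u * u + s
      aq≡ = complete-square M symM (x zero) y
      s≥0 : 0ℚ ≤ s
      s≥0 = schur-psd M symM (ℚ.<-≤-trans c>0 c≤aₖ) p y
      aq≤Aq : corner M * q ≤ A * q
      aq≤Aq = ℚ.*-monoʳ-≤-nonNeg q ⦃ nonNegative (p x) ⦄ aₖ≤A
      s≤Aq : s ≤ A * q
      s≤Aq = ℚ.≤-trans (from-diff (subst (0ℚ ≤_)
        (trans (solve 2 (λ u s → u := u :+ s :- s) refl (u * u) s) (cong (_- s) (sym aq≡))) (sq-nonneg u))) aq≤Aq
      u²≤Aq : u * u ≤ A * q
      u²≤Aq = ℚ.≤-trans (from-diff (subst (0ℚ ≤_)
        (trans (solve 2 (λ u s → s := u :+ s :- u) refl (u * u) s) (cong (_- u * u) (sym aq≡))) s≥0)) aq≤Aq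
      y²≤ : ∀ i → y i * y i ≤ K * (A * q)
      y²≤ i = ℚ.≤-trans (y≤ y i) (*-monoˡ (ℚ.<⇒≤ K>0) s≤Aq)
      KAq≥0 : 0ℚ ≤ K * (A * q)
      KAq≥0 = *-nonneg (ℚ.<⇒≤ K>0) (*-nonneg (ℚ.<⇒≤ A>0) (p x))
      c²x₀²≤ : c * c * (x zero * x zero) ≤ R * q
      c²x₀²≤ = begin
        c * c * (x zero * x zero)
          ≤⟨ ℚ.*-monoʳ-≤-nonNeg (x zero * x zero) ⦃ nonNegative (sq-nonneg (x zero)) ⦄
               (ℚ.≤-trans (*-monoˡ (ℚ.<⇒≤ c>0) c≤aₖ)
                 (ℚ.*-monoʳ-≤-nonNeg (corner M) ⦃ nonNegative (ℚ.≤-trans (ℚ.<⇒≤ c>0) c≤aₖ) ⦄ c≤aₖ)) ⟩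
        corner M * corner M * (x zero * x zero)
          ≡⟨ solve 3 (λ a x d → a :* a :* (x :* x) := (a :* x :+ d :+ (:- d)) :* (a :* x :+ d :+ (:- d))) refl (corner M) (x zero) d ⟩
        (u + - d) * (u + - d)
          ≤⟨ square-sum u (- d) ⟩
        two * (u * u) + two * (- d * - d)
          ≡⟨ cong (two * (u * u) +_) (solve 1 (λ d → con two :* ((:- d) :* (:- d)) := con two :* (d :* d)) refl d) ⟩
        two * (u * u) + two * (d * d)
          ≤⟨ ℚ.+-mono-≤ (*-monoˡ two≥0 u²≤Aq) (*-monoˡ two≥0 (dot≤ y (K * (A * q)) KAq≥0 y²≤)) ⟩
        two * (A * q) + two * (L * (K * (A * q)))
          ≡⟨ solve 4 (λ a q l k → con two :* (a :* q) :+ con two :* (l :* (k :* (a :* q)))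
               := (con two :* a :+ con two :* (l :* (k :* a))) :* q) refl A q L K ⟩
        R * q ∎
        where open ℚ.≤-Reasoning
      bound : ∀ i → x i * x i ≤ K′ * q
      bound zero = begin
        x zero * x zero                         ≡⟨ ℚ.*-identityˡ _ ⟨
        1ℚ * (x zero * x zero)                  ≡⟨ cong (_* (x zero * x zero)) c²c⁻²≡1 ⟨
        c * c * c⁻² * (x zero * x zero)         ≡⟨ solve 3 (λ c i x → c :* i :* x := i :* (c :* x)) refl (c * c) c⁻² (x zero * x zero) ⟩
        c⁻² * (c * c * (x zero * x zero))       ≤⟨ *-monoˡ (ℚ.<⇒≤ c⁻²>0) c²x₀²≤ ⟩
        c⁻² * (R * q)                           ≤⟨ from-diff (subst (0ℚ ≤_)
            (solve 5 (λ i r q k a → k :* (a :* q) := (k :* a :+ i :* r) :* q :- i :* (r :* q)) refl c⁻² R q K A) KAq≥0) ⟩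
        K′ * q ∎
        where open ℚ.≤-Reasoning
      bound (suc i) = ℚ.≤-trans (y²≤ i) (from-diff (subst (0ℚ ≤_)
        (solve 5 (λ i r q k a → i :* (r :* q) := (k :* a :+ i :* r) :* q :- k :* (a :* q)) refl c⁻² R q K A)
        (*-nonneg (ℚ.<⇒≤ c⁻²>0) (*-nonneg (ℚ.<⇒≤ R>0) (p x)))))

  module Elimination {n} (M : Matrix ℝ (suc n)) (symM : ∀ k → Symmetric (atTime M k))
                     (psd : Eventually (λ k → PSD (atTime M k))) where
    a : ℝ
    a = M zero zero

    a≥0 : Eventually (λ k → 0ℚ ≤ seq a k)
    a≥0 = ev-map (λ k p → subst (0ℚ ≤_) (trans (quad-single (atTime M k) zero 1ℚ) (ℚ.*-identityʳ _)) (p (single zero 1ℚ))) psd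

    -- In the limit this is the inequality b² ≤ a c for a principal minor. The form at (-b t, 1),
    -- with t a ≤ 1, gives t b² ≤ c < B; choosing t with t ε² = B leaves b² < ε².
    null-row : a ≈ᵣ zeroᵣ → ∀ j → M zero (suc j) ≈ᵣ zeroᵣ
    null-row a≈0 j ε ε>0 with upper (M (suc j) (suc j)) | inverse (*-positive ε>0 ε>0)
    ... | B , B>0 , ≤B | q , q>0 , εεq≡1 with inverse (*-positive B>0 q>0)
    ... | t⁻¹ , t⁻¹>0 , tt⁻¹≡1 = ev-map₂ (λ k (p , c<B) a<t⁻¹ → subst (λ p → ∣ p ∣ < ε) (sym (minus-zero (b k))) (∣∣<-from-sq ε>0 (final k p c<B a<t⁻¹)))
        (ev-× psd ≤B) (a≈0 t⁻¹ t⁻¹>0)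
      where
      t = B * q
      t>0 : 0ℚ < t
      t>0 = *-positive B>0 q>0
      b c : ℕ → ℚ
      b k = seq (M zero (suc j)) k
      c k = seq (M (suc j) (suc j)) k
      final : ∀ k → PSD (atTime M k) → c k < B → ∣ seq a k - 0ℚ ∣ < t⁻¹ → b k * b k < ε * ε
      final k p c<B a<t⁻¹ = ℚ.*-cancelˡ-<-nonNeg t ⦃ nonNegative (ℚ.<⇒≤ t>0) ⦄
        (ℚ.≤-<-trans tbb≤c (subst (c k <_) (sym tεε≡B) c<B))
        where
        tεε≡B : t * (ε * ε) ≡ B
        tεε≡B = trans (solve 3 (λ b q e → b :* q :* e := b :* (e :* q)) refl B q (ε * ε))
          (trans (cong (B *_) εεq≡1) (ℚ.*-identityʳ B))
        ta≤1 : t * seq a k ≤ 1ℚ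
        ta≤1 = subst (t * seq a k ≤_) tt⁻¹≡1 (*-monoˡ (ℚ.<⇒≤ t>0)
          (ℚ.≤-trans (≤∣∣ (seq a k)) (ℚ.<⇒≤ (subst (λ p → ∣ p ∣ < t⁻¹) (minus-zero (seq a k)) a<t⁻¹))))
        form : 0ℚ ≤ seq a k * ((- (b k * t)) * (- (b k * t))) + two * ((- (b k * t)) * (b k * 1ℚ)) + c k * (1ℚ * 1ℚ)
        form = subst (0ℚ ≤_) (quad-pair (atTime M k) (symM k) (- (b k * t)) j 1ℚ) (p ((- (b k * t)) ∷ᵛ single j 1ℚ))
        tbb≤c : t * (b k * b k) ≤ c k
        tbb≤c = from-diff (subst (0ℚ ≤_)
          (solve 4 (λ a b c t →
            (a :* ((:- (b :* t)) :* (:- (b :* t))) :+ con two :* ((:- (b :* t)) :* (b :* con 1ℚ)) :+ c :* (con 1ℚ :* con 1ℚ))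
              :+ (t :* (b :* b)) :* (con 1ℚ :- t :* a) := c :- t :* (b :* b)) refl (seq a k) (b k) (c k) t)
          (+-nonneg form (*-nonneg (*-nonneg (ℚ.<⇒≤ t>0) (sq-nonneg (b k))) (to-diff ta≤1))))

    null-kernel : a ≈ᵣ zeroᵣ → Kernel M
    null-kernel a≈0 = e₀ , not-null , λ i → null-cong {M i zero} {mulᵣ M e₀ i} (λ k → sym (column i k)) (null-column i)
      where
      e₀ : Fin (suc n) → ℝ
      e₀ i = fromℚ (single zero 1ℚ i)
      not-null : ¬ (∀ i → e₀ i ≈ᵣ zeroᵣ)
      not-null null with null zero 1ℚ (ℚ.positive⁻¹ 1ℚ)
      ... | N , lt = ℚ.<-irrefl refl (lt N ℕ.≤-refl)
      column : ∀ i k → seq (mulᵣ M e₀ i) k ≡ seq (M i zero) k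
      column i k = trans (seq-∑ (λ j → M i j *ᵣ e₀ j) k)
        (trans (∑-single (atTime M k i) zero 1ℚ) (ℚ.*-identityʳ _))
      null-column : ∀ i → M i zero ≈ᵣ zeroᵣ
      null-column zero    = a≈0
      null-column (suc i) = null-cong {M zero (suc i)} {M (suc i) zero} (λ k → symM k zero (suc i)) (null-row a≈0 i)

    module Away (c : ℚ) (c>0 : 0ℚ < c) (c≤a : Eventually (λ k → c ≤ seq a k)) where
      a>0 : Eventually (λ k → 0ℚ < seq a k)
      a>0 = ev-map (λ k → ℚ.<-≤-trans c>0) c≤a

      schur-psdᵣ : Eventually (λ k → PSD (atTime (schurᵣ M) k))
      schur-psdᵣ = ev-map₂ (λ k → schur-psd (atTime M k) (symM k)) a>0 psd

      -- The kernel vector is `lift` applied at every index: its first product vanishes identically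
      -- and the others are those of the Schur complement. It stays nonzero because `a` is bounded
      -- away from zero, so that smallness of a y forces smallness of y.
      extend-kernel : Kernel (schurᵣ M) → Kernel M
      extend-kernel (y , y≢0 , My≈0) = v , v≢0 , Mv≈0
        where
        v : Fin (suc n) → ℝ
        v zero    = fromℚ (- 1ℚ) *ᵣ ∑ᵣ (λ j → M zero (suc j) *ᵣ y j)
        v (suc i) = a *ᵣ y i
        yₖ : ℕ → Fin n → ℚ
        yₖ k i = seq (y i) k
        v-lift : ∀ k i → seq (v i) k ≡ lift (atTime M k) (yₖ k) i
        v-lift k zero    = cong (- 1ℚ *_) (seq-∑ (λ j → M zero (suc j) *ᵣ y j) k)
        v-lift k (suc i) = refl
        mul-lift : ∀ k i → seq (mulᵣ M v i) k ≡ apply (atTime M k) (lift (atTime M k) (yₖ k)) i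
        mul-lift k i = trans (seq-∑ (λ j → M i j *ᵣ v j) k) (∑-cong λ j → cong (seq (M i j) k *_) (v-lift k j))
        Mv≈0 : ∀ i → mulᵣ M v i ≈ᵣ zeroᵣ
        Mv≈0 zero ε ε>0 = 0 , λ k _ → subst (λ t → ∣ t - 0ℚ ∣ < ε)
          (sym (trans (mul-lift k zero) (apply-lift-zero (atTime M k) (yₖ k)))) ε>0
        Mv≈0 (suc i) = null-cong {mulᵣ (schurᵣ M) y i} {mulᵣ M v (suc i)} (λ k → trans (seq-∑ (λ j → schurᵣ M i j *ᵣ y j) k)
          (sym (trans (mul-lift k (suc i)) (apply-lift-suc (atTime M k) (symM k) (yₖ k) i)))) (My≈0 i)
        v≢0 : ¬ (∀ i → v i ≈ᵣ zeroᵣ)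
        v≢0 v≈0 = y≢0 λ i ε ε>0 → ev-map₂ (λ k c≤aₖ ay<cε →
            ℚ.*-cancelˡ-<-nonNeg c ⦃ nonNegative (ℚ.<⇒≤ c>0) ⦄ (ℚ.≤-<-trans (cy≤ay k i c≤aₖ) ay<cε))
          c≤a (v≈0 (suc i) (c * ε) (*-positive c>0 ε>0))
          where
          cy≤ay : ∀ k i → c ≤ seq a k → c * ∣ seq (y i) k - 0ℚ ∣ ≤ ∣ seq a k * seq (y i) k - 0ℚ ∣
          cy≤ay k i c≤aₖ = subst₂ (λ s t → c * ∣ s ∣ ≤ ∣ t ∣) (sym (minus-zero _)) (sym (minus-zero _))
            (subst (c * ∣ seq (y i) k ∣ ≤_)
              (sym (trans (ℚ.∣p*q∣≡∣p∣*∣q∣ (seq a k) (seq (y i) k))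
                (cong (_* ∣ seq (y i) k ∣) (ℚ.0≤p⇒∣p∣≡p (ℚ.≤-trans (ℚ.<⇒≤ c>0) c≤aₖ)))))
              (ℚ.*-monoʳ-≤-nonNeg ∣ seq (y i) k ∣ ⦃ nonNegative (ℚ.0≤∣p∣ (seq (y i) k)) ⦄ c≤aₖ))

      extend-coercive : Coercive (schurᵣ M) → Coercive M
      extend-coercive (K , K>0 , coercive) =
        let A , A>0 , a<A = upper a
            c⁻² , c⁻²>0 , c²c⁻²≡1 = inverse (*-positive c>0 c>0)
            L , L≥0 , dot≤ = dot-bound β β≥0
            KA>0 = *-positive K>0 A>0
        in K * A + c⁻² * (two * A + two * (L * (K * A)))
         , +-positive KA>0 (*-positive c⁻²>0 (ℚ.+-mono-<-≤ (*-positive (ℚ.positive⁻¹ two) A>0)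
             (*-nonneg two≥0 (*-nonneg L≥0 (ℚ.<⇒≤ KA>0)))))
         , ev-map₂ (λ k (p , c≤aₖ , aₖ<A) (y≤ , b≤) → SchurBound.bound (atTime M k) (symM k) p
               A>0 K>0 L≥0 c>0 c⁻²>0 c²c⁻²≡1 c≤aₖ (ℚ.<⇒≤ aₖ<A) y≤
               (λ y Q Q≥0 → dot≤ (row (atTime M k)) y Q Q≥0 b≤))
             (ev-× psd (ev-× c≤a a<A)) (ev-× coercive b<β)
        where
        β : Fin n → ℚ
        β j = proj₁ (upper (M zero (suc j) *ᵣ M zero (suc j)))
        β≥0 : ∀ j → 0ℚ ≤ β j
        β≥0 j = ℚ.<⇒≤ (proj₁ (proj₂ (upper (M zero (suc j) *ᵣ M zero (suc j)))))
        b<β : Eventually (λ k → ∀ j → seq (M zero (suc j)) k * seq (M zero (suc j)) k ≤ β j)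
        b<β = ev-Fin λ j → ev-map (λ k → ℚ.<⇒≤) (proj₂ (proj₂ (upper (M zero (suc j) *ᵣ M zero (suc j)))))

  -- Elimination with a real pivot. A pivot tending to zero takes its whole row along, so the first
  -- unit vector lies in the kernel; a pivot bounded away from zero hands the question to the Schur
  -- complement.
  kernel-or-coercive : ∀ {n} (M : Matrix ℝ n) → (∀ k → Symmetric (atTime M k)) →
    Eventually (λ k → PSD (atTime M k)) → ¬ ¬ (Kernel M ⊎ Coercive M)
  kernel-or-coercive {zero} M symM psd neither = neither (inj₂ (1ℚ , ℚ.positive⁻¹ 1ℚ , 0 , λ _ _ _ ()))
  kernel-or-coercive {suc n} M symM psd neither =
    null-or-away a a≥0 λ where
      (inj₁ a≈0) → neither (inj₁ (null-kernel a≈0))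
      (inj₂ (c , c>0 , c≤a)) → let open Away c c>0 c≤a in
        kernel-or-coercive (schurᵣ M) (λ k → schur-symmetric (atTime M k) (symM k)) schur-psdᵣ λ where
          (inj₁ ker) → neither (inj₁ (extend-kernel ker))
          (inj₂ coe) → neither (inj₂ (extend-coercive coe))
    where open Elimination M symM psd

-- Integer sums and counting over lists

module Sums where
  open import Data.Integer using (ℤ; +_; -[1+_]; -≤+; 0ℤ; 1ℤ; _+_; _*_; -_; _-_; _≤_; ∣_∣; +≤+; nonNegative)
  open import Data.Integer.Properties as ℤ
  open import Data.Integer.Solver using (module +-*-Solver)
  open import Data.List using (_++_; tabulate)
  import Data.List.Properties as List
  open import Data.List.Membership.Propositional using (_∈_)
  open import Data.List.Relation.Unary.Unique.Propositional using (Unique) public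
  open import Relation.Binary using (DecidableEquality)
  open +-*-Solver

  private
    variable
      A B : Set

  ≤-by : ∀ {i j d} → 0ℤ ≤ d → d ≡ j - i → i ≤ j
  ≤-by d≥0 eq = ℤ.0≤i-j⇒j≤i (subst (0ℤ ≤_) eq d≥0)

  gap : ∀ {i j} → i ≤ j → 0ℤ ≤ j - i
  gap = ℤ.i≤j⇒0≤j-i

  0≤+ : ∀ {i j} → 0ℤ ≤ i → 0ℤ ≤ j → 0ℤ ≤ i + j
  0≤+ i≥0 j≥0 = ℤ.+-mono-≤ i≥0 j≥0

  0≤* : ∀ {i j} → 0ℤ ≤ i → 0ℤ ≤ j → 0ℤ ≤ i * j
  0≤* {i} {j} i≥0 j≥0 = subst (_≤ i * j) (ℤ.*-zeroʳ i) (ℤ.*-monoˡ-≤-nonNeg i ⦃ nonNegative i≥0 ⦄ j≥0)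

  *-mono : ∀ {i j k l} → 0ℤ ≤ i → 0ℤ ≤ k → i ≤ j → k ≤ l → i * k ≤ j * l
  *-mono {i} {j} {k} {l} i≥0 k≥0 i≤j k≤l = ℤ.≤-trans
    (ℤ.*-monoˡ-≤-nonNeg i ⦃ nonNegative i≥0 ⦄ k≤l)
    (ℤ.*-monoʳ-≤-nonNeg l ⦃ nonNegative (ℤ.≤-trans k≥0 k≤l) ⦄ i≤j)

  i≤∣i∣ : ∀ i → i ≤ + ∣ i ∣
  i≤∣i∣ (+ n)    = ℤ.≤-refl
  i≤∣i∣ -[1+ n ] = -≤+

  𝟙 : Bool → ℤ
  𝟙 true  = 1ℤ
  𝟙 false = 0ℤ

  0≤𝟙 : ∀ b → 0ℤ ≤ 𝟙 b
  0≤𝟙 true  = +≤+ ℕ.z≤n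
  0≤𝟙 false = +≤+ ℕ.z≤n

  𝟙≤1 : ∀ b → 𝟙 b ≤ 1ℤ
  𝟙≤1 true  = ℤ.≤-refl
  𝟙≤1 false = +≤+ ℕ.z≤n

  𝟙-∧ : ∀ a b → 𝟙 (a ∧ b) ≡ 𝟙 a * 𝟙 b
  𝟙-∧ true  b = sym (ℤ.*-identityˡ (𝟙 b))
  𝟙-∧ false b = refl

  𝟙-not : ∀ b → 𝟙 b + 𝟙 (not b) ≡ 1ℤ
  𝟙-not true  = refl
  𝟙-not false = refl

  ∑ : (A → ℤ) → List A → ℤ
  ∑ f []       = 0ℤ
  ∑ f (x ∷ xs) = f x + ∑ f xs

  cnt : (A → Bool) → List A → ℤ
  cnt p = ∑ (𝟙 ∘ p)

  ∣_∣ₗ : List A → ℤ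
  ∣ L ∣ₗ = + length L

  ∑-cong-∈ : ∀ {f g : A → ℤ} L → (∀ {x} → x ∈ L → f x ≡ g x) → ∑ f L ≡ ∑ g L
  ∑-cong-∈ []      eq = refl
  ∑-cong-∈ (x ∷ L) eq = cong₂ _+_ (eq (here refl)) (∑-cong-∈ L (eq ∘ there))

  ∑-cong : ∀ {f g : A → ℤ} L → (∀ x → f x ≡ g x) → ∑ f L ≡ ∑ g L
  ∑-cong L eq = ∑-cong-∈ L λ {x} _ → eq x

  ∑-mono : ∀ {f g : A → ℤ} L → (∀ {x} → x ∈ L → f x ≤ g x) → ∑ f L ≤ ∑ g L
  ∑-mono []      le = ℤ.≤-refl
  ∑-mono (x ∷ L) le = ℤ.+-mono-≤ (le (here refl)) (∑-mono L (le ∘ there))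

  ∑-+ : ∀ (f g : A → ℤ) L → ∑ (λ x → f x + g x) L ≡ ∑ f L + ∑ g L
  ∑-+ f g []      = refl
  ∑-+ f g (x ∷ L) = trans (cong (λ t → f x + g x + t) (∑-+ f g L))
    (solve 4 (λ a b c d → (a :+ b) :+ (c :+ d) := (a :+ c) :+ (b :+ d)) refl (f x) (g x) (∑ f L) (∑ g L))

  ∑-* : ∀ c (f : A → ℤ) L → ∑ (λ x → c * f x) L ≡ c * ∑ f L
  ∑-* c f []      = sym (ℤ.*-zeroʳ c)
  ∑-* c f (x ∷ L) = trans (cong (λ t → c * f x + t) (∑-* c f L)) (sym (ℤ.*-distribˡ-+ c (f x) (∑ f L)))

  ∑-zero : ∀ (L : List A) → ∑ (λ _ → 0ℤ) L ≡ 0ℤ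
  ∑-zero []      = refl
  ∑-zero (x ∷ L) = trans (ℤ.+-identityˡ _) (∑-zero L)

  ∑-nonneg : ∀ {f : A → ℤ} L → (∀ {x} → x ∈ L → 0ℤ ≤ f x) → 0ℤ ≤ ∑ f L
  ∑-nonneg {f = f} L f≥0 = subst (_≤ ∑ f L) (∑-zero L) (∑-mono L f≥0)

  ∑-const : ∀ c (L : List A) → ∑ (λ _ → c) L ≡ ∣ L ∣ₗ * c
  ∑-const c []      = sym (ℤ.*-zeroˡ c)
  ∑-const c (x ∷ L) = trans (cong (λ t → c + t) (∑-const c L))
    (solve 2 (λ c l → c :+ l :* c := (con 1ℤ :+ l) :* c) refl c ∣ L ∣ₗ)

  ∑-bound : ∀ {f : A → ℤ} {c} L → (∀ {x} → x ∈ L → f x ≤ c) → ∑ f L ≤ ∣ L ∣ₗ * c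
  ∑-bound {f = f} {c} L le = subst (∑ f L ≤_) (∑-const c L) (∑-mono L le)

  ∑-swap : ∀ (f : A → B → ℤ) L M → ∑ (λ x → ∑ (f x) M) L ≡ ∑ (λ y → ∑ (λ x → f x y) L) M
  ∑-swap f []      M = sym (∑-zero M)
  ∑-swap f (x ∷ L) M = trans (cong (λ t → ∑ (f x) M + t) (∑-swap f L M)) (sym (∑-+ (f x) (λ y → ∑ (λ x → f x y) L) M))

  ∑-++ : ∀ (f : A → ℤ) L M → ∑ f (L ++ M) ≡ ∑ f L + ∑ f M
  ∑-++ f []      M = sym (ℤ.+-identityˡ _)
  ∑-++ f (x ∷ L) M = trans (cong (λ t → f x + t) (∑-++ f L M)) (sym (ℤ.+-assoc (f x) _ _))

  ∑-map : ∀ (f : B → ℤ) (g : A → B) L → ∑ f (map g L) ≡ ∑ (f ∘ g) L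
  ∑-map f g []      = refl
  ∑-map f g (x ∷ L) = cong (λ t → f (g x) + t) (∑-map f g L)

  ∑-tabulate : ∀ {n} (f : A → ℤ) (g : Fin n → A) → ∑ f (tabulate g) ≡ ∑ (f ∘ g) (allFin n)
  ∑-tabulate {n = n} f g = trans (cong (∑ f) (sym (List.map-tabulate id g))) (∑-map f g (allFin n))

  ∑-lookup : ∀ (f : A → ℤ) L → ∑ f L ≡ ∑ (f ∘ lookup L) (allFin (length L))
  ∑-lookup f L = trans (cong (∑ f) (sym (List.tabulate-lookup L))) (∑-tabulate f (lookup L))

  ∑-filter : ∀ (f : A → ℤ) (p : A → Bool) L → ∑ f (filter (T? ∘ p) L) ≡ ∑ (λ x → 𝟙 (p x) * f x) L
  ∑-filter f p []      = refl
  ∑-filter f p (x ∷ L) with p x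
  ... | true  = cong₂ _+_ (sym (ℤ.*-identityˡ (f x))) (∑-filter f p L)
  ... | false = trans (∑-filter f p L) (sym (trans (cong (λ t → t + ∑ (λ x → 𝟙 (p x) * f x) L) (ℤ.*-zeroˡ (f x))) (ℤ.+-identityˡ _)))

  length-filter : ∀ (p : A → Bool) L → ∣ filter (T? ∘ p) L ∣ₗ ≡ cnt p L
  length-filter p L = trans (sym (trans (∑-const 1ℤ (filter (T? ∘ p) L)) (ℤ.*-identityʳ _)))
    (trans (∑-filter (λ _ → 1ℤ) p L) (∑-cong L λ x → ℤ.*-identityʳ (𝟙 (p x))))

  cnt-filter : ∀ (p q : A → Bool) L → cnt q (filter (T? ∘ p) L) ≡ cnt (λ x → p x ∧ q x) L
  cnt-filter p q L = trans (∑-filter (𝟙 ∘ q) p L) (∑-cong L λ x → sym (𝟙-∧ (p x) (q x)))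

  cnt-nonneg : ∀ (p : A → Bool) L → 0ℤ ≤ cnt p L
  cnt-nonneg p L = ∑-nonneg L λ {x} _ → 0≤𝟙 (p x)

  cnt-≤-length : ∀ (p : A → Bool) L → cnt p L ≤ ∣ L ∣ₗ
  cnt-≤-length p L = subst (cnt p L ≤_) (ℤ.*-identityʳ _) (∑-bound L λ {x} _ → 𝟙≤1 (p x))

  cnt-not : ∀ (p : A → Bool) L → cnt p L + cnt (not ∘ p) L ≡ ∣ L ∣ₗ
  cnt-not p L = trans (sym (∑-+ (𝟙 ∘ p) (𝟙 ∘ not ∘ p) L))
    (trans (∑-cong L λ x → 𝟙-not (p x)) (trans (∑-const 1ℤ L) (ℤ.*-identityʳ _)))

  T⇒≡ : ∀ {b} → T b → b ≡ true
  T⇒≡ {true} _ = refl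

  ¬T⇒≡ : ∀ {b} → ¬ T b → b ≡ false
  ¬T⇒≡ {false} _ = refl
  ¬T⇒≡ {true}  ¬t = contradiction _ ¬t

  cnt-all : ∀ (p : A → Bool) L → (∀ {x} → x ∈ L → T (p x)) → cnt p L ≡ ∣ L ∣ₗ
  cnt-all p L all = trans (∑-cong-∈ L λ x∈ → cong 𝟙 (T⇒≡ (all x∈))) (trans (∑-const 1ℤ L) (ℤ.*-identityʳ _))

  cnt-none : ∀ (p : A → Bool) L → (∀ {x} → x ∈ L → ¬ T (p x)) → cnt p L ≡ 0ℤ
  cnt-none p L none = trans (∑-cong-∈ L λ x∈ → cong 𝟙 (¬T⇒≡ (none x∈))) (∑-zero L)

  member-≤-∑ : ∀ {f : A → ℤ} {L x} → (∀ {y} → y ∈ L → 0ℤ ≤ f y) → x ∈ L → f x ≤ ∑ f L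
  member-≤-∑ {f = f} {y ∷ L} f≥0 (here refl) = subst (_≤ f y + ∑ f L) (ℤ.+-identityʳ _)
    (ℤ.+-monoʳ-≤ (f y) (∑-nonneg L (f≥0 ∘ there)))
  member-≤-∑ {f = f} {y ∷ L} {x} f≥0 (there x∈) = subst (_≤ f y + ∑ f L) (ℤ.+-identityˡ _)
    (ℤ.+-mono-≤ (f≥0 (here refl)) (member-≤-∑ (f≥0 ∘ there) x∈))

  cnt-member : ∀ (p : A → Bool) {L x} → x ∈ L → T (p x) → 1ℤ ≤ cnt p L
  cnt-member p {L} {x} x∈ px = subst (_≤ cnt p L) (cong 𝟙 (T⇒≡ px)) (member-≤-∑ (λ {y} _ → 0≤𝟙 (p y)) x∈)

  cnt-witness : ∀ (p : A → Bool) L → 1ℤ ≤ cnt p L → ∃[ x ] x ∈ L × T (p x)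
  cnt-witness p [] (+≤+ ())
  cnt-witness p (x ∷ L) le with p x in eq
  ... | true  = x , here refl , subst T (sym eq) _
  ... | false with cnt-witness p L (subst (1ℤ ≤_) (ℤ.+-identityˡ _) le)
  ...   | y , y∈ , py = y , there y∈ , py

  module _ (_≟_ : DecidableEquality A) where
    δ : A → A → ℤ
    δ x y = 𝟙 (does (x ≟ y))

    δ-refl : ∀ x → δ x x ≡ 1ℤ
    δ-refl x with x ≟ x
    ... | yes _  = refl
    ... | no x≢x = contradiction refl x≢x

    δ-≢ : ∀ {x y} → x ≢ y → δ x y ≡ 0ℤ
    δ-≢ {x} {y} x≢y with x ≟ y
    ... | yes x≡y = contradiction x≡y x≢y
    ... | no _    = refl

    ∑-δ-∉ : ∀ (f : A → ℤ) y L → All (y ≢_) L → ∑ (λ x → δ x y * f x) L ≡ 0ℤ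
    ∑-δ-∉ f y [] [] = refl
    ∑-δ-∉ f y (x ∷ L) (y≢x ∷ y∉) = trans (cong₂ _+_ (trans (cong (_* f x) (δ-≢ (y≢x ∘ sym))) (ℤ.*-zeroˡ (f x))) (∑-δ-∉ f y L y∉)) refl

    ∑-δ : ∀ (f : A → ℤ) {y L} → Unique L → y ∈ L → ∑ (λ x → δ x y * f x) L ≡ f y
    ∑-δ f {y} {x ∷ L} (x∉ ∷ uniq) (here refl) =
      trans (cong₂ _+_ (trans (cong (_* f x) (δ-refl x)) (ℤ.*-identityˡ (f x))) (∑-δ-∉ f x L x∉)) (ℤ.+-identityʳ _)
    ∑-δ f {y} {x ∷ L} (x∉ ∷ uniq) (there y∈) =
      trans (cong₂ _+_ (trans (cong (_* f x) (δ-≢ (All.lookup x∉ y∈))) (ℤ.*-zeroˡ (f x))) (∑-δ f uniq y∈)) (ℤ.+-identityˡ _)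

  -- Exactly `k` elements are taken, not at least `k`, so that the Gram matrix of the chosen
  -- configuration consists of numerals.
  choose : ∀ {R : A → A → Set} (p : A → Bool) {L} → AllPairs R L → ∀ k → + k ≤ cnt p L →
    ∃[ M ] AllPairs R M × length M ≡ k × (∀ {x} → x ∈ M → x ∈ L × T (p x))
  choose p rel zero _ = [] , [] , refl , λ ()
  choose p [] (suc k) (+≤+ ())
  choose p {x ∷ L} (R-x ∷ rel) (suc k) le with p x in eq
  ... | false with choose p rel (suc k) (subst (+ suc k ≤_) (ℤ.+-identityˡ _) le)
  ...   | M , rel′ , len , sub = M , rel′ , len , λ y∈ → there (proj₁ (sub y∈)) , proj₂ (sub y∈)
  choose p {x ∷ L} (R-x ∷ rel) (suc k) le | true with choose p rel k (≤-by (gap le) (solve 2 (λ c k → (con 1ℤ :+ c) :- (con 1ℤ :+ k) := c :- k) refl (cnt p L) (+ k)))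
  ... | M , rel′ , len , sub = x ∷ M , All.tabulate (λ y∈ → All.lookup R-x (proj₁ (sub y∈))) ∷ rel′ , cong suc len , λ where
          (here refl) → here refl , subst T (sym eq) _
          (there y∈)  → there (proj₁ (sub y∈)) , proj₂ (sub y∈)

-- From the least eigenvalue to semidefiniteness

module Spectral where
  open Quad
  open Limit
  open Sums using (i≤∣i∣)
  open import Data.Integer as ℤ using (ℤ)
  import Data.Integer.Properties as ℤ
  open import Data.Rational using (ℚ; 0ℚ; 1ℚ; _+_; _*_; -_; _-_; _<_; _≤_; ∣_∣; mkℚ; toℚᵘ; nonNegative; positive; _≤?_)
  open import Data.Rational.Properties as ℚ hiding (_≤?_)
  open import Data.Rational.Solver using (module +-*-Solver)
  import Data.Rational.Unnormalised as ℚᵘ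
  import Data.Rational.Unnormalised.Properties as ℚᵘ
  open +-*-Solver

  ι : ℤ → ℚ
  ι z = z Data.Rational./ 1

  abstract
    ι-≃ : ∀ z → toℚᵘ (ι z) ℚᵘ.≃ ℚᵘ.mkℚᵘ z 0
    ι-≃ z = ℚ.toℚᵘ-fromℚᵘ (ℚᵘ.mkℚᵘ z 0)

    ι-+ : ∀ a b → ι (a ℤ.+ b) ≡ ι a + ι b
    ι-+ a b = ℚ.toℚᵘ-injective (ℚᵘ.≃-trans (ι-≃ (a ℤ.+ b)) (ℚᵘ.≃-sym (ℚᵘ.≃-trans (ℚ.toℚᵘ-homo-+ (ι a) (ι b))
      (ℚᵘ.≃-trans (ℚᵘ.+-cong (ι-≃ a) (ι-≃ b))
        (ℚᵘ.*≡* (cong (ℤ._* ℤ.1ℤ) (cong₂ ℤ._+_ (ℤ.*-identityʳ a) (ℤ.*-identityʳ b))))))))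

    ι-* : ∀ a b → ι (a ℤ.* b) ≡ ι a * ι b
    ι-* a b = ℚ.toℚᵘ-injective (ℚᵘ.≃-trans (ι-≃ (a ℤ.* b)) (ℚᵘ.≃-sym (ℚᵘ.≃-trans (ℚ.toℚᵘ-homo-* (ι a) (ι b))
      (ℚᵘ.*-cong (ι-≃ a) (ι-≃ b)))))

    ι-mono-≤ : ∀ {a b} → a ℤ.≤ b → ι a ≤ ι b
    ι-mono-≤ {a} {b} a≤b = ℚ.toℚᵘ-cancel-≤ (ℚᵘ.≤-respˡ-≃ (ℚᵘ.≃-sym (ι-≃ a)) (ℚᵘ.≤-respʳ-≃ (ℚᵘ.≃-sym (ι-≃ b))
      (ℚᵘ.*≤* (ℤ.*-monoʳ-≤-nonNeg ℤ.1ℤ a≤b))))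

    ι-cancel-≤ : ∀ {a b} → ι a ≤ ι b → a ℤ.≤ b
    ι-cancel-≤ {a} {b} le with ℚᵘ.≤-respˡ-≃ (ι-≃ a) (ℚᵘ.≤-respʳ-≃ (ι-≃ b) (ℚ.toℚᵘ-mono-≤ le))
    ... | ℚᵘ.*≤* a≤b = subst₂ ℤ._≤_ (ℤ.*-identityʳ a) (ℤ.*-identityʳ b) a≤b

    ι-mono-< : ∀ {a b} → a ℤ.< b → ι a < ι b
    ι-mono-< a<b = ℚ.≰⇒> λ le → ℤ.<-irrefl refl (ℤ.<-≤-trans a<b (ι-cancel-≤ le))

    archimedean : ∀ q → ∃[ N ] q < ι (ℤ.+ N)
    archimedean q@(mkℚ n d _) = suc ℤ.∣ n ∣ , ℚ.toℚᵘ-cancel-< (ℚᵘ.<-respʳ-≃ (ℚᵘ.≃-sym (ι-≃ (ℤ.+ suc ℤ.∣ n ∣)))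
      (ℚᵘ.*<* (ℤ.≤-<-trans (ℤ.≤-reflexive (ℤ.*-identityʳ n)) (ℤ.≤-<-trans (i≤∣i∣ n)
        (ℤ.<-≤-trans (ℤ.+<+ (ℕ.n<1+n ℤ.∣ n ∣)) (subst (ℤ.+ suc ℤ.∣ n ∣ ℤ.≤_)
          (ℤ.pos-* (suc ℤ.∣ n ∣) (suc d)) (ℤ.+≤+ (ℕ.m≤m*n (suc ℤ.∣ n ∣) (suc d)))))))))

  num : ℕ → ℚ
  num k = ι (ℤ.+ k)

  num>0 : ∀ k → 0ℚ < num (suc k)
  num>0 k = ι-mono-< {ℤ.+ 0} {ℤ.+ suc k} (ℤ.+<+ (ℕ.s≤s ℕ.z≤n))

  num≥0 : ∀ k → 0ℚ ≤ num k
  num≥0 k = ι-mono-≤ {ℤ.+ 0} {ℤ.+ k} (ℤ.+≤+ ℕ.z≤n)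

  num-suc : ∀ k → num (suc k) ≡ 1ℚ + num k
  num-suc k = ι-+ ℤ.1ℤ (ℤ.+ k)

  mesh : ℕ → ℚ
  mesh k = proj₁ (inverse (num>0 k))

  mesh>0 : ∀ k → 0ℚ < mesh k
  mesh>0 k = proj₁ (proj₂ (inverse (num>0 k)))

  num-mesh : ∀ k → num (suc k) * mesh k ≡ 1ℚ
  num-mesh k = proj₂ (proj₂ (inverse (num>0 k)))

  abstract
    mesh-small : ∀ ε → 0ℚ < ε → Eventually (λ k → mesh k < ε)
    mesh-small ε ε>0 =
      let r , r>0 , εr≡1 = inverse ε>0
          N , r<N = archimedean r
      in N , λ k N≤k →
        let r<k = ℚ.<-≤-trans r<N (ι-mono-≤ (ℤ.+≤+ (ℕ.m≤n⇒m≤1+n N≤k)))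
        in ℚ.*-cancelˡ-<-nonNeg (num (suc k)) ⦃ nonNegative (num≥0 (suc k)) ⦄
             (subst₂ _<_ (trans εr≡1 (sym (num-mesh k))) (ℚ.*-comm ε (num (suc k)))
               (ℚ.*-monoʳ-<-pos ε ⦃ positive ε>0 ⦄ r<k))

  ∑-const : ∀ n c → ∑ {n} (λ _ → c) ≡ num n * c
  ∑-const zero    c = sym (ℚ.*-zeroˡ c)
  ∑-const (suc n) c = trans (cong (c +_) (∑-const n c))
    (trans (solve 2 (λ c n → c :+ n :* c := (con 1ℚ :+ n) :* c) refl c (num n)) (cong (_* c) (sym (num-suc n))))

  single-sym : ∀ {n} (i j : Fin n) t → single i t j ≡ single j t i
  single-sym zero    zero    t = refl
  single-sym zero    (suc j) t = refl
  single-sym (suc i) zero    t = refl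
  single-sym (suc i) (suc j) t = single-sym i j t

  shift : ∀ {n} → Matrix ℚ n → ℚ → Matrix ℚ n
  shift A t i j = A i j + - single i 1ℚ j * t

  shift-symmetric : ∀ {n} (A : Matrix ℚ n) t → Symmetric A → Symmetric (shift A t)
  shift-symmetric A t symA i j = cong₂ (λ a s → a + - s * t) (symA i j) (single-sym i j 1ℚ)

  apply-shift : ∀ {n} (A : Matrix ℚ n) t x i → apply (shift A t) x i ≡ apply A x i - t * x i
  apply-shift A t x i = begin
    ∑ (λ j → shift A t i j * x j)
      ≡⟨ trans (∑-cong λ j → trans (solve 4 (λ a s t x → (a :+ (:- s) :* t) :* x := a :* x :+ (:- t) :* (x :* s)) refl
            (A i j) (single i 1ℚ j) t (x j)) refl)
          (∑-+ (λ j → A i j * x j) (λ j → - t * (x j * single i 1ℚ j))) ⟩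
    apply A x i + ∑ (λ j → - t * (x j * single i 1ℚ j))
      ≡⟨ cong (apply A x i +_) (trans (∑-* (- t) (λ j → x j * single i 1ℚ j)) (cong (- t *_) (∑-single x i 1ℚ))) ⟩
    apply A x i + - t * (x i * 1ℚ)
      ≡⟨ solve 3 (λ a t x → a :+ (:- t) :* (x :* con 1ℚ) := a :- t :* x) refl (apply A x i) t (x i) ⟩
    _ ∎
    where open ≡-Reasoning

  quad-shift : ∀ {n} (A : Matrix ℚ n) t x → quad (shift A t) x ≡ quad A x - t * dot x x
  quad-shift A t x = begin
    ∑ (λ i → x i * apply (shift A t) x i)
      ≡⟨ trans (∑-cong λ i → trans (cong (x i *_) (apply-shift A t x i))
            (solve 3 (λ x a t → x :* (a :- t :* x) := x :* a :+ (:- t) :* (x :* x)) refl (x i) (apply A x i) t))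
          (∑-+ (λ i → x i * apply A x i) (λ i → - t * (x i * x i))) ⟩
    quad A x + ∑ (λ i → - t * (x i * x i))
      ≡⟨ cong (quad A x +_) (∑-* (- t) (λ i → x i * x i)) ⟩
    quad A x + - t * dot x x
      ≡⟨ solve 3 (λ q t d → q :+ (:- t) :* d := q :- t :* d) refl (quad A x) t (dot x x) ⟩
    _ ∎
    where open ≡-Reasoning

  dot-nonneg : ∀ {n} (x : Fin n → ℚ) → 0ℚ ≤ dot x x
  dot-nonneg x = ∑-nonneg λ i → sq-nonneg (x i)

  -- Sum the terms x_i² + x_j² + 2 x_i A_ij x_j over all i and j. Each is nonnegative since A_ij² ≤
  -- 1, and the total is twice the form of A + nI.
  psd-below : ∀ {n} (A : Matrix ℚ n) → (∀ i j → A i j * A i j ≤ 1ℚ) → ∀ t → t ≤ - num n → PSD (shift A t)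
  psd-below {n} A small t t≤-n x = ℚ.*-cancelˡ-≤-pos two ⦃ positive (ℚ.positive⁻¹ two) ⦄
    (subst₂ _≤_ (sym (ℚ.*-zeroʳ two)) refl (ℚ.≤-trans doubled≥0 (ℚ.≤-reflexive (sym eq))))
    where
    s = dot x x
    term : Fin n → Fin n → ℚ
    term i j = x i * x i + x j * x j + two * (x i * (A i j * x j))
    term≥0 : ∀ i j → 0ℚ ≤ term i j
    term≥0 i j = subst (0ℚ ≤_)
      (solve 3 (λ x y a → (x :+ a :* y) :* (x :+ a :* y) :+ (con 1ℚ :- a :* a) :* (y :* y)
        := x :* x :+ y :* y :+ con two :* (x :* (a :* y))) refl (x i) (x j) (A i j))
      (+-nonneg (sq-nonneg (x i + A i j * x j)) (*-nonneg (to-diff (small i j)) (sq-nonneg (x j))))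
    inner : ∀ i → ∑ (term i) ≡ num n * (x i * x i) + s + two * (x i * apply A x i)
    inner i = trans (∑-+ (λ j → x i * x i + x j * x j) (λ j → two * (x i * (A i j * x j))))
      (cong₂ _+_ (trans (∑-+ (λ _ → x i * x i) (λ j → x j * x j)) (cong (_+ s) (∑-const n (x i * x i))))
        (trans (∑-* two (λ j → x i * (A i j * x j))) (cong (two *_) (∑-* (x i) (λ j → A i j * x j)))))
    total : ∑ (λ i → ∑ (term i)) ≡ num n * s + num n * s + two * quad A x
    total = trans (∑-cong inner) (trans (∑-+ (λ i → num n * (x i * x i) + s) (λ i → two * (x i * apply A x i)))
      (cong₂ _+_ (trans (∑-+ (λ i → num n * (x i * x i)) (λ _ → s)) (cong₂ _+_ (∑-* (num n) (λ i → x i * x i)) (∑-const n s)))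
        (∑-* two (λ i → x i * apply A x i))))
    doubled≥0 : 0ℚ ≤ (num n * s + num n * s + two * quad A x) + two * (s * (- num n - t))
    doubled≥0 = +-nonneg (subst (0ℚ ≤_) total (∑-nonneg λ i → ∑-nonneg (term≥0 i)))
      (*-nonneg two≥0 (*-nonneg (dot-nonneg x) (to-diff t≤-n)))
    eq : two * quad (shift A t) x ≡ (num n * s + num n * s + two * quad A x) + two * (s * (- num n - t))
    eq = trans (cong (two *_) (quad-shift A t x))
      (solve 4 (λ q t s n → con two :* (q :- t :* s) := (n :* s :+ n :* s :+ con two :* q) :+ con two :* (s :* (:- n :- t))) refl
        (quad A x) t s (num n))

  Negative : ∀ {n} → Matrix ℚ n → Set
  Negative M = ∃[ x ] quad M x < 0ℚ

  -- The form of A - t decreases as t grows, so a shift with a negative value cannot lie at or below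
  -- a semidefinite one.
  below-negative : ∀ {n} (A : Matrix ℚ n) {t u} → PSD (shift A t) → Negative (shift A u) → t < u
  below-negative A {t} {u} psd (x , neg) = ℚ.≰⇒> λ u≤t →
    ℚ.<-irrefl refl (ℚ.≤-<-trans (psd x) (ℚ.≤-<-trans
      (subst₂ _≤_ (sym (quad-shift A t x)) (sym (quad-shift A u x)) (from-diff (subst (0ℚ ≤_)
        (solve 4 (λ q s t u → s :* (t :- u) := (q :- u :* s) :- (q :- t :* s)) refl (quad A x) (dot x x) t u)
        (*-nonneg (dot-nonneg x) (to-diff u≤t))))) neg))

  crossing : ∀ {n} (A : Matrix ℚ n) → Symmetric A → ∀ (f : ℕ → ℚ) J →
    PSD (shift A (f 0)) → Negative (shift A (f J)) →
    ∃[ j ] PSD (shift A (f j)) × Negative (shift A (f (suc j)))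
  crossing A symA f zero psd (x , neg) = contradiction (ℚ.≤-<-trans (psd x) neg) (ℚ.<-irrefl refl)
  crossing A symA f (suc J) psd neg with psd? (shift A (f J)) (shift-symmetric A (f J) symA)
  ... | inj₁ psd′ = J , psd′ , neg
  ... | inj₂ neg′ = crossing A symA f J psd neg′

  -- The supremum t of {t ∣ A - t is positive semidefinite} is the least eigenvalue of A.
  module Supremum {n} (Aᵣ : Matrix ℝ n) (A : Matrix ℚ n) (constant : ∀ i j k → seq (Aᵣ i j) k ≡ A i j) (symA : Symmetric A) (small : ∀ i j → A i j * A i j ≤ 1ℚ)
                  (c : ℚ) (c≤0 : c ≤ 0ℚ) (neg : Negative (shift A c)) where
    bottom : ℚ
    bottom = c - num n

    -- Steps of size 1/(k + 1), starting at c - n, where `psd-below` applies, and reaching `c` after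
    -- n (k + 1) of them.
    grid : ℕ → ℕ → ℚ
    grid k j = bottom + num j * mesh k

    psd-bottom : ∀ k → PSD (shift A (grid k 0))
    psd-bottom k = psd-below A small (grid k 0) (from-diff (subst (0ℚ ≤_)
      (solve 3 (λ c n h → :- c := :- n :- (c :- n :+ con 0ℚ :* h)) refl c (num n) (mesh k))
      (ℚ.neg-antimono-≤ c≤0)))

    grid-top : ∀ k → grid k (n ℕ.* suc k) ≡ c
    grid-top k = trans (cong (λ t → bottom + t * mesh k) (trans (cong ι (ℤ.pos-* n (suc k))) (ι-* (ℤ.+ n) (ℤ.+ suc k))))
      (trans (solve 4 (λ c n s h → c :- n :+ n :* s :* h := c :- n :+ n :* (s :* h)) refl c (num n) (num (suc k)) (mesh k))
        (trans (cong (λ t → bottom + num n * t) (num-mesh k))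
          (solve 2 (λ c n → c :- n :+ n :* con 1ℚ := c) refl c (num n))))

    abstract
      crossings : ∀ k → ∃[ t ] PSD (shift A t) × Negative (shift A (t + mesh k))
      crossings k =
        let j , psd , neg′ = crossing A symA (grid k) (n ℕ.* suc k) (psd-bottom k)
              (subst (λ t → Negative (shift A t)) (sym (grid-top k)) neg)
        in grid k j , psd , subst (λ t → Negative (shift A t))
             (trans (cong (λ t → bottom + t * mesh k) (num-suc j))
               (solve 3 (λ b j h → b :+ (con 1ℚ :+ j) :* h := b :+ j :* h :+ h) refl bottom (num j) (mesh k))) neg′

    lo : ℕ → ℚ
    lo k = proj₁ (crossings k)

    psd-lo : ∀ k → PSD (shift A (lo k))
    psd-lo k = proj₁ (proj₂ (crossings k))

    neg-hi : ∀ k → Negative (shift A (lo k + mesh k))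
    neg-hi k = proj₂ (proj₂ (crossings k))

    lo<hi : ∀ k l → lo k < lo l + mesh l
    lo<hi k l = below-negative A (psd-lo k) (neg-hi l)

    close : ∀ {p q ε} → p < q + ε → q < p + ε → ∣ p - q ∣ < ε
    close {p} {q} {ε} lt gt with ℚ.∣p∣≡p∨∣p∣≡-p (p - q)
    ... | inj₁ eq = subst (_< ε) (sym eq) (from-diff-< (subst (0ℚ <_)
            (solve 3 (λ p q e → q :+ e :- p := e :- (p :- q)) refl p q ε) (to-diff-< lt)))
    ... | inj₂ eq = subst (_< ε) (sym eq) (from-diff-< (subst (0ℚ <_)
            (solve 3 (λ p q e → p :+ e :- q := e :- (:- (p :- q))) refl p q ε) (to-diff-< gt)))

    -- Every semidefinite shift lies below every negative one, so lo k < lo l + mesh l for all k and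
    -- l; this is already the Cauchy property.
    sup : ℝ
    sup .seq = lo
    sup .cauchy ε ε>0 =
      let N , small-mesh = mesh-small ε ε>0
      in N , λ k l N≤k N≤l → close
           (ℚ.<-trans (lo<hi k l) (ℚ.+-monoʳ-< (lo l) (small-mesh l N≤l)))
           (ℚ.<-trans (lo<hi l k) (ℚ.+-monoʳ-< (lo k) (small-mesh k N≤k)))

    shifted : Matrix ℝ n
    shifted i j = fromℚ (A i j) +ᵣ fromℚ (- single i 1ℚ j) *ᵣ sup

    -- Write q for the form at the shift `lo k`. Coercivity bounds x · x by n K q for every x, so
    -- raising the shift by a mesh h with h (n K + 1) ≤ 1 keeps q - h (x · x) nonnegative. But
    -- `neg-hi` provides an x for which it is negative.
    not-coercive : ¬ Coercive shifted
    not-coercive (K , K>0 , coe) =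
      let m = num n * K + 1ℚ
          m>0 = ℚ.+-mono-≤-< (*-nonneg (num≥0 n) (ℚ.<⇒≤ K>0)) (ℚ.positive⁻¹ 1ℚ)
          ε , ε>0 , mε≡1 = inverse m>0
          N , at = ev-× coe (mesh-small ε ε>0)
          bound , mesh<ε = at N ℕ.≤-refl
          x , neg′ = neg-hi N
      in absurd N x m m>0 ε mε≡1 refl bound mesh<ε neg′
      where
      absurd : ∀ k x m → 0ℚ < m → ∀ ε → m * ε ≡ 1ℚ → m ≡ num n * K + 1ℚ →
        (∀ x i → x i * x i ≤ K * quad (shift A (lo k)) x) →
        mesh k < ε → ¬ (quad (shift A (lo k + mesh k)) x < 0ℚ)
      absurd k x m m>0 ε mε≡1 m≡ bound mesh<ε lt = ℚ.<-irrefl refl (ℚ.≤-<-trans (subst (0ℚ ≤_)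
          (trans (cong (λ m → (num n * (K * q) - s) * h + ((1ℚ - m * h) * q + h * q)) m≡)
            (solve 5 (λ n k q s h → (n :* (k :* q) :- s) :* h :+ ((con 1ℚ :- (n :* k :+ con 1ℚ) :* h) :* q :+ h :* q)
              := q :- h :* s) refl (num n) K q s h))
          (+-nonneg (*-nonneg (to-diff s≤) (ℚ.<⇒≤ (mesh>0 k)))
            (+-nonneg (*-nonneg (to-diff mh≤1) (psd-lo k x)) (*-nonneg (ℚ.<⇒≤ (mesh>0 k)) (psd-lo k x)))))
          (subst (_< 0ℚ) eq lt))
        where
        h = mesh k
        q = quad (shift A (lo k)) x
        s = dot x x
        s≤ : s ≤ num n * (K * q)
        s≤ = subst (s ≤_) (∑-const n (K * q)) (∑-mono (bound x))
        mh≤1 : m * h ≤ 1ℚ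
        mh≤1 = subst (m * h ≤_) mε≡1 (*-monoˡ (ℚ.<⇒≤ m>0) (ℚ.<⇒≤ mesh<ε))
        eq : quad (shift A (lo k + h)) x ≡ q - h * s
        eq = trans (quad-shift A (lo k + h) x)
          (trans (solve 4 (λ q l h s → q :- (l :+ h) :* s := q :- l :* s :- h :* s) refl (quad A x) (lo k) h s)
            (cong (_- h * s) (sym (quad-shift A (lo k) x))))

    kernel-eigenvalue : Kernel shifted → IsEigenvalue Aᵣ sup
    kernel-eigenvalue (v , v≢0 , null) = v , v≢0 , λ i ε ε>0 →
      ev-map (λ k → subst (λ t → ∣ t ∣ < ε) (eq i k)) (null i ε ε>0)
      where
      eq : ∀ i k → seq (mulᵣ shifted v i) k - 0ℚ ≡ seq (mulᵣ Aᵣ v i) k - lo k * seq (v i) k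
      eq i k = trans (minus-zero _) (trans (seq-∑ (λ j → shifted i j *ᵣ v j) k)
        (trans (apply-shift A (lo k) (λ j → seq (v j) k) i)
          (cong (_- lo k * seq (v i) k) (sym (trans (seq-∑ (λ j → Aᵣ i j *ᵣ v j) k)
            (∑-cong λ j → cong (_* seq (v j) k) (constant i j k)))))))

    sup-eigenvalue : ¬ ¬ IsEigenvalue Aᵣ sup
    sup-eigenvalue ¬eig = kernel-or-coercive shifted (λ k → shift-symmetric A (lo k) symA) (0 , λ k _ → psd-lo k) λ where
      (inj₁ ker) → ¬eig (kernel-eigenvalue ker)
      (inj₂ coe) → not-coercive coe

    -- A negative value q at `x` survives a small decrease of the shift. With s = x · x and r = 1 /
    -- (s + 1), the decrease δ = -q r changes the value to q - q r s = r q, which is still negative.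
    gap : ∃[ δ ] 0ℚ < δ × Negative (shift A (c - δ))
    gap =
      let x , neg′ = neg
          s = dot x x
          m = - quad (shift A c) x
          m>0 = ℚ.neg-antimono-< neg′
          r , r>0 , sr≡1 = inverse {s + 1ℚ} (ℚ.+-mono-≤-< (dot-nonneg x) (ℚ.positive⁻¹ 1ℚ))
      in m * r , *-positive m>0 r>0 , x , below x r r>0 sr≡1 neg′
      where
      below : ∀ x r → 0ℚ < r → (dot x x + 1ℚ) * r ≡ 1ℚ → quad (shift A c) x < 0ℚ →
              quad (shift A (c - (- quad (shift A c) x) * r)) x < 0ℚ
      below x r r>0 sr≡1 lt = subst (_< 0ℚ) (sym eq)
          (subst (r * q <_) (ℚ.*-zeroʳ r) (ℚ.*-monoʳ-<-pos r ⦃ positive r>0 ⦄ lt))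
        where
        q = quad (shift A c) x
        s = dot x x
        eq : quad (shift A (c - (- q) * r)) x ≡ r * q
        eq = trans (quad-shift A (c - (- q) * r) x)
          (trans (solve 5 (λ a c q r s → a :- (c :- (:- q) :* r) :* s := (a :- c :* s) :- q :* ((s :+ con 1ℚ) :* r) :+ r :* q) refl (quad A x) c q r s)
            (trans (cong₂ (λ u v → u - q * v + r * q) (sym (quad-shift A c x)) sr≡1)
              (solve 2 (λ q r → q :- q :* con 1ℚ :+ r :* q := r :* q) refl q r)))

    -- The chain c ≤ μ ≤ sup ≤ c - δ, read at one late index. The first two inequalities hold there
    -- up to ε = δ / 4 each, and the last one holds exactly by `below-negative`.
    contradictory : ∀ μ → (∀ ν → IsEigenvalue Aᵣ ν → μ ≤ᵣ ν) → ¬ (fromℚ c ≤ᵣ μ)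
    contradictory μ least c≤μ = sup-eigenvalue λ eig →
      let δ , δ>0 , neg′ = gap
          ε , ε>0 , 4ε≡δ = quarter δ δ>0
          N , at = ev-× (c≤μ ε ε>0) (least sup eig ε ε>0)
          c<μ+ε , μ<lo+ε = at N ℕ.≤-refl
      in squeeze (seq μ N) (lo N) ε δ ε>0 4ε≡δ c<μ+ε μ<lo+ε (below-negative A (psd-lo N) neg′)
      where
      squeeze : ∀ m l ε δ → 0ℚ < ε → ε + ε + (ε + ε) ≡ δ → c < m + ε → m < l + ε → ¬ (l < c - δ)
      squeeze m l ε _ ε>0 refl c<m+ε m<l+ε l<c-δ = ℚ.<-irrefl (sym eq) positive-sum
        where
        positive-sum : 0ℚ < ((m + ε - c) + (l + ε - m)) + (((c - (ε + ε + (ε + ε))) - l) + (ε + ε))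
        positive-sum = +-positive
          (+-positive {m + ε - c} {l + ε - m} (to-diff-< {c} {m + ε} c<m+ε) (to-diff-< {m} {l + ε} m<l+ε))
          (+-positive {(c - (ε + ε + (ε + ε))) - l} {ε + ε} (to-diff-< {l} {c - (ε + ε + (ε + ε))} l<c-δ) (+-positive ε>0 ε>0))
        eq : ((m + ε - c) + (l + ε - m)) + (((c - (ε + ε + (ε + ε))) - l) + (ε + ε)) ≡ 0ℚ
        eq = solve 4 (λ m l e c → ((m :+ e :- c) :+ (l :+ e :- m)) :+ (((c :- (e :+ e :+ (e :+ e))) :- l) :+ (e :+ e)) := con 0ℚ) refl m l ε c

  psd-of-least-eigenvalue : ∀ {n} (Aᵣ : Matrix ℝ n) (A : Matrix ℚ n) → (∀ i j k → seq (Aᵣ i j) k ≡ A i j) →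
    Symmetric A → (∀ i j → A i j * A i j ≤ 1ℚ) → ∀ c → c ≤ 0ℚ → ∀ μ → (∀ ν → IsEigenvalue Aᵣ ν → μ ≤ᵣ ν) →
    fromℚ c ≤ᵣ μ → PSD (shift A c)
  psd-of-least-eigenvalue Aᵣ A constant symA small c c≤0 μ least c≤μ = [ (λ psd → psd) ,
    (λ neg → contradiction c≤μ (Supremum.contradictory Aᵣ A constant symA small c c≤0 neg μ least)) ]′
    (psd? (shift A c) (shift-symmetric A c symA))

-- Integer bilinear forms on formal combinations

module Forms where
  open Sums
  open import Data.Integer using (ℤ; +_; 0ℤ; 1ℤ; _+_; _*_; -_; _-_; _≤_; ∣_∣; +≤+)
  open import Data.Integer.Properties as ℤ
  open import Data.Integer.Solver using (module +-*-Solver)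
  open import Data.List using (concatMap)
  open +-*-Solver

  private
    variable
      X Y : Set

  Combination : Set → Set
  Combination X = List (ℤ × X)

  form : (X → X → ℤ) → Combination X → Combination X → ℤ
  form k w w′ = ∑ (λ (a , x) → ∑ (λ (b , y) → a * b * k x y) w′) w

  -- The ℓ¹ norm of the coefficients. It measures sensitivity: by `form-bound`, an entrywise error e
  -- changes a form by at most the product of the two weights times e.
  weight : Combination X → ℤ
  weight = ∑ λ (a , _) → + ∣ a ∣

  form-cong : ∀ {k k′ : X → X → ℤ} w w′ → (∀ x y → k x y ≡ k′ x y) → form k w w′ ≡ form k′ w w′
  form-cong w w′ eq = ∑-cong w λ (a , x) → ∑-cong w′ λ (b , y) → cong (a * b *_) (eq x y)

  form-+ : ∀ (k k′ : X → X → ℤ) w w′ → form (λ x y → k x y + k′ x y) w w′ ≡ form k w w′ + form k′ w w′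
  form-+ k k′ w w′ = trans
    (∑-cong w λ (a , x) → trans
      (∑-cong w′ λ (b , y) → ℤ.*-distribˡ-+ (a * b) (k x y) (k′ x y))
      (∑-+ (λ (b , y) → a * b * k x y) (λ (b , y) → a * b * k′ x y) w′))
    (∑-+ (λ (a , x) → ∑ (λ (b , y) → a * b * k x y) w′) (λ (a , x) → ∑ (λ (b , y) → a * b * k′ x y) w′) w)

  form-* : ∀ c (k : X → X → ℤ) w w′ → form (λ x y → c * k x y) w w′ ≡ c * form k w w′
  form-* c k w w′ = trans
    (∑-cong w λ (a , x) → trans
      (∑-cong w′ λ (b , y) → solve 3 (λ ab c k → ab :* (c :* k) := c :* (ab :* k)) refl (a * b) c (k x y))
      (∑-* c (λ (b , y) → a * b * k x y) w′))
    (∑-* c (λ (a , x) → ∑ (λ (b , y) → a * b * k x y) w′) w)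

  scale : (X → ℤ × Y) → Combination X → Combination Y
  scale ρ = map λ (a , x) → a * proj₁ (ρ x) , proj₂ (ρ x)

  form-scale : ∀ (k : Y → Y → ℤ) (ρ : X → ℤ × Y) w w′ →
    form k (scale ρ w) (scale ρ w′) ≡
    form (λ x y → proj₁ (ρ x) * proj₁ (ρ y) * k (proj₂ (ρ x)) (proj₂ (ρ y))) w w′
  form-scale k ρ w w′ = trans
    (∑-map (λ (a , x) → ∑ (λ (b , y) → a * b * k x y) (scale ρ w′)) (λ (a , x) → a * proj₁ (ρ x) , proj₂ (ρ x)) w)
    (∑-cong w λ (a , x) → trans
      (∑-map (λ (b , y) → a * proj₁ (ρ x) * b * k (proj₂ (ρ x)) y) (λ (b , y) → b * proj₁ (ρ y) , proj₂ (ρ y)) w′)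
      (∑-cong w′ λ (b , y) → solve 5 (λ a s b t k → a :* s :* (b :* t) :* k := a :* b :* (s :* t :* k)) refl
        a (proj₁ (ρ x)) b (proj₁ (ρ y)) (k (proj₂ (ρ x)) (proj₂ (ρ y)))))

  form-map : ∀ (k : Y → Y → ℤ) (v : X → Y) w w′ →
    form k (scale (λ x → 1ℤ , v x) w) (scale (λ x → 1ℤ , v x) w′) ≡ form (λ x y → k (v x) (v y)) w w′
  form-map k v w w′ = trans (form-scale k (λ x → 1ℤ , v x) w w′) (form-cong w w′ λ x y → ℤ.*-identityˡ _)

  form-bound : ∀ (d : X → X → ℤ) e → (∀ x y → + ∣ d x y ∣ ≤ e) → ∀ w w′ →
    form d w w′ ≤ weight w * weight w′ * e
  form-bound d e d≤e w w′ = ℤ.≤-trans (∑-mono w λ { {a , x} _ → row a x }) (ℤ.≤-reflexive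
      (trans (∑-cong w λ (a , x) → solve 3 (λ a v e → a :* (v :* e) := v :* e :* a) refl (+ ∣ a ∣) (weight w′) e)
        (trans (∑-* (weight w′ * e) (λ (a , x) → + ∣ a ∣) w)
          (solve 3 (λ a v e → v :* e :* a := a :* v :* e) refl (weight w) (weight w′) e))))
    where
    entry : ∀ a b d → + ∣ d ∣ ≤ e → a * b * d ≤ + ∣ a ∣ * e * + ∣ b ∣
    entry a b d d≤e = ℤ.≤-trans (i≤∣i∣ (a * b * d)) (subst₂ _≤_ (sym abs)
      (solve 3 (λ a b e → a :* b :* e := a :* e :* b) refl (+ ∣ a ∣) (+ ∣ b ∣) e)
      (ℤ.*-monoˡ-≤-nonNeg (+ ∣ a ∣ * + ∣ b ∣) ⦃ Data.Integer.nonNegative (0≤* {+ ∣ a ∣} {+ ∣ b ∣} (+≤+ ℕ.z≤n) (+≤+ ℕ.z≤n)) ⦄ d≤e))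
      where
      import Data.Integer
      abs : + ∣ a * b * d ∣ ≡ + ∣ a ∣ * + ∣ b ∣ * + ∣ d ∣
      abs = trans (cong +_ (ℤ.abs-* (a * b) d)) (trans (ℤ.pos-* ∣ a * b ∣ ∣ d ∣)
        (cong (_* + ∣ d ∣) (trans (cong +_ (ℤ.abs-* a b)) (ℤ.pos-* ∣ a ∣ ∣ b ∣))))
    row : ∀ a x → ∑ (λ (b , y) → a * b * d x y) w′ ≤ + ∣ a ∣ * (weight w′ * e)
    row a x = ℤ.≤-trans (∑-mono w′ λ { {b , y} _ → entry a b (d x y) (d≤e x y) })
      (ℤ.≤-reflexive (trans (∑-* (+ ∣ a ∣ * e) (λ (b , y) → + ∣ b ∣) w′)
        (solve 3 (λ a v e → a :* e :* v := a :* (v :* e)) refl (+ ∣ a ∣) (weight w′) e)))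

  form-approx : ∀ (k k′ : X → X → ℤ) e → (∀ x y → + ∣ k x y - k′ x y ∣ ≤ e) → ∀ w w′ →
    form k w w′ ≤ form k′ w w′ + weight w * weight w′ * e
  form-approx k k′ e close w w′ = subst (_≤ form k′ w w′ + weight w * weight w′ * e)
    (sym (trans (form-cong w w′ λ x y → solve 2 (λ k k′ → k := k′ :+ (k :- k′)) refl (k x y) (k′ x y))
      (form-+ k′ (λ x y → k x y - k′ x y) w w′)))
    (ℤ.+-monoʳ-≤ (form k′ w w′) (form-bound (λ x y → k x y - k′ x y) e close w w′))

  -- Passes from a configuration in the graph to its Gram matrix of numerals, where a negative value
  -- is found by evaluation.
  gram : ∀ {p} {k : X → X → ℤ} (v : Fin p → X) (Γ : Fin p → Fin p → ℤ) → (∀ i j → k (v i) (v j) ≡ Γ i j) →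
    (∀ w → 0ℤ ≤ form k w w) → ∀ w → 0ℤ ≤ form Γ w w
  gram {k = k} v Γ eq nonneg w = subst (0ℤ ≤_)
    (trans (form-map k v w w) (form-cong w w eq)) (nonneg (scale (λ x → 1ℤ , v x) w))

  expand : (Y → Combination X) → Combination Y → Combination X
  expand θ = concatMap λ (a , y) → map (λ (b , x) → a * b , x) (θ y)

  ∑-expand : ∀ (f : X → ℤ) (θ : Y → Combination X) w →
    ∑ (λ (a , x) → a * f x) (expand θ w) ≡ ∑ (λ (a , y) → a * ∑ (λ (b , x) → b * f x) (θ y)) w
  ∑-expand f θ []            = refl
  ∑-expand f θ ((a , y) ∷ w) = trans
    (∑-++ (λ (a , x) → a * f x) (map (λ (b , x) → a * b , x) (θ y)) (expand θ w))
    (cong₂ _+_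
      (trans (∑-map (λ (a , x) → a * f x) (λ (b , x) → a * b , x) (θ y))
        (trans (∑-cong (θ y) λ (b , x) → ℤ.*-assoc a b (f x)) (∑-* a (λ (b , x) → b * f x) (θ y))))
      (∑-expand f θ w))

  form-factor : ∀ (k : X → X → ℤ) w w′ → form k w w′ ≡ ∑ (λ (a , x) → a * ∑ (λ (b , y) → b * k x y) w′) w
  form-factor k w w′ = ∑-cong w λ (a , x) → trans
    (∑-cong w′ λ (b , y) → ℤ.*-assoc a b (k x y)) (∑-* a (λ (b , y) → b * k x y) w′)

  form-expand : ∀ (k : X → X → ℤ) (θ : Y → Combination X) w w′ →
    form k (expand θ w) (expand θ w′) ≡ form (λ y y′ → form k (θ y) (θ y′)) w w′
  form-expand k θ w w′ = begin
    form k (expand θ w) (expand θ w′)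
      ≡⟨ form-factor k (expand θ w) (expand θ w′) ⟩
    ∑ (λ (a , x) → a * ∑ (λ (b , y) → b * k x y) (expand θ w′)) (expand θ w)
      ≡⟨ ∑-expand (λ x → ∑ (λ (b , y) → b * k x y) (expand θ w′)) θ w ⟩
    ∑ (λ (a , y) → a * ∑ (λ (c , x) → c * ∑ (λ (b , z) → b * k x z) (expand θ w′)) (θ y)) w
      ≡⟨ ∑-cong w (λ (a , y) → cong (a *_) (trans (∑-cong (θ y) λ (c , x) →
           trans (cong (c *_) (∑-expand (k x) θ w′)) (sym (∑-* c (λ (b , z) → b * ∑ (λ (d , t) → d * k x t) (θ z)) w′)))
           (trans (∑-swap (λ (c , x) (b , z) → c * (b * ∑ (λ (d , t) → d * k x t) (θ z))) (θ y) w′)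
             (∑-cong w′ λ (b , z) → trans
               (trans (∑-cong (θ y) λ (c , x) → solve 3 (λ c b s → c :* (b :* s) := b :* (c :* s)) refl c b (∑ (λ (d , t) → d * k x t) (θ z)))
                 (∑-* b (λ (c , x) → c * ∑ (λ (d , t) → d * k x t) (θ z)) (θ y)))
               (cong (b *_) (sym (form-factor k (θ y) (θ z)))))))) ⟩
    ∑ (λ (a , y) → a * ∑ (λ (b , z) → b * form k (θ y) (θ z)) w′) w
      ≡⟨ form-factor (λ y z → form k (θ y) (θ z)) w w′ ⟨
    _ ∎
    where open ≡-Reasoning

  weight-expand : ∀ (θ : Y → Combination X) c → (∀ y → weight (θ y) ≤ c) → ∀ w → weight (expand θ w) ≤ weight w * c
  weight-expand θ c bound []            = ℤ.≤-reflexive (sym (ℤ.*-zeroˡ c))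
  weight-expand θ c bound ((a , y) ∷ w) = subst₂ _≤_
    (sym (trans (∑-++ (λ (a , _) → + ∣ a ∣) (map (λ (b , x) → a * b , x) (θ y)) (expand θ w))
      (cong (_+ weight (expand θ w)) (trans (∑-map (λ (a , _) → + ∣ a ∣) (λ (b , x) → a * b , x) (θ y))
        (trans (∑-cong (θ y) λ (b , x) → trans (cong +_ (ℤ.abs-* a b)) (ℤ.pos-* ∣ a ∣ ∣ b ∣))
          (∑-* (+ ∣ a ∣) (λ (b , _) → + ∣ b ∣) (θ y)))))))
    (sym (ℤ.*-distribʳ-+ c (+ ∣ a ∣) (weight w)))
    (ℤ.+-mono-≤ (ℤ.*-monoˡ-≤-nonNeg (+ ∣ a ∣) (bound y)) (weight-expand θ c bound w))

  weight-nonneg : ∀ (w : Combination X) → 0ℤ ≤ weight w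
  weight-nonneg w = ∑-nonneg w λ _ → +≤+ ℕ.z≤n

-- The form A + 3I on vertices and on indicator vectors

module GraphForm where
  open Sums
  open Forms
  open Quad using (PSD; quad; single)
  open Spectral using (ι; ι-+; ι-*; ι-cancel-≤; psd-of-least-eigenvalue; shift)
  open import Data.Fin using (_≟_)
  open import Data.Integer using (ℤ; +_; -[1+_]; 0ℤ; 1ℤ; _+_; _*_; -_; _-_; _≤_)
  open import Data.Integer.Properties as ℤ hiding (_≟_)
  open import Data.Integer.Solver using (module +-*-Solver)
  open import Data.List.Membership.Propositional.Properties using (∈-allFin)
  import Data.Rational as ℚ
  import Data.Rational.Properties as ℚ
  open +-*-Solver

  allFin-unique : ∀ n → Unique (allFin n)
  allFin-unique n = AllPairs.tabulate⁺ id

  ∑-allFin-δ : ∀ {n} (f : Fin n → ℤ) y → ∑ (λ x → δ _≟_ x y * f x) (allFin n) ≡ f y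
  ∑-allFin-δ {n} f y = ∑-δ _≟_ f (allFin-unique n) (∈-allFin y)

  ι-∑ : ∀ {n} (f : Fin n → ℤ) → Quad.∑ (λ i → ι (f i)) ≡ ι (∑ f (allFin n))
  ι-∑ {ℕ.zero}  f = refl
  ι-∑ {ℕ.suc n} f = trans (cong (ι (f zero) ℚ.+_) (ι-∑ (f ∘ suc)))
    (trans (sym (ι-+ (f zero) (∑ (f ∘ suc) (allFin n))))
      (cong (λ t → ι (f zero + t)) (sym (∑-tabulate f suc))))

  single-δ : ∀ {n} (i j : Fin n) → single i ℚ.1ℚ j ≡ ι (δ _≟_ i j)
  single-δ zero    zero    = refl
  single-δ zero    (suc j) = refl
  single-δ (suc i) zero    = refl
  single-δ (suc i) (suc j) = trans (single-δ i j) (cong ι (eq i j))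
    where
    eq : ∀ i j → δ _≟_ i j ≡ δ _≟_ (suc i) (suc j)
    eq i j with i ≟ j
    ... | yes refl = refl
    ... | no _     = refl

  module _ (G : Graph) where
    open Graph G

    B : V → V → ℤ
    B x y = adjacencyMatrix x y + + 3 * δ _≟_ x y

    -- The inner product under A + 3I of the indicator vectors of two lists, counted with
    -- multiplicity.
    K : List V → List V → ℤ
    K L M = ∑ (λ x → ∑ (B x) M) L

    δ-sym : ∀ (x y : V) → δ _≟_ x y ≡ δ _≟_ y x
    δ-sym x y with x ≟ y
    ... | yes refl = sym (δ-refl _≟_ x)
    ... | no x≢y   = sym (δ-≢ _≟_ (x≢y ∘ sym))

    B-sym : ∀ x y → B x y ≡ B y x
    B-sym x y = cong₂ (λ a d → (if a then 1ℤ else 0ℤ) + + 3 * d) (symmetric x y) (δ-sym x y)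

    K-sym : ∀ L M → K L M ≡ K M L
    K-sym L M = trans (∑-swap B L M) (∑-cong M λ y → ∑-cong L λ x → B-sym x y)

    flatten : Combination (List V) → Combination V
    flatten = expand (map (1ℤ ,_))

    form-flatten : ∀ w w′ → form B (flatten w) (flatten w′) ≡ form K w w′
    form-flatten w w′ = trans (form-expand B (map (1ℤ ,_)) w w′) (form-cong w w′ λ L M → trans
      (∑-map (λ (a , x) → ∑ (λ (b , y) → a * b * B x y) (map (1ℤ ,_) M)) (1ℤ ,_) L)
      (∑-cong L λ x → trans (∑-map (λ (b , y) → 1ℤ * b * B x y) (1ℤ ,_) M) (∑-cong M λ y → ℤ.*-identityˡ (B x y))))

    -- Collects a formal combination into an actual vector indexed by the vertices, the kind of
    -- argument that semidefiniteness of the matrix speaks about.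
    coefficient : Combination V → V → ℤ
    coefficient w x = ∑ (λ (a , y) → a * δ _≟_ x y) w

    ∑-coefficient : ∀ w (f : V → ℤ) → ∑ (λ x → coefficient w x * f x) (allFin order) ≡ ∑ (λ (a , y) → a * f y) w
    ∑-coefficient w f = begin
      ∑ (λ x → coefficient w x * f x) (allFin order)
        ≡⟨ ∑-cong (allFin order) (λ x → trans (ℤ.*-comm (coefficient w x) (f x))
             (trans (sym (∑-* (f x) (λ (a , y) → a * δ _≟_ x y) w))
               (∑-cong w λ (a , y) → solve 3 (λ f a d → f :* (a :* d) := a :* (d :* f)) refl (f x) a (δ _≟_ x y)))) ⟩
      ∑ (λ x → ∑ (λ (a , y) → a * (δ _≟_ x y * f x)) w) (allFin order)
        ≡⟨ ∑-swap (λ x (a , y) → a * (δ _≟_ x y * f x)) (allFin order) w ⟩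
      ∑ (λ (a , y) → ∑ (λ x → a * (δ _≟_ x y * f x)) (allFin order)) w
        ≡⟨ ∑-cong w (λ (a , y) → trans (∑-* a (λ x → δ _≟_ x y * f x) (allFin order)) (cong (a *_) (∑-allFin-δ f y))) ⟩
      _ ∎
      where open ≡-Reasoning

    form-coefficient : ∀ w → form B w w ≡
      ∑ (λ x → coefficient w x * ∑ (λ y → B x y * coefficient w y) (allFin order)) (allFin order)
    form-coefficient w = trans (form-factor B w w) (sym (trans
      (∑-coefficient w (λ x → ∑ (λ y → B x y * coefficient w y) (allFin order)))
      (∑-cong w λ (a , x) → cong (a *_) (trans (∑-cong (allFin order) λ y → ℤ.*-comm (B x y) (coefficient w y)) (∑-coefficient w (B x))))))

    A : Matrix ℚ.ℚ order
    A x y = ι (adjacencyMatrix x y)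

    minus-three : ℚ.ℚ
    minus-three = ι -[1+ 2 ]

    shift-B : ∀ x y → shift A minus-three x y ≡ ι (B x y)
    shift-B x y = sym (trans (ι-+ (adjacencyMatrix x y) (+ 3 * δ _≟_ x y)) (cong (A x y ℚ.+_)
      (trans (ι-* (+ 3) (δ _≟_ x y)) (trans (cong (ι (+ 3) ℚ.*_) (sym (single-δ x y))) (swap (single x ℚ.1ℚ y))))))
      where
      open import Data.Rational.Solver renaming (module +-*-Solver to ℚ-Solver)
      swap : ∀ s → ι (+ 3) ℚ.* s ≡ (ℚ.- s) ℚ.* minus-three
      swap s = ℚ-Solver.solve 1 (λ s → ℚ-Solver.con (ι (+ 3)) ℚ-Solver.:* s ℚ-Solver.:= (ℚ-Solver.:- s) ℚ-Solver.:* ℚ-Solver.con minus-three) refl s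

    quad-ι : ∀ (z : V → ℤ) → quad (shift A minus-three) (ι ∘ z) ≡
      ι (∑ (λ x → z x * ∑ (λ y → B x y * z y) (allFin order)) (allFin order))
    quad-ι z = trans
      (Quad.∑-cong λ x → trans (cong (ι (z x) ℚ.*_)
        (trans (Quad.∑-cong λ y → trans (cong (ℚ._* ι (z y)) (shift-B x y)) (sym (ι-* (B x y) (z y))))
          (ι-∑ (λ y → B x y * z y))))
        (sym (ι-* (z x) (∑ (λ y → B x y * z y) (allFin order)))))
      (ι-∑ (λ x → z x * ∑ (λ y → B x y * z y) (allFin order)))

    small-square : ∀ b → ι (if b then 1ℤ else 0ℤ) ℚ.* ι (if b then 1ℤ else 0ℤ) ℚ.≤ ℚ.1ℚ
    small-square true  = ℚ.≤-refl
    small-square false = ℚ.<⇒≤ (ℚ.positive⁻¹ ℚ.1ℚ)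

    form-nonneg : ∀ μ → IsλMin G μ → fromℤ -[1+ 2 ] ≤ᵣ μ → ∀ w → 0ℤ ≤ form K w w
    form-nonneg μ (_ , least) -3≤μ w = subst (0ℤ ≤_) (trans (sym (form-coefficient (flatten w))) (form-flatten w w))
      (ι-cancel-≤ (subst (ℚ.0ℚ ℚ.≤_) (quad-ι z) (psd (ι ∘ z))))
      where
      z : V → ℤ
      z = coefficient (flatten w)
      psd : PSD (shift A minus-three)
      psd = psd-of-least-eigenvalue realAdjacencyMatrix A (λ _ _ _ → refl)
        (λ x y → cong (λ b → ι (if b then 1ℤ else 0ℤ)) (symmetric x y)) (λ x y → small-square (adj x y))
        minus-three (ℚ.<⇒≤ (ℚ.negative⁻¹ minus-three)) μ least -3≤μ

-- Configurations excluded by nonnegativity of the form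

module Cliques where
  open Sums
  open Forms
  open GraphForm
  open import Data.Empty using (⊥)
  open import Data.Fin using (_≟_)
  open import Data.Integer using (ℤ; +_; 0ℤ; 1ℤ; -1ℤ; _+_; _*_; -_; _-_; _≤_; _≤?_)
  open import Data.Integer.Properties as ℤ hiding (_≟_; _≤?_)
  open import Data.Integer.Solver using (module +-*-Solver)
  open import Data.List.Membership.Propositional using (_∈_)
  import Data.List.Membership.DecPropositional as DecMembership
  open +-*-Solver

  T-not : ∀ {b} → T (not b) → ¬ T b
  T-not {true}  ()
  T-not {false} _ ()

  not-T : ∀ {b} → ¬ T b → T (not b)
  not-T {true}  ¬t = ¬t _
  not-T {false} _  = _

  module _ (G : Graph) where
    open Graph G

    Clique : List V → Set
    Clique = AllPairs Adj

    -- Closeness is made reflexive so that a member of a clique is close to all of it and far from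
    -- none.
    close far : V → V → Bool
    close x y = adj x y ∨ does (x ≟ y)
    far x y = not (close x y)

    close-sym : ∀ x y → close x y ≡ close y x
    close-sym x y = cong₂ _∨_ (symmetric x y) (does-sym x y)
      where
      does-sym : ∀ (x y : V) → does (x ≟ y) ≡ does (y ≟ x)
      does-sym x y with x ≟ y | y ≟ x
      ... | yes _    | yes _    = refl
      ... | no _     | no _     = refl
      ... | yes refl | no y≢y   = contradiction refl y≢y
      ... | no x≢x   | yes refl = contradiction refl x≢x

    adj-sym : ∀ {x y} → Adj x y → Adj y x
    adj-sym {x} {y} = subst T (symmetric x y)

    adj-≢ : ∀ {x y} → Adj x y → x ≢ y
    adj-≢ {x} a refl = subst T (irreflexive x) a

    adj-close : ∀ {x y} → Adj x y → T (close x y)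
    adj-close {x} {y} a with adj x y
    ... | true = _

    ≡-close : ∀ {x y} → x ≡ y → T (close x y)
    ≡-close {x} refl with adj x x | x ≟ x
    ... | true  | _      = _
    ... | false | yes _  = _
    ... | false | no x≢x = x≢x refl

    close-cases : ∀ {x y} → T (close x y) → Adj x y ⊎ x ≡ y
    close-cases {x} {y} c with adj x y | x ≟ y
    ... | true  | _       = inj₁ _
    ... | false | yes x≡y = inj₂ x≡y
    ... | false | no _    = contradiction c λ ()

    B-refl : ∀ x → B G x x ≡ + 3
    B-refl x = cong₂ (λ a d → (if a then 1ℤ else 0ℤ) + + 3 * d) (irreflexive x) (δ-refl _≟_ x)

    B-adj : ∀ {x y} → Adj x y → B G x y ≡ 1ℤ
    B-adj a = cong₂ (λ a d → (if a then 1ℤ else 0ℤ) + + 3 * d) (T⇒≡ a) (δ-≢ _≟_ (adj-≢ a))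

    B-far : ∀ {x y} → T (far x y) → B G x y ≡ 0ℤ
    B-far f = cong₂ (λ a d → (if a then 1ℤ else 0ℤ) + + 3 * d)
      (¬T⇒≡ (T-not f ∘ adj-close)) (δ-≢ _≟_ (T-not f ∘ ≡-close))

    B-close : ∀ x y → B G x y ≡ 𝟙 (close x y) + + 2 * δ _≟_ x y
    B-close x y with adj x y in eq | x ≟ y
    ... | true  | yes refl = contradiction (trans (sym eq) (irreflexive x)) λ ()
    ... | true  | no _     = refl
    ... | false | yes _    = refl
    ... | false | no _     = refl

    K-const : ∀ {b} L M → (∀ {x y} → x ∈ L → y ∈ M → B G x y ≡ b) → K G L M ≡ ∣ L ∣ₗ * (∣ M ∣ₗ * b)
    K-const {b} L M eq = trans (∑-cong-∈ L λ x∈ → trans (∑-cong-∈ M (eq x∈)) (∑-const b M)) (∑-const (∣ M ∣ₗ * b) L)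

    K-diag : ∀ {b L} → AllPairs (λ x y → B G x y ≡ b) L → K G L L ≡ ∣ L ∣ₗ * (+ 3 + b * (∣ L ∣ₗ - 1ℤ))
    K-diag {b} [] = refl
    K-diag {b} {x ∷ L} (eq ∷ rel) = begin
      B G x x + ∑ (B G x) L + ∑ (λ y → B G y x + ∑ (B G y) L) L
        ≡⟨ cong₂ _+_ (cong₂ _+_ (B-refl x) row≡) (trans (∑-+ (λ y → B G y x) (λ y → ∑ (B G y) L) L)
             (cong₂ _+_ (trans (∑-cong L λ y → B-sym G y x) row≡) (K-diag rel))) ⟩
      + 3 + ∣ L ∣ₗ * b + (∣ L ∣ₗ * b + ∣ L ∣ₗ * (+ 3 + b * (∣ L ∣ₗ - 1ℤ)))
        ≡⟨ solve 2 (λ l b → con (+ 3) :+ l :* b :+ (l :* b :+ l :* (con (+ 3) :+ b :* (l :- con 1ℤ)))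
             := (con 1ℤ :+ l) :* (con (+ 3) :+ b :* (con 1ℤ :+ l :- con 1ℤ))) refl ∣ L ∣ₗ b ⟩
      _ ∎
      where
      open ≡-Reasoning
      row≡ : ∑ (B G x) L ≡ ∣ L ∣ₗ * b
      row≡ = trans (∑-cong-∈ L λ y∈ → All.lookup eq y∈) (∑-const b L)

    clique-close : ∀ {C x y} → Clique C → x ∈ C → y ∈ C → T (close x y)
    clique-close (x~ ∷ cl) (here refl) (here refl) = ≡-close refl
    clique-close (x~ ∷ cl) (here refl) (there y∈)  = adj-close (All.lookup x~ y∈)
    clique-close (x~ ∷ cl) (there x∈)  (here refl) = adj-close (adj-sym (All.lookup x~ x∈))
    clique-close (x~ ∷ cl) (there x∈)  (there y∈)  = clique-close cl x∈ y∈

    clique-adj : ∀ {C x y} → Clique C → x ∈ C → y ∈ C → x ≢ y → Adj x y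
    clique-adj cl x∈ y∈ x≢y with close-cases (clique-close cl x∈ y∈)
    ... | inj₁ a   = a
    ... | inj₂ x≡y = contradiction x≡y x≢y

    clique-unique : ∀ {C} → Clique C → Unique C
    clique-unique = AllPairs.map adj-≢

    module _ (nonneg : ∀ w → 0ℤ ≤ form (K G) w w) where
      -- The vector 3x minus the sum of the coclique has value 27 - 60 + 30 = -3. For a coclique of
      -- size k and coefficient a the value is 3a² - 2ak + 3k, which cannot be negative for k ≤ 9.
      no-coclique : ∀ x ys → AllPairs (λ y z → T (far y z)) ys → (∀ {y} → y ∈ ys → Adj x y) → length ys ≡ 10 → ⊥
      no-coclique x ys coclique x~ len = contradiction (gram v Γ eq nonneg ((+ 3 , # 0) ∷ (-1ℤ , # 1) ∷ [])) λ ()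
        where
        v : Fin 2 → List V
        v zero       = x ∷ []
        v (suc zero) = ys
        Γ : Fin 2 → Fin 2 → ℤ
        Γ zero       zero       = + 3
        Γ zero       (suc zero) = + 10
        Γ (suc zero) zero       = + 10
        Γ (suc zero) (suc zero) = + 30
        x-ys : K G (x ∷ []) ys ≡ + 10
        x-ys = trans (K-const (x ∷ []) ys λ { (here refl) y∈ → B-adj (x~ y∈) }) (cong (λ l → 1ℤ * (+ l * 1ℤ)) len)
        eq : ∀ i j → K G (v i) (v j) ≡ Γ i j
        eq zero       zero       = trans (ℤ.+-identityʳ _) (trans (ℤ.+-identityʳ _) (B-refl x))
        eq zero       (suc zero) = x-ys
        eq (suc zero) zero       = trans (K-sym G ys (x ∷ [])) x-ys
        eq (suc zero) (suc zero) = trans (K-diag (AllPairs.map B-far coclique)) (cong (λ l → + l * (+ 3 + 0ℤ * (+ l - 1ℤ))) len)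

      -- The vector 4x - P + R has value 48 - 104 + 195 + 195 - 338 = -4. For parts of size k and
      -- coefficient a the value is 3a² - 2ak + 4k, which cannot be negative for k ≤ 12; hence 13.
      no-split : ∀ {C} x P R → Clique C → Clique P → Clique R → (∀ {y} → y ∈ P → y ∈ C × Adj x y) →
        (∀ {y} → y ∈ R → y ∈ C × T (far x y)) → length P ≡ 13 → length R ≡ 13 → ⊥
      no-split x P R cl clP clR inP inR lenP lenR =
        contradiction (gram v Γ eq nonneg ((+ 4 , # 0) ∷ (-1ℤ , # 1) ∷ (1ℤ , # 2) ∷ [])) λ ()
        where
        v : Fin 3 → List V
        v zero             = x ∷ []
        v (suc zero)       = P
        v (suc (suc zero)) = R
        Γ : Fin 3 → Fin 3 → ℤ
        Γ zero             zero             = + 3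
        Γ zero             (suc zero)       = + 13
        Γ zero             (suc (suc zero)) = 0ℤ
        Γ (suc zero)       zero             = + 13
        Γ (suc zero)       (suc zero)       = + 195
        Γ (suc zero)       (suc (suc zero)) = + 169
        Γ (suc (suc zero)) zero             = 0ℤ
        Γ (suc (suc zero)) (suc zero)       = + 169
        Γ (suc (suc zero)) (suc (suc zero)) = + 195
        x-P : K G (x ∷ []) P ≡ + 13
        x-P = trans (K-const (x ∷ []) P λ { (here refl) y∈ → B-adj (proj₂ (inP y∈)) }) (cong (λ l → 1ℤ * (+ l * 1ℤ)) lenP)
        x-R : K G (x ∷ []) R ≡ 0ℤ
        x-R = trans (K-const (x ∷ []) R λ { (here refl) y∈ → B-far (proj₂ (inR y∈)) }) (cong (λ l → 1ℤ * (+ l * 0ℤ)) lenR)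
        P-R : K G P R ≡ + 169
        P-R = trans (K-const P R λ p∈ r∈ → B-adj (clique-adj cl (proj₁ (inP p∈)) (proj₁ (inR r∈))
                λ { refl → T-not (proj₂ (inR r∈)) (adj-close (proj₂ (inP p∈))) }))
              (cong₂ (λ l m → + l * (+ m * 1ℤ)) lenP lenR)
        diag : ∀ {L} → Clique L → length L ≡ 13 → K G L L ≡ + 195
        diag cl len = trans (K-diag (AllPairs.map B-adj cl)) (cong (λ l → + l * (+ 3 + 1ℤ * (+ l - 1ℤ))) len)
        eq : ∀ i j → K G (v i) (v j) ≡ Γ i j
        eq zero             zero             = trans (ℤ.+-identityʳ _) (trans (ℤ.+-identityʳ _) (B-refl x))
        eq zero             (suc zero)       = x-P
        eq zero             (suc (suc zero)) = x-R
        eq (suc zero)       zero             = trans (K-sym G P (x ∷ [])) x-P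
        eq (suc zero)       (suc zero)       = diag clP lenP
        eq (suc zero)       (suc (suc zero)) = P-R
        eq (suc (suc zero)) zero             = trans (K-sym G R (x ∷ [])) x-R
        eq (suc (suc zero)) (suc zero)       = trans (K-sym G R P) P-R
        eq (suc (suc zero)) (suc (suc zero)) = diag clR lenR

      -- For x outside the clique, close members are adjacent to x, so 13 close and 13 far members
      -- would form the configuration of `no-split`.
      far-or-close-few : ∀ {C} → Clique C → ∀ x → cnt (far x) C ≤ + 12 ⊎ cnt (close x) C ≤ + 12
      far-or-close-few {C} cl x with x ∈? C
        where open DecMembership _≟_ using (_∈?_)
      ... | yes x∈C = inj₁ (subst (_≤ + 12) (sym (cnt-none (far x) C λ y∈ f → T-not f (clique-close cl x∈C y∈))) (Data.Integer.+≤+ ℕ.z≤n))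
      ... | no x∉C with cnt (far x) C ≤? + 12 | cnt (close x) C ≤? + 12
      ...   | yes few | _       = inj₁ few
      ...   | no _    | yes few = inj₂ few
      ...   | no manyF | no manyC =
        let P , clP , lenP , inP = choose (close x) cl 13 (ℤ.i<j⇒suc[i]≤j (ℤ.≰⇒> manyC))
            R , clR , lenR , inR = choose (far x) cl 13 (ℤ.i<j⇒suc[i]≤j (ℤ.≰⇒> manyF))
        in contradiction (no-split x P R cl clP clR
             (λ y∈ → proj₁ (inP y∈) , adjacent (proj₁ (inP y∈)) (proj₂ (inP y∈))) inR lenP lenR) λ ()
        where
        adjacent : ∀ {y} → y ∈ C → T (close x y) → Adj x y
        adjacent y∈ c with close-cases c
        ... | inj₁ a    = a
        ... | inj₂ refl = contradiction y∈ x∉C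

-- Representatives of the fibres of a map

module Repr where
  open import Data.List.Membership.Propositional using (_∈_; find)
  open import Data.List.Relation.Unary.All.Properties using (¬Any⇒All¬)
  open import Data.List.Relation.Unary.Any using (any?)
  open import Relation.Binary using (DecidableEquality)

  module _ {A B : Set} (_≟_ : DecidableEquality B) (q : A → B) where
    representatives : List A → List A
    representatives [] = []
    representatives (x ∷ L) with any? (λ y → q x ≟ q y) (representatives L)
    ... | yes _ = representatives L
    ... | no _  = x ∷ representatives L

    representatives-distinct : ∀ L → AllPairs (λ x y → q x ≢ q y) (representatives L)
    representatives-distinct [] = []
    representatives-distinct (x ∷ L) with any? (λ y → q x ≟ q y) (representatives L)
    ... | yes _   = representatives-distinct L
    ... | no none = ¬Any⇒All¬ _ none ∷ representatives-distinct L

    representatives-cover : ∀ {L x} → x ∈ L → ∃[ y ] y ∈ representatives L × q x ≡ q y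
    representatives-cover {x ∷ L} (here refl) with any? (λ y → q x ≟ q y) (representatives L)
    ... | yes some = find some
    ... | no _     = x , here refl , refl
    representatives-cover {x ∷ L} (there x∈) with any? (λ y → q x ≟ q y) (representatives L)
    ... | yes _ = representatives-cover x∈
    ... | no _  = let y , y∈ , eq = representatives-cover x∈ in y , there y∈ , eq

    representatives-⊆ : ∀ {L x} → x ∈ representatives L → x ∈ L
    representatives-⊆ {x ∷ L} x∈ with any? (λ y → q x ≟ q y) (representatives L)
    representatives-⊆ {x ∷ L} x∈         | yes _ = there (representatives-⊆ x∈)
    representatives-⊆ {x ∷ L} (here eq)  | no _  = here eq
    representatives-⊆ {x ∷ L} (there x∈) | no _  = there (representatives-⊆ x∈)

-- Classes of n-cliques as fat vertices

module FatCliques where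
  open Sums
  open Forms
  open GraphForm
  open Cliques
  open Repr
  open import Data.Fin using (_≟_)
  open import Data.Integer using (ℤ; +_; -[1+_]; 0ℤ; 1ℤ; -1ℤ; _+_; _*_; -_; _-_; _≤_; _<_; _≤?_; ∣_∣; +≤+)
  open import Data.Integer.Properties as ℤ hiding (_≟_; _≤?_)
  open import Data.Integer.Solver using (module +-*-Solver)
  open import Data.List using (cartesianProductWith)
  open import Data.List.Membership.Propositional using (_∈_)
  open import Data.List.Membership.Propositional.Properties using (∈-cartesianProductWith⁺; ∈-allFin; ∈-map⁺)
  open import Data.Vec as Vec using (Vec)
  import Data.Vec.Properties as Vec
  open import Relation.Binary using (DecidableEquality)
  open import Relation.Nullary.Decidable using (_×-dec_)
  open +-*-Solver

  abs-bound : ∀ {i e} → 0ℤ ≤ e + i → 0ℤ ≤ e - i → + ∣ i ∣ ≤ e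
  abs-bound {+ n}      {e} lo hi = ≤-by hi refl
  abs-bound { -[1+ n ]} {e} lo hi = ≤-by lo refl

  module _ (G : Graph) (n : ℕ) where
    open Graph G

    record NClique : Set where
      constructor nclique
      field
        members : List V
        clique  : Clique G members
        size    : length members ≡ n
    open NClique public

    near : V → NClique → Bool
    near x C = does (cnt (far G x) (members C) ≤? + 12)

    -- A vector of Booleans, since its equality is decidable: two cliques belong to the same class
    -- when these vectors coincide.
    vicinity : NClique → Vec Bool order
    vicinity C = Vec.tabulate λ x → near x C

    _≟ᵛ_ : DecidableEquality (Vec Bool order)
    _≟ᵛ_ = Vec.≡-dec Bool._≟_

    lookup-vicinity : ∀ x C → Vec.lookup (vicinity C) x ≡ near x C
    lookup-vicinity x C = Vec.lookup∘tabulate (λ x → near x C) x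

    near-far : ∀ {x C} → T (near x C) → cnt (far G x) (members C) ≤ + 12
    near-far {x} {C} t with cnt (far G x) (members C) ≤? + 12
    ... | yes few = few

    far-few⇒near : ∀ {x C} → cnt (far G x) (members C) ≤ + 12 → T (near x C)
    far-few⇒near {x} {C} few with cnt (far G x) (members C) ≤? + 12
    ... | yes _   = _
    ... | no many = many few

    member-near : ∀ {x C} → x ∈ members C → T (near x C)
    member-near {x} {C} x∈ = far-few⇒near {x} {C} (subst (_≤ + 12)
      (sym (cnt-none (far G x) (members C) λ y∈ f → T-not f (clique-close G (clique C) x∈ y∈))) (+≤+ ℕ.z≤n))

    allLists : ℕ → List (List V)
    allLists zero    = [] ∷ []
    allLists (suc k) = cartesianProductWith _∷_ (allFin order) (allLists k)

    ∈-allLists : ∀ L → L ∈ allLists (length L)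
    ∈-allLists []      = here refl
    ∈-allLists (x ∷ L) = ∈-cartesianProductWith⁺ _∷_ (∈-allFin x) (∈-allLists L)

    select : List (List V) → List NClique
    select [] = []
    select (L ∷ Ls) with AllPairs.allPairs? (λ x y → T? (adj x y)) L ×-dec (length L ℕ.≟ n)
    ... | yes (cl , len) = nclique L cl len ∷ select Ls
    ... | no _           = select Ls

    -- The enumerated clique may carry other proofs than `C`; agreement of the members is enough
    -- because `near` looks at nothing else.
    ∈-select : ∀ {Ls} C → members C ∈ Ls → ∃[ C′ ] C′ ∈ select Ls × members C′ ≡ members C
    ∈-select {L ∷ Ls} C C∈ with AllPairs.allPairs? (λ x y → T? (adj x y)) L ×-dec (length L ℕ.≟ n)
    ∈-select {L ∷ Ls} C (here refl) | yes (cl , len) = nclique L cl len , here refl , refl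
    ∈-select {L ∷ Ls} C (there C∈)  | yes (cl , len) = let C′ , C′∈ , eq = ∈-select C C∈ in C′ , there C′∈ , eq
    ∈-select {L ∷ Ls} C (here refl) | no bad         = contradiction (clique C , size C) bad
    ∈-select {L ∷ Ls} C (there C∈)  | no _           = ∈-select C C∈

    fats : List NClique
    fats = representatives _≟ᵛ_ vicinity (select (allLists n))

    fats-distinct : AllPairs (λ C C′ → vicinity C ≢ vicinity C′) fats
    fats-distinct = representatives-distinct _≟ᵛ_ vicinity (select (allLists n))

    fats-cover : ∀ C → ∃[ F ] F ∈ fats × (∀ x → near x C ≡ near x F)
    fats-cover C =
      let C′ , C′∈ , eq = ∈-select C (subst (λ k → members C ∈ allLists k) (size C) (∈-allLists (members C)))
          F , F∈ , eq′ = representatives-cover _≟ᵛ_ vicinity C′∈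
      in F , F∈ , λ x → trans (cong (λ L → does (cnt (far G x) L ≤? + 12)) (sym eq))
           (trans (sym (lookup-vicinity x C′)) (trans (cong (λ v → Vec.lookup v x) eq′) (lookup-vicinity x F)))

    N : ℤ
    N = + n

    cnt-δ≤1 : ∀ x {L : List V} → Unique L → ∑ (δ _≟_ x) L ≤ 1ℤ
    cnt-δ≤1 x [] = +≤+ ℕ.z≤n
    cnt-δ≤1 x {y ∷ L} (y∉ ∷ uniq) with x ≟ y
    ... | yes refl = ℤ.≤-reflexive (trans (cong (λ t → 1ℤ + t)
            (trans (∑-cong-∈ L λ z∈ → δ-≢ _≟_ (All.lookup y∉ z∈)) (∑-zero L))) refl)
    ... | no _     = ℤ.≤-trans (ℤ.≤-reflexive (ℤ.+-identityˡ _)) (cnt-δ≤1 x uniq)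

    meets : NClique → NClique → ℤ
    meets C C′ = cnt (λ x → near x C′) (members C)

    module _ (n-large : + 15600 < N) (nonneg : ∀ w → 0ℤ ≤ form (K G) w w) where
      15601≤N : + 15601 ≤ N
      15601≤N = ℤ.i<j⇒suc[i]≤j n-large

      0≤N : 0ℤ ≤ N
      0≤N = +≤+ ℕ.z≤n

      far⊎close : ∀ x C → cnt (far G x) (members C) ≤ + 12 ⊎ cnt (close G x) (members C) ≤ + 12
      far⊎close x C = far-or-close-few G nonneg (clique C) x

      close+far : ∀ x C → cnt (close G x) (members C) + cnt (far G x) (members C) ≡ N
      close+far x C = trans (cnt-not (close G x) (members C)) (cong +_ (size C))

      not-near-close : ∀ {x C} → near x C ≡ false → cnt (close G x) (members C) ≤ + 12
      not-near-close {x} {C} eq with far⊎close x C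
      ... | inj₂ few = few
      ... | inj₁ few = contradiction (subst T eq (far-few⇒near {x} {C} few)) λ ()

      row : V → NClique → ℤ
      row x C = ∑ (B G x) (members C)

      -- A row is the number of close members, plus 2 if x is itself a member. With f far and c
      -- close members and d = 1 or 0 according to membership, it equals N - f + 2d with f ≤ 12 in
      -- the near case and c + 2d with c ≤ 12 otherwise; both deviations stay within 12 + 2 = 14.
      row-bounds : ∀ x C → 0ℤ ≤ + 14 + (row x C - N * 𝟙 (near x C)) × 0ℤ ≤ + 14 - (row x C - N * 𝟙 (near x C))
      row-bounds x C = bounds (near x C) refl
        where
        c f d : ℤ
        c = cnt (close G x) (members C)
        f = cnt (far G x) (members C)
        d = ∑ (δ _≟_ x) (members C)
        row≡ : row x C ≡ c + + 2 * d
        row≡ = trans (∑-cong (members C) (B-close G x))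
          (trans (∑-+ (𝟙 ∘ close G x) (λ y → + 2 * δ _≟_ x y) (members C))
            (cong (λ t → c + t) (∑-* (+ 2) (δ _≟_ x) (members C))))
        d≥0 : 0ℤ ≤ d
        d≥0 = ∑-nonneg (members C) λ {y} _ → 0≤𝟙 (does (x ≟ y))
        d≤1 : 0ℤ ≤ 1ℤ - d
        d≤1 = gap (cnt-δ≤1 x (clique-unique G (clique C)))
        f≥0 : 0ℤ ≤ f
        f≥0 = cnt-nonneg (far G x) (members C)
        c≥0 : 0ℤ ≤ c
        c≥0 = cnt-nonneg (close G x) (members C)
        bounds : ∀ b → near x C ≡ b → 0ℤ ≤ + 14 + (row x C - N * 𝟙 b) × 0ℤ ≤ + 14 - (row x C - N * 𝟙 b)
        bounds true eq = subst₂ (λ r m → 0ℤ ≤ + 14 + (r - m * 1ℤ) × 0ℤ ≤ + 14 - (r - m * 1ℤ)) (sym row≡) (close+far x C)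
          ( subst (0ℤ ≤_) (solve 3 (λ c f d → con (+ 2) :* d :+ (con (+ 12) :- f) :+ con (+ 2)
                  := con (+ 14) :+ (c :+ con (+ 2) :* d :- (c :+ f) :* con 1ℤ)) refl c f d)
                (0≤+ (0≤+ (0≤* {+ 2} (+≤+ ℕ.z≤n) d≥0) (gap (near-far {x} {C} (subst T (sym eq) _)))) (+≤+ ℕ.z≤n))
          , subst (0ℤ ≤_) (solve 3 (λ c f d → con (+ 2) :* (con 1ℤ :- d) :+ f :+ con (+ 12)
                  := con (+ 14) :- (c :+ con (+ 2) :* d :- (c :+ f) :* con 1ℤ)) refl c f d)
                (0≤+ (0≤+ (0≤* {+ 2} (+≤+ ℕ.z≤n) d≤1) f≥0) (+≤+ ℕ.z≤n)))
        bounds false eq = subst (λ r → 0ℤ ≤ + 14 + (r - N * 0ℤ) × 0ℤ ≤ + 14 - (r - N * 0ℤ)) (sym row≡)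
          ( subst (0ℤ ≤_) (solve 3 (λ c n d → c :+ con (+ 2) :* d :+ con (+ 14)
                  := con (+ 14) :+ (c :+ con (+ 2) :* d :- n :* con 0ℤ)) refl c N d)
                (0≤+ (0≤+ c≥0 (0≤* {+ 2} (+≤+ ℕ.z≤n) d≥0)) (+≤+ ℕ.z≤n))
          , subst (0ℤ ≤_) (solve 3 (λ c n d → (con (+ 12) :- c) :+ con (+ 2) :* (con 1ℤ :- d)
                  := con (+ 14) :- (c :+ con (+ 2) :* d :- n :* con 0ℤ)) refl c N d)
                (0≤+ (gap (not-near-close {x} {C} eq)) (0≤* {+ 2} (+≤+ ℕ.z≤n) d≤1)))

      -- Count the pairs (x, y) ∈ C × C′ such that x is near to C′ but far from y, or x is not near
      -- to C′ but close to y: every x occurs in at most 12 of them, and every y in at least 13.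
      meets-few-or-most : ∀ C C′ → meets C C′ ≤ + 24 ⊎ cnt (λ x → not (near x C′)) (members C) ≤ + 24
      meets-few-or-most C C′ with meets C C′ ≤? + 24 | cnt (λ x → not (near x C′)) (members C) ≤? + 24
      ... | yes few | _       = inj₁ few
      ... | no _    | yes few = inj₂ few
      ... | no p>24 | no r>24 = contradiction
              (subst (0ℤ ≤_) (solve 2 (λ n s → (s :- n :* con (+ 13)) :+ (n :* con (+ 12) :- s) :+ (n :- con (+ 15601))
                  := con -[1+ 15600 ]) refl N total) (0≤+ (0≤+ (gap lower) (gap upper)) (gap 15601≤N)))
              λ ()
        where
        bad : V → V → Bool
        bad x y = if near x C′ then far G x y else close G x y
        total : ℤ
        total = ∑ (λ x → cnt (bad x) (members C′)) (members C)
        few-bad : ∀ x b → near x C′ ≡ b → cnt (λ y → if b then far G x y else close G x y) (members C′) ≤ + 12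
        few-bad x true  eq = near-far {x} {C′} (subst T (sym eq) _)
        few-bad x false eq = not-near-close {x} {C′} eq
        upper : total ≤ N * + 12
        upper = subst (λ m → total ≤ m * + 12) (cong +_ (size C)) (∑-bound (members C) λ {x} _ → few-bad x (near x C′) refl)
        bad≥ : ∀ b c → 𝟙 (not b) - 𝟙 (not c) ≤ 𝟙 (if b then not c else c)
        bad≥ true  true  = ℤ.≤-refl
        bad≥ true  false = Data.Integer.-≤+
        bad≥ false true  = ℤ.≤-refl
        bad≥ false false = ℤ.≤-refl
        bad≥′ : ∀ b c → 𝟙 b - 𝟙 c ≤ 𝟙 (if b then not c else c)
        bad≥′ true  true  = ℤ.≤-refl
        bad≥′ true  false = ℤ.≤-refl
        bad≥′ false true  = Data.Integer.-≤+
        bad≥′ false false = ℤ.≤-refl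
        ∑-minus : ∀ (f g : V → ℤ) L → ∑ (λ x → f x - g x) L ≡ ∑ f L - ∑ g L
        ∑-minus f g L = trans (∑-cong L λ x → cong (λ t → f x + t) (sym (ℤ.-1*i≡-i (g x))))
          (trans (∑-+ f (λ x → -1ℤ * g x) L) (cong (λ t → ∑ f L + t) (trans (∑-* -1ℤ g L) (ℤ.-1*i≡-i (∑ g L)))))
        -- The bound 24 comes from here. If y is far from at most 12 members of C, the at least 25
        -- members not near to C′ include 13 close to y; if it is close to at most 12, the at least
        -- 25 members near to C′ include 13 far from y.
        column : ∀ y → + 13 ≤ ∑ (λ x → 𝟙 (bad x y)) (members C)
        column y with far⊎close y C
        ... | inj₁ few = ℤ.≤-trans
                (≤-by (0≤+ (gap (ℤ.i<j⇒suc[i]≤j (ℤ.≰⇒> r>24))) (gap few))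
                  (solve 2 (λ r f → (r :- con (+ 25)) :+ (con (+ 12) :- f) := r :- f :- con (+ 13)) refl
                    (cnt (λ x → not (near x C′)) (members C)) (cnt (far G y) (members C))))
                (ℤ.≤-trans (ℤ.≤-reflexive (sym (∑-minus (λ x → 𝟙 (not (near x C′))) (λ x → 𝟙 (far G y x)) (members C))))
                  (∑-mono (members C) λ {x} _ → subst (λ c → 𝟙 (not (near x C′)) - 𝟙 (not c) ≤ 𝟙 (bad x y)) (close-sym G x y)
                    (bad≥ (near x C′) (close G x y))))
        ... | inj₂ few = ℤ.≤-trans
                (≤-by (0≤+ (gap (ℤ.i<j⇒suc[i]≤j (ℤ.≰⇒> p>24))) (gap few))
                  (solve 2 (λ r f → (r :- con (+ 25)) :+ (con (+ 12) :- f) := r :- f :- con (+ 13)) refl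
                    (meets C C′) (cnt (close G y) (members C))))
                (ℤ.≤-trans (ℤ.≤-reflexive (sym (∑-minus (λ x → 𝟙 (near x C′)) (λ x → 𝟙 (close G y x)) (members C))))
                  (∑-mono (members C) λ {x} _ → subst (λ c → 𝟙 (near x C′) - 𝟙 c ≤ 𝟙 (bad x y)) (close-sym G x y)
                    (bad≥′ (near x C′) (close G x y))))
        lower : N * + 13 ≤ total
        lower = subst₂ _≤_ (trans (∑-const (+ 13) (members C′)) (cong (λ m → + m * + 13) (size C′)))
          (sym (∑-swap (λ x y → 𝟙 (bad x y)) (members C) (members C′)))
          (∑-mono (members C′) λ {y} _ → column y)

      -- The constant is 38 = 14 + 24: each of the n rows may be off by 14, and the number of
      -- members near to the other clique may be off by 24, each unit of which counts n.
      record Approx (i m : ℤ) : Set where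
        constructor approximates
        field
          error : + ∣ i - N * N * m ∣ ≤ + 38 * N

      approx-exact : ∀ k m → k ≡ m → Approx (N * N * k) m
      approx-exact k m refl = approximates (subst (λ t → + ∣ t ∣ ≤ + 38 * N) (sym (ℤ.i≡j⇒i-j≡0 {N * N * k} refl)) (0≤* {+ 38} (+≤+ ℕ.z≤n) 0≤N))

      approx-row : ∀ x C → Approx (N * row x C) (𝟙 (near x C))
      approx-row x C = approximates (abs-bound
        (subst (0ℤ ≤_) (solve 3 (λ n r b → n :* (con (+ 14) :+ (r :- n :* b)) :+ con (+ 24) :* n
            := con (+ 38) :* n :+ (n :* r :- n :* n :* b)) refl N (row x C) (𝟙 (near x C)))
          (0≤+ (0≤* 0≤N (proj₁ (row-bounds x C))) (0≤* {+ 24} (+≤+ ℕ.z≤n) 0≤N)))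
        (subst (0ℤ ≤_) (solve 3 (λ n r b → n :* (con (+ 14) :- (r :- n :* b)) :+ con (+ 24) :* n
            := con (+ 38) :* n :- (n :* r :- n :* n :* b)) refl N (row x C) (𝟙 (near x C)))
          (0≤+ (0≤* 0≤N (proj₂ (row-bounds x C))) (0≤* {+ 24} (+≤+ ℕ.z≤n) 0≤N))))

      approx-meets : ∀ C C′ b → 0ℤ ≤ + 24 + (meets C C′ - N * b) → 0ℤ ≤ + 24 - (meets C C′ - N * b) →
        Approx (K G (members C) (members C′)) b
      approx-meets C C′ b lo hi = approximates (abs-bound
        (subst (0ℤ ≤_) (solve 4 (λ k n t b → (k :- (n :* t :- n :* con (+ 14))) :+ n :* (con (+ 24) :+ (t :- n :* b))
            := con (+ 38) :* n :+ (k :- n :* n :* b)) refl κ N (meets C C′) b)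
          (0≤+ (gap κ≥) (0≤* 0≤N lo)))
        (subst (0ℤ ≤_) (solve 4 (λ k n t b → ((n :* t :+ n :* con (+ 14)) :- k) :+ n :* (con (+ 24) :- (t :- n :* b))
            := con (+ 38) :* n :- (k :- n :* n :* b)) refl κ N (meets C C′) b)
          (0≤+ (gap κ≤) (0≤* 0≤N hi))))
        where
        κ = K G (members C) (members C′)
        sum≡ : ∀ e → ∑ (λ x → N * 𝟙 (near x C′) + e) (members C) ≡ N * meets C C′ + N * e
        sum≡ e = trans (∑-+ (λ x → N * 𝟙 (near x C′)) (λ _ → e) (members C))
          (cong₂ _+_ (∑-* N (λ x → 𝟙 (near x C′)) (members C)) (trans (∑-const e (members C)) (cong (λ m → + m * e) (size C))))
        κ≤ : κ ≤ N * meets C C′ + N * + 14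
        κ≤ = subst (κ ≤_) (sum≡ (+ 14)) (∑-mono (members C) λ {x} _ → ≤-by (proj₂ (row-bounds x C′))
          (solve 3 (λ r n b → con (+ 14) :- (r :- n :* b) := n :* b :+ con (+ 14) :- r) refl (row x C′) N (𝟙 (near x C′))))
        κ≥ : N * meets C C′ - N * + 14 ≤ κ
        κ≥ = subst (_≤ κ) (trans (sum≡ -[1+ 13 ]) (solve 2 (λ n t → n :* t :+ n :* con -[1+ 13 ] := n :* t :- n :* con (+ 14)) refl N (meets C C′)))
          (∑-mono (members C) λ {x} _ → ≤-by (proj₁ (row-bounds x C′))
          (solve 3 (λ r n b → con (+ 14) :+ (r :- n :* b) := r :- (n :* b :+ con -[1+ 13 ])) refl (row x C′) N (𝟙 (near x C′))))

      meets≤N : ∀ C C′ → meets C C′ ≤ N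
      meets≤N C C′ = subst (meets C C′ ≤_) (cong +_ (size C)) (cnt-≤-length (λ x → near x C′) (members C))

      approx-same : ∀ C C′ → cnt (λ x → not (near x C′)) (members C) ≤ + 24 → Approx (K G (members C) (members C′)) 1ℤ
      approx-same C C′ few = approx-meets C C′ 1ℤ
        (subst (0ℤ ≤_) (trans (cong (λ r → + 24 - r) rest) (solve 2 (λ n t → con (+ 24) :- (n :- t) := con (+ 24) :+ (t :- n :* con 1ℤ)) refl N (meets C C′))) (gap few))
        (subst (0ℤ ≤_) (solve 2 (λ n t → con (+ 24) :+ (n :- t) := con (+ 24) :- (t :- n :* con 1ℤ)) refl N (meets C C′))
          (0≤+ {+ 24} (+≤+ ℕ.z≤n) (gap (meets≤N C C′))))
        where
        rest : cnt (λ x → not (near x C′)) (members C) ≡ N - meets C C′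
        rest = trans (solve 2 (λ r t → r := t :+ r :- t) refl (cnt (λ x → not (near x C′)) (members C)) (meets C C′))
          (cong (_- meets C C′) (trans (cnt-not (λ x → near x C′) (members C)) (cong +_ (size C))))

      approx-different : ∀ C C′ → meets C C′ ≤ + 24 → Approx (K G (members C) (members C′)) 0ℤ
      approx-different C C′ few = approx-meets C C′ 0ℤ
        (subst (0ℤ ≤_) (solve 2 (λ n t → con (+ 24) :+ t := con (+ 24) :+ (t :- n :* con 0ℤ)) refl N (meets C C′))
          (0≤+ {+ 24} (+≤+ ℕ.z≤n) (cnt-nonneg (λ x → near x C′) (members C))))
        (subst (0ℤ ≤_) (solve 2 (λ n t → con (+ 24) :- t := con (+ 24) :- (t :- n :* con 0ℤ)) refl N (meets C C′)) (gap few))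

      -- Replacing a vertex x by n x and a clique C by its indicator vector multiplies all
      -- inner products by n², up to an error that is linear in n.
      approx-nonneg : ∀ {X : Set} (ρ : X → ℤ × List V) (m : X → X → ℤ) →
        (∀ g h → Approx (proj₁ (ρ g) * proj₁ (ρ h) * K G (proj₂ (ρ g)) (proj₂ (ρ h))) (m g h)) →
        ∀ w → weight w ≤ + 20 → 0ℤ ≤ form m w w
      -- A negative integer `F` contributes at most -n², against an error of at most 400 · 38 n =
      -- 15200 n. Writing 15601 = 15200 + 401 turns the contradiction into a polynomial identity
      -- with negative right-hand side.
      approx-nonneg ρ m approx w w≤20 = ℤ.≮⇒≥ λ F<0 → contradiction
        (subst (0ℤ ≤_) (solve 3 (λ n f w →
            (n :* n :* f :+ w :* (con (+ 38) :* n)) :+ (con (+ 400) :- w) :* (con (+ 38) :* n)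
            :+ (n :* n :* (con -1ℤ :- f)) :+ n :* (n :- con (+ 15601)) :+ con (+ 401) :* (n :- con (+ 15601)) := con (- (+ 401 * + 15601)))
            refl N F (weight w * weight w))
          (0≤+ (0≤+ (0≤+ (0≤+ bound (0≤* (gap w²≤400) (0≤* {+ 38} (+≤+ ℕ.z≤n) 0≤N)))
            (0≤* (0≤* 0≤N 0≤N) (gap (ℤ.i<j⇒i≤pred[j] F<0)))) (0≤* 0≤N (gap 15601≤N))) (0≤* {+ 401} (+≤+ ℕ.z≤n) (gap 15601≤N))))
        λ ()
        where
        F = form m w w
        κ : _ → _ → ℤ
        κ g h = proj₁ (ρ g) * proj₁ (ρ h) * K G (proj₂ (ρ g)) (proj₂ (ρ h))
        w²≤400 : weight w * weight w ≤ + 400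
        w²≤400 = *-mono (weight-nonneg w) (weight-nonneg w) w≤20 w≤20
        bound : 0ℤ ≤ N * N * F + weight w * weight w * (+ 38 * N)
        bound = ℤ.≤-trans (subst (0ℤ ≤_) (form-scale (K G) ρ w w) (nonneg (scale ρ w)))
          (subst (λ t → form κ w w ≤ t + weight w * weight w * (+ 38 * N)) (form-* (N * N) m w w)
            (form-approx κ (λ g h → N * N * m g h) (+ 38 * N) (λ g h → Approx.error (approx g h)) w w))

      K-single : ∀ x y → K G (x ∷ []) (y ∷ []) ≡ B G x y
      K-single x y = trans (ℤ.+-identityʳ _) (ℤ.+-identityʳ _)

      approx-vertices : ∀ x y → Approx (N * N * K G (x ∷ []) (y ∷ [])) (B G x y)
      approx-vertices x y = approx-exact (K G (x ∷ []) (y ∷ [])) (B G x y) (K-single x y)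

      approx-vertex-clique : ∀ x C → Approx (N * 1ℤ * K G (x ∷ []) (members C)) (𝟙 (near x C))
      approx-vertex-clique x C = subst (λ t → Approx t (𝟙 (near x C)))
        (sym (cong₂ _*_ (ℤ.*-identityʳ N) (ℤ.+-identityʳ (row x C)))) (approx-row x C)

      approx-clique-vertex : ∀ x C → Approx (1ℤ * N * K G (members C) (x ∷ [])) (𝟙 (near x C))
      approx-clique-vertex x C = subst (λ t → Approx t (𝟙 (near x C)))
        (cong₂ _*_ (ℤ.*-comm N 1ℤ) (K-sym G (x ∷ []) (members C))) (approx-vertex-clique x C)

      approx-self : ∀ C → Approx (K G (members C) (members C)) 1ℤ
      approx-self C = approx-same C C (subst (_≤ + 24)
        (sym (cnt-none (λ x → not (near x C)) (members C) λ {x} x∈ ¬near → T-not ¬near (member-near {x} {C} x∈))) (+≤+ ℕ.z≤n))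

      -- If C and C′ have the same limit, their difference is null and x must have equal inner
      -- products with both. Explicitly, x - 2C + 2C′ has limiting value 3 - 4 + 4 + 4 - 8 = -1.
      no-separation : ∀ x C C′ → near x C ≡ true → near x C′ ≡ false → ¬ Approx (K G (members C) (members C′)) 1ℤ
      no-separation x C C′ x~C x≁C′ C~C′ = contradiction
        (approx-nonneg ρ Γ approx ((1ℤ , # 0) ∷ (-[1+ 1 ] , # 1) ∷ (+ 2 , # 2) ∷ []) (+≤+ (ℕ.m≤m+n 5 15))) λ ()
        where
        ρ : Fin 3 → ℤ × List V
        ρ zero             = N , x ∷ []
        ρ (suc zero)       = 1ℤ , members C
        ρ (suc (suc zero)) = 1ℤ , members C′
        Γ : Fin 3 → Fin 3 → ℤ
        Γ zero             zero             = + 3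
        Γ zero             (suc zero)       = 1ℤ
        Γ zero             (suc (suc zero)) = 0ℤ
        Γ (suc zero)       zero             = 1ℤ
        Γ (suc zero)       (suc zero)       = 1ℤ
        Γ (suc zero)       (suc (suc zero)) = 1ℤ
        Γ (suc (suc zero)) zero             = 0ℤ
        Γ (suc (suc zero)) (suc zero)       = 1ℤ
        Γ (suc (suc zero)) (suc (suc zero)) = 1ℤ
        unit : ∀ {k m} → Approx k m → Approx (1ℤ * 1ℤ * k) m
        unit {k} {m} = subst (λ t → Approx t m) (sym (ℤ.*-identityˡ k))
        approx : ∀ i j → Approx (proj₁ (ρ i) * proj₁ (ρ j) * K G (proj₂ (ρ i)) (proj₂ (ρ j))) (Γ i j)
        approx zero             zero             = subst (Approx _) (B-refl G x) (approx-vertices x x)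
        approx zero             (suc zero)       = subst (Approx _) (cong 𝟙 x~C) (approx-vertex-clique x C)
        approx zero             (suc (suc zero)) = subst (Approx _) (cong 𝟙 x≁C′) (approx-vertex-clique x C′)
        approx (suc zero)       zero             = subst (Approx _) (cong 𝟙 x~C) (approx-clique-vertex x C)
        approx (suc zero)       (suc zero)       = unit (approx-self C)
        approx (suc zero)       (suc (suc zero)) = unit C~C′
        approx (suc (suc zero)) zero             = subst (Approx _) (cong 𝟙 x≁C′) (approx-clique-vertex x C′)
        approx (suc (suc zero)) (suc zero)       = unit (subst (λ t → Approx t 1ℤ) (K-sym G (members C) (members C′)) C~C′)
        approx (suc (suc zero)) (suc (suc zero)) = unit (approx-self C′)

      -- Turns an approximate coincidence into an exact one. As a consequence, cliques with
      -- different vicinities fall into the other case of `meets-few-or-most` and are orthogonal in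
      -- the limit.
      same-vicinity : ∀ C C′ → cnt (λ x → not (near x C′)) (members C) ≤ + 24 → vicinity C ≡ vicinity C′
      same-vicinity C C′ few = Vec.tabulate-cong λ x → agree x (near x C) (near x C′) refl refl
        where
        agree : ∀ x b b′ → near x C ≡ b → near x C′ ≡ b′ → near x C ≡ near x C′
        agree x true  true  eq eq′ = trans eq (sym eq′)
        agree x false false eq eq′ = trans eq (sym eq′)
        agree x true  false eq eq′ = contradiction (approx-same C C′ few) (no-separation x C C′ eq eq′)
        agree x false true  eq eq′ = contradiction
          (subst (λ t → Approx t 1ℤ) (K-sym G (members C) (members C′)) (approx-same C C′ few)) (no-separation x C′ C eq′ eq)

      Generator : Set
      Generator = V ⊎ NClique

      m : Generator → Generator → ℤ
      m (inj₁ x) (inj₁ y)  = B G x y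
      m (inj₁ x) (inj₂ C)  = 𝟙 (near x C)
      m (inj₂ C) (inj₁ x)  = 𝟙 (near x C)
      m (inj₂ C) (inj₂ C′) = δ _≟ᵛ_ (vicinity C′) (vicinity C)

      approx-cliques : ∀ C C′ → Approx (1ℤ * 1ℤ * K G (members C) (members C′)) (m (inj₂ C) (inj₂ C′))
      approx-cliques C C′ = subst (λ t → Approx t (m (inj₂ C) (inj₂ C′))) (sym (ℤ.*-identityˡ _)) (decide (vicinity C′ ≟ᵛ vicinity C))
        where
        decide : Dec (vicinity C′ ≡ vicinity C) → Approx (K G (members C) (members C′)) (m (inj₂ C) (inj₂ C′))
        decide (yes eq) = subst (Approx _)
          (sym (trans (cong (λ v → δ _≟ᵛ_ v (vicinity C)) eq) (δ-refl _≟ᵛ_ (vicinity C))))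
          (approx-same C C′ (subst (_≤ + 24) (sym (cnt-none (λ x → not (near x C′)) (members C)
            λ {x} x∈ ¬near → T-not ¬near (subst T (trans (sym (lookup-vicinity x C))
              (trans (cong (λ v → Vec.lookup v x) (sym eq)) (lookup-vicinity x C′))) (member-near {x} {C} x∈)))) (+≤+ ℕ.z≤n)))
        decide (no neq) = subst (Approx _) (sym (δ-≢ _≟ᵛ_ neq)) (different (meets-few-or-most C C′))
          where
          different : meets C C′ ≤ + 24 ⊎ cnt (λ x → not (near x C′)) (members C) ≤ + 24 → Approx (K G (members C) (members C′)) 0ℤ
          different (inj₁ few)  = approx-different C C′ few
          different (inj₂ most) = contradiction (sym (same-vicinity C C′ most)) neq

      m-nonneg : ∀ w → weight w ≤ + 20 → 0ℤ ≤ form m w w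
      m-nonneg = approx-nonneg ρ m approx
        where
        ρ : Generator → ℤ × List V
        ρ (inj₁ x) = N , x ∷ []
        ρ (inj₂ C) = 1ℤ , members C
        approx : ∀ g h → Approx (proj₁ (ρ g) * proj₁ (ρ h) * K G (proj₂ (ρ g)) (proj₂ (ρ h))) (m g h)
        approx (inj₁ x) (inj₁ y)  = approx-vertices x y
        approx (inj₁ x) (inj₂ C)  = approx-vertex-clique x C
        approx (inj₂ C) (inj₁ x)  = approx-clique-vertex x C
        approx (inj₂ C) (inj₂ C′) = approx-cliques C C′

      -- When `L` lists the fat neighbours of `x`, this is the component of `x` orthogonal to all
      -- fat vertices, because those are orthonormal in the limit.
      star : V → List NClique → Combination Generator
      star x L = (1ℤ , inj₁ x) ∷ map (λ F → -1ℤ , inj₂ F) L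

      weight-star : ∀ x L → weight (star x L) ≡ 1ℤ + ∣ L ∣ₗ
      weight-star x L = cong (λ t → 1ℤ + t) (trans (∑-map (λ (a , _) → + ∣ a ∣) (λ F → -1ℤ , inj₂ F) L)
        (trans (∑-const 1ℤ L) (ℤ.*-identityʳ ∣ L ∣ₗ)))

      coincidences : List NClique → List NClique → ℤ
      coincidences L M = ∑ (λ F → ∑ (λ F′ → δ _≟ᵛ_ (vicinity F′) (vicinity F)) M) L

      form-star : ∀ x y L M → form m (star x L) (star y M) ≡
        B G x y - cnt (near x) M - cnt (near y) L + coincidences L M
      form-star x y L M = begin
        form m (star x L) (star y M)
          ≡⟨ form-factor m (star x L) (star y M) ⟩
        1ℤ * (1ℤ * B G x y + ∑ (λ (b , g) → b * m (inj₁ x) g) (map (λ F → -1ℤ , inj₂ F) M))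
          + ∑ (λ (a , g) → a * ∑ (λ (b , h) → b * m g h) (star y M)) (map (λ F → -1ℤ , inj₂ F) L)
          ≡⟨ cong₂ (λ s t → 1ℤ * (1ℤ * B G x y + s) + t)
               (trans (∑-map (λ (b , g) → b * m (inj₁ x) g) (λ F → -1ℤ , inj₂ F) M) (∑-* -1ℤ (𝟙 ∘ near x) M))
               (trans (∑-map (λ (a , g) → a * ∑ (λ (b , h) → b * m g h) (star y M)) (λ F → -1ℤ , inj₂ F) L)
                 (trans (∑-cong L λ F → cong (λ t → -1ℤ * (1ℤ * 𝟙 (near y F) + t))
                     (trans (∑-map (λ (b , h) → b * m (inj₂ F) h) (λ F → -1ℤ , inj₂ F) M) (∑-* -1ℤ (λ F′ → δ _≟ᵛ_ (vicinity F′) (vicinity F)) M)))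
                   (trans (∑-* -1ℤ (λ F → 1ℤ * 𝟙 (near y F) + -1ℤ * ∑ (λ F′ → δ _≟ᵛ_ (vicinity F′) (vicinity F)) M) L)
                     (cong (-1ℤ *_) (trans (∑-+ (λ F → 1ℤ * 𝟙 (near y F)) (λ F → -1ℤ * ∑ (λ F′ → δ _≟ᵛ_ (vicinity F′) (vicinity F)) M) L)
                       (cong₂ _+_ (∑-* 1ℤ (𝟙 ∘ near y) L) (∑-* -1ℤ (λ F → ∑ (λ F′ → δ _≟ᵛ_ (vicinity F′) (vicinity F)) M) L))))))) ⟩
        1ℤ * (1ℤ * B G x y + -1ℤ * cnt (near x) M) + -1ℤ * (1ℤ * cnt (near y) L + -1ℤ * coincidences L M)
          ≡⟨ solve 4 (λ b c d e → con 1ℤ :* (con 1ℤ :* b :+ con -1ℤ :* c) :+ con -1ℤ :* (con 1ℤ :* d :+ con -1ℤ :* e) := b :- c :- d :+ e) refl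
               (B G x y) (cnt (near x) M) (cnt (near y) L) (coincidences L M) ⟩
        _ ∎
        where open ≡-Reasoning

      ∑-vicinity : ∀ {L} → AllPairs (λ C C′ → vicinity C ≢ vicinity C′) L → ∀ (f : Vec Bool order → ℤ) {F} → F ∈ L →
        ∑ (λ F′ → δ _≟ᵛ_ (vicinity F′) (vicinity F) * f (vicinity F′)) L ≡ f (vicinity F)
      ∑-vicinity {L} distinct f {F} F∈ = trans (sym (∑-map (λ v → δ _≟ᵛ_ v (vicinity F) * f v) vicinity L))
        (∑-δ _≟ᵛ_ f (AllPairs.map⁺ distinct) (∈-map⁺ vicinity F∈))

      -- A vertex minus four of its fat neighbours has limiting value 3 - 4 - 4 + 4 = -1, at weight
      -- 5.
      fats-≤3 : ∀ x → cnt (near x) fats ≤ + 3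
      fats-≤3 x = ℤ.≮⇒≥ λ 3< →
        let L , distinct , size-L , in-L = choose (near x) fats-distinct 4 (ℤ.i<j⇒suc[i]≤j 3<)
            ∣L∣≡4 : ∣ L ∣ₗ ≡ + 4
            ∣L∣≡4 = cong +_ size-L
            near-L = trans (cnt-all (near x) L λ F∈ → proj₂ (in-L F∈)) ∣L∣≡4
            pairs : coincidences L L ≡ + 4
            pairs = trans (∑-cong-∈ L λ {F} F∈ → trans
                (∑-cong L λ F′ → sym (ℤ.*-identityʳ (δ _≟ᵛ_ (vicinity F′) (vicinity F)))) (∑-vicinity distinct (λ _ → 1ℤ) F∈))
              (trans (∑-const 1ℤ L) (trans (ℤ.*-identityʳ ∣ L ∣ₗ) ∣L∣≡4))
        in contradiction (subst (0ℤ ≤_)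
             (trans (form-star x x L L) (cong₂ _+_ (cong₂ _-_ (cong₂ _-_ (B-refl G x) near-L) near-L) pairs))
             (m-nonneg (star x L) (subst (_≤ + 20) (sym (trans (weight-star x L) (cong (λ l → 1ℤ + l) ∣L∣≡4))) (+≤+ (ℕ.m≤m+n 5 15)))))
           λ ()

      fatsAt : V → List NClique
      fatsAt x = filter (T? ∘ near x) fats

      common : V → V → ℤ
      common x y = cnt (λ F → near x F ∧ near y F) fats

      special : V → V → ℤ
      special x y = B G x y - common x y

      coincidences-fatsAt : ∀ x y → coincidences (fatsAt x) (fatsAt y) ≡ common x y
      coincidences-fatsAt x y = trans
        (∑-filter (λ F → ∑ (λ F′ → δ _≟ᵛ_ (vicinity F′) (vicinity F)) (fatsAt y)) (near x) fats)
        (∑-cong-∈ fats λ {F} F∈ → trans (cong (𝟙 (near x F) *_) (inner F F∈)) (sym (𝟙-∧ (near x F) (near y F))))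
        where
        inner : ∀ F → F ∈ fats → ∑ (λ F′ → δ _≟ᵛ_ (vicinity F′) (vicinity F)) (fatsAt y) ≡ 𝟙 (near y F)
        inner F F∈ = begin
          ∑ (λ F′ → δ _≟ᵛ_ (vicinity F′) (vicinity F)) (fatsAt y)
            ≡⟨ ∑-filter (λ F′ → δ _≟ᵛ_ (vicinity F′) (vicinity F)) (near y) fats ⟩
          ∑ (λ F′ → 𝟙 (near y F′) * δ _≟ᵛ_ (vicinity F′) (vicinity F)) fats
            ≡⟨ ∑-cong fats (λ F′ → trans (ℤ.*-comm (𝟙 (near y F′)) (δ _≟ᵛ_ (vicinity F′) (vicinity F)))
                 (cong (λ b → δ _≟ᵛ_ (vicinity F′) (vicinity F) * 𝟙 b) (sym (lookup-vicinity y F′)))) ⟩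
          ∑ (λ F′ → δ _≟ᵛ_ (vicinity F′) (vicinity F) * 𝟙 (Vec.lookup (vicinity F′) y)) fats
            ≡⟨ ∑-vicinity fats-distinct (λ v → 𝟙 (Vec.lookup v y)) F∈ ⟩
          𝟙 (Vec.lookup (vicinity F) y)
            ≡⟨ cong 𝟙 (lookup-vicinity y F) ⟩
          𝟙 (near y F) ∎
          where open ≡-Reasoning

      form-fatsAt : ∀ x y → form m (star x (fatsAt x)) (star y (fatsAt y)) ≡ special x y
      form-fatsAt x y = trans (form-star x y (fatsAt x) (fatsAt y))
        (trans (cong₂ _+_ (cong₂ _-_ (cong (λ t → B G x y - t) left) (cnt-filter (near x) (near y) fats)) (coincidences-fatsAt x y))
          (solve 2 (λ b c → b :- c :- c :+ c := b :- c) refl (B G x y) (common x y)))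
        where
        left : cnt (near x) (fatsAt y) ≡ common x y
        left = trans (cnt-filter (near y) (near x) fats) (∑-cong fats λ F → cong 𝟙 (Bool.∧-comm (near y F) (near x F)))

      -- The entries of `special` are the limiting inner products of the stars. A star has weight at
      -- most 1 + 3 = 4, so weight 5 in vertices becomes weight 20 in generators.
      special-nonneg : ∀ w → weight w ≤ + 5 → 0ℤ ≤ form special w w
      special-nonneg w w≤5 = subst (0ℤ ≤_)
        (trans (form-expand m θ w w) (form-cong w w form-fatsAt))
        (m-nonneg (expand θ w) (ℤ.≤-trans (weight-expand θ (+ 4) weight-θ w)
          (*-mono (weight-nonneg w) (+≤+ ℕ.z≤n) w≤5 (ℤ.≤-refl {+ 4}))))
        where
        θ : V → Combination Generator
        θ x = star x (fatsAt x)
        weight-θ : ∀ x → weight (θ x) ≤ + 4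
        weight-θ x = subst (_≤ + 4) (sym (trans (weight-star x (fatsAt x)) (cong (λ l → 1ℤ + l) (length-filter (near x) fats))))
          (ℤ.+-monoʳ-≤ 1ℤ (fats-≤3 x))

-- Ramsey's theorem and the existence of two fat neighbours

module TwoFat where
  open Sums
  open Forms
  open GraphForm
  open Cliques
  open FatCliques
  open import Data.Fin using (_≟_)
  open import Data.Integer using (ℤ; +_; 0ℤ; 1ℤ; -1ℤ; _+_; _*_; -_; _-_; _≤_; _<_; _≤?_; +≤+; +<+)
  open import Data.Integer.Properties as ℤ hiding (_≟_; _≤?_)
  open import Data.Integer.Solver using (module +-*-Solver)
  open import Data.List.Membership.Propositional using (_∈_)
  open import Data.List.Membership.Propositional.Properties using (∈-filter⁻)
  open +-*-Solver

  ramsey : ℕ → ℕ → ℕ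
  ramsey zero    q       = 0
  ramsey (suc p) zero    = 0
  ramsey (suc p) (suc q) = suc (ramsey p (suc q) ℕ.+ ramsey (suc p) q)

  cnt-two : ∀ {A : Set} (p : A → Bool) {L x y} → x ∈ L → y ∈ L → x ≢ y → T (p x) → T (p y) → + 2 ≤ cnt p L
  cnt-two p (here refl) (here refl) x≢y px py = contradiction refl x≢y
  cnt-two p {L = _ ∷ L} (here refl) (there y∈) x≢y px py =
    ℤ.+-mono-≤ (ℤ.≤-reflexive (sym (cong 𝟙 (T⇒≡ px)))) (cnt-member p y∈ py)
  cnt-two p {L = _ ∷ L} (there x∈) (here refl) x≢y px py =
    ℤ.+-mono-≤ (ℤ.≤-reflexive (sym (cong 𝟙 (T⇒≡ py)))) (cnt-member p x∈ px)
  cnt-two p {L = z ∷ L} (there x∈) (there y∈) x≢y px py =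
    ℤ.≤-trans (cnt-two p x∈ y∈ x≢y px py) (ℤ.≤-trans (ℤ.≤-reflexive (sym (ℤ.+-identityˡ _))) (ℤ.+-monoˡ-≤ (cnt p L) (0≤𝟙 (p z))))

  module _ (G : Graph) where
    open Graph G

    Homogeneous : ℕ → ℕ → List V → Set
    Homogeneous p q M = (Clique G M × length M ≡ p) ⊎ (AllPairs (λ x y → T (far G x y)) M × length M ≡ q)

    large-part : ∀ (p : V → Bool) a b L → a ℕ.+ b ℕ.≤ length L →
      a ℕ.≤ length (filter (T? ∘ p) L) ⊎ b ℕ.≤ length (filter (T? ∘ not ∘ p) L)
    large-part p a b L a+b≤ with a ℕ.≤? length (filter (T? ∘ p) L)
    ... | yes a≤ = inj₁ a≤
    ... | no a≰  = inj₂ (ℕ.+-cancelˡ-≤ a b _ (ℕ.≤-trans a+b≤ (ℕ.≤-trans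
            (ℕ.≤-reflexive (sym lengths)) (ℕ.+-monoˡ-≤ (length (filter (T? ∘ not ∘ p) L)) (ℕ.<⇒≤ (ℕ.≰⇒> a≰))))))
      where
      lengths : length (filter (T? ∘ p) L) ℕ.+ length (filter (T? ∘ not ∘ p) L) ≡ length L
      lengths = ℤ.+-injective (trans (ℤ.pos-+ (length (filter (T? ∘ p) L)) (length (filter (T? ∘ not ∘ p) L)))
        (trans (cong₂ _+_ (length-filter p L) (length-filter (not ∘ p) L)) (cnt-not p L)))

    ramsey-theorem : ∀ p q L → Unique L → ramsey p q ℕ.≤ length L →
      ∃[ M ] (∀ {x} → x ∈ M → x ∈ L) × Homogeneous p q M
    ramsey-theorem zero    q    L uniq big = [] , (λ ()) , inj₁ ([] , refl)
    ramsey-theorem (suc p) zero L uniq big = [] , (λ ()) , inj₂ ([] , refl)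
    ramsey-theorem (suc p) (suc q) (x ∷ L) (x∉ ∷ uniq) (ℕ.s≤s big)
      with large-part (adj x) (ramsey p (suc q)) (ramsey (suc p) q) L big
    ... | inj₁ many = extend (ramsey-theorem p (suc q) (filter (T? ∘ adj x) L) (AllPairs.filter⁺ (T? ∘ adj x) uniq) many)
      where
      extend : ∃[ M ] (∀ {y} → y ∈ M → y ∈ filter (T? ∘ adj x) L) × Homogeneous p (suc q) M →
               ∃[ M ] (∀ {y} → y ∈ M → y ∈ x ∷ L) × Homogeneous (suc p) (suc q) M
      extend (M , sub , inj₂ coclique) = M , (λ y∈ → there (proj₁ (∈-filter⁻ (T? ∘ adj x) {xs = L} (sub y∈)))) , inj₂ coclique
      extend (M , sub , inj₁ (cl , len)) = x ∷ M
        , (λ { (here refl) → here refl ; (there y∈) → there (proj₁ (∈-filter⁻ (T? ∘ adj x) {xs = L} (sub y∈))) })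
        , inj₁ (All.tabulate (λ y∈ → proj₂ (∈-filter⁻ (T? ∘ adj x) {xs = L} (sub y∈))) ∷ cl , cong suc len)
    ... | inj₂ many = extend (ramsey-theorem (suc p) q (filter (T? ∘ not ∘ adj x) L) (AllPairs.filter⁺ (T? ∘ not ∘ adj x) uniq) many)
      where
      extend : ∃[ M ] (∀ {y} → y ∈ M → y ∈ filter (T? ∘ not ∘ adj x) L) × Homogeneous (suc p) q M →
               ∃[ M ] (∀ {y} → y ∈ M → y ∈ x ∷ L) × Homogeneous (suc p) (suc q) M
      extend (M , sub , inj₁ cl) = M , (λ y∈ → there (proj₁ (∈-filter⁻ (T? ∘ not ∘ adj x) {xs = L} (sub y∈)))) , inj₁ cl
      extend (M , sub , inj₂ (coclique , len)) = x ∷ M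
        , (λ { (here refl) → here refl ; (there y∈) → there (proj₁ (∈-filter⁻ (T? ∘ not ∘ adj x) {xs = L} (sub y∈))) })
        , inj₂ (All.tabulate far-x ∷ coclique , cong suc len)
        where
        far-x : ∀ {y} → y ∈ M → T (far G x y)
        far-x {y} y∈ = not-T λ c → not-close c (close-cases G c)
          where
          y∈′ = ∈-filter⁻ (T? ∘ not ∘ adj x) {xs = L} (sub y∈)
          not-close : T (close G x y) → ¬ (Adj x y ⊎ x ≡ y)
          not-close _ (inj₁ a)   = T-not (proj₂ y∈′) a
          not-close _ (inj₂ x≡y) = All.lookup x∉ (proj₁ y∈′) x≡y

    neighbourList : V → List V
    neighbourList x = filter (T? ∘ adj x) (allFin order)

    some-member : ∀ {n} → + 15600 < + n → ∀ (C : NClique G n) → ∃[ y ] y ∈ members C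
    some-member {n} n-large C = nonempty (members C) (subst (λ k → + 15600 < + k) (sym (size C)) n-large)
      where
      nonempty : ∀ (L : List V) → + 15600 < + length L → ∃[ y ] y ∈ L
      nonempty []      (+<+ ())
      nonempty (y ∷ L) _ = y , here refl

    module _ (n : ℕ) (n-large : + 15600 < + n) (nonneg : ∀ w → 0ℤ ≤ form (K G) w w) (x : V) where
      private
        r = ramsey n 10
        nb = neighbourList x
        d = ∣ nb ∣ₗ

      nb-unique : Unique nb
      nb-unique = AllPairs.filter⁺ (T? ∘ adj x) (allFin-unique order)

      nb-adj : ∀ {y} → y ∈ nb → Adj x y
      nb-adj y∈ = proj₂ (∈-filter⁻ (T? ∘ adj x) {xs = allFin order} y∈)

      -- The other outcome of Ramsey's theorem, a coclique of size 10 among the neighbours of x, is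
      -- excluded by `no-coclique`.
      clique-in : ∀ (p : V → Bool) → + r ≤ cnt p nb → Σ (NClique G n) λ C → ∀ {y} → y ∈ members C → y ∈ nb × T (p y)
      clique-in p r≤ = result (ramsey-theorem n 10 (filter (T? ∘ p) nb) (AllPairs.filter⁺ (T? ∘ p) nb-unique)
          (ℤ.drop‿+≤+ (subst (+ r ≤_) (sym (length-filter p nb)) r≤)))
        where
        result : ∃[ M ] (∀ {y} → y ∈ M → y ∈ filter (T? ∘ p) nb) × Homogeneous n 10 M →
                 Σ (NClique G n) λ C → ∀ {y} → y ∈ members C → y ∈ nb × T (p y)
        result (M , sub , inj₁ (cl , len)) = nclique M cl len , λ y∈ → ∈-filter⁻ (T? ∘ p) {xs = nb} (sub y∈)
        result (M , sub , inj₂ (coclique , len)) = contradiction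
          (no-coclique G nonneg x M coclique (λ y∈ → nb-adj (proj₁ (∈-filter⁻ (T? ∘ p) {xs = nb} (sub y∈)))) len) λ ()

      near-x : ∀ C → (∀ {y} → y ∈ members C → y ∈ nb) → T (near G n x C)
      near-x C sub = far-few⇒near G n {x} {C} (subst (_≤ + 12)
        (sym (cnt-none (far G x) (members C) λ y∈ f → T-not f (adj-close G (nb-adj (sub y∈))))) (+≤+ ℕ.z≤n))

      module Few (few : cnt (near G n x) (fats G n) ≤ 1ℤ) (C₀ : NClique G n) (C₀⊆ : ∀ {y} → y ∈ members C₀ → y ∈ nb) where
        inside : V → Bool
        inside y = near G n y C₀

        -- A clique among the neighbours of x is near to x, so its class is a fat neighbour of x,
        -- and there is only one. Its near vertices are therefore those of `C₀`.
        same : ∀ C → (∀ {y} → y ∈ members C → y ∈ nb) → ∀ y → near G n y C ≡ inside y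
        same C C⊆ y =
          let F₀ , F₀∈ , eq₀ = fats-cover G n C₀
              F , F∈ , eq = fats-cover G n C
          in trans (eq y) (trans (equal F₀ F F₀∈ F∈ (subst T (eq₀ x) (near-x C₀ C₀⊆)) (subst T (eq x) (near-x C C⊆))
               (_≟ᵛ_ G n (vicinity G n F) (vicinity G n F₀))) (sym (eq₀ y)))
          where
          equal : ∀ F₀ F → F₀ ∈ fats G n → F ∈ fats G n → T (near G n x F₀) → T (near G n x F) →
            Dec (vicinity G n F ≡ vicinity G n F₀) → near G n y F ≡ near G n y F₀
          equal F₀ F F₀∈ F∈ t₀ t (yes eq) = trans (sym (lookup-vicinity G n y F))
            (trans (cong (λ v → Data.Vec.lookup v y) eq) (lookup-vicinity G n y F₀))
            where import Data.Vec
          equal F₀ F F₀∈ F∈ t₀ t (no neq) = contradiction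
            (ℤ.≤-trans (cnt-two (near G n x) F∈ F₀∈ (neq ∘ cong (vicinity G n)) t t₀) few) λ { (+≤+ (ℕ.s≤s ())) }

        -- Otherwise the outside neighbours contain an n-clique. Its members are near to it, hence
        -- inside by `same`.
        few-outside : cnt (not ∘ inside) nb ≤ + r
        few-outside = ℤ.<⇒≤ (ℤ.≰⇒> λ r≤ →
          let C , C⊆ = clique-in (not ∘ inside) r≤
              y , y∈ = some-member n-large C
          in T-not (proj₂ (C⊆ y∈)) (subst T (same C (proj₁ ∘ C⊆) y) (member-near G n {y} {C} y∈)))

        -- Otherwise `y` would be far from all members of some n-clique, although by `same` it is
        -- near to that clique and far from at most 12.
        few-far : ∀ y → T (inside y) → cnt (far G y) nb ≤ + r
        few-far y y-inside = ℤ.<⇒≤ (ℤ.≰⇒> λ r≤ →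
          let C , C⊆ = clique-in (far G y) r≤
              far≤12 = near-far G n {y} {C} (subst T (sym (same C (proj₁ ∘ C⊆) y)) y-inside)
              far≡n = trans (cnt-all (far G y) (members C) λ z∈ → proj₂ (C⊆ z∈)) (cong +_ (size C))
          in contradiction (ℤ.<-≤-trans n-large (subst (_≤ + 12) far≡n far≤12)) λ { (+<+ lt) → ℕ.<⇒≱ lt (ℕ.m≤m+n 12 15588) })

        far-bound : ∀ y b → inside y ≡ b → cnt (far G y) nb ≤ + r + d * 𝟙 (not b)
        far-bound y true  eq = ℤ.≤-trans (few-far y (subst T (sym eq) _))
          (ℤ.≤-reflexive (sym (trans (cong (λ t → + r + t) (ℤ.*-zeroʳ d)) (ℤ.+-identityʳ (+ r)))))
        far-bound y false eq = ℤ.≤-trans (cnt-≤-length (far G y) nb)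
          (≤-by {d = + r} (+≤+ ℕ.z≤n) (solve 2 (λ d r → r := r :+ d :* con 1ℤ :- d) refl d (+ r)))

        adj+far : ∀ y → d ≤ cnt (adj y) nb + 1ℤ + cnt (far G y) nb
        adj+far y = subst (_≤ cnt (adj y) nb + 1ℤ + cnt (far G y) nb) (cnt-not (close G y) nb)
          (ℤ.+-monoˡ-≤ (cnt (far G y) nb) (ℤ.≤-trans (∑-mono nb λ {z} _ → 𝟙-∨ (adj y z) (does (y ≟ z)))
            (subst (_≤ cnt (adj y) nb + 1ℤ) (sym (∑-+ (𝟙 ∘ adj y) (δ _≟_ y) nb)) (ℤ.+-monoʳ-≤ (cnt (adj y) nb) (cnt-δ≤1 G n y nb-unique)))))
          where
          𝟙-∨ : ∀ a b → 𝟙 (a ∨ b) ≤ 𝟙 a + 𝟙 b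
          𝟙-∨ true  true  = +≤+ (ℕ.s≤s ℕ.z≤n)
          𝟙-∨ true  false = ℤ.≤-refl
          𝟙-∨ false b     = ℤ.≤-reflexive (sym (ℤ.+-identityˡ (𝟙 b)))

        -- Counts ordered pairs of neighbours of x. The term d (1 + r) pays for the pairs (y, y) and
        -- for the at most r far partners of each inside y; the term d r pays for all pairs starting
        -- at one of the at most r outside vertices.
        local-edges : d * d ≤ ∑ (λ y → cnt (adj y) nb) nb + d * (1ℤ + + r) + d * + r
        local-edges = begin
          d * d
            ≡⟨ ∑-const d nb ⟨
          ∑ (λ _ → d) nb
            ≤⟨ ∑-mono nb (λ {y} _ → ℤ.≤-trans (adj+far y) (ℤ.+-monoʳ-≤ (cnt (adj y) nb + 1ℤ) (far-bound y (inside y) refl))) ⟩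
          ∑ (λ y → cnt (adj y) nb + 1ℤ + (+ r + d * 𝟙 (not (inside y)))) nb
            ≡⟨ trans (∑-cong nb λ y → solve 4 (λ a r d i → a :+ con 1ℤ :+ (r :+ d :* i) := a :+ (con 1ℤ :+ r) :+ d :* i) refl
                  (cnt (adj y) nb) (+ r) d (𝟙 (not (inside y))))
                (trans (∑-+ (λ y → cnt (adj y) nb + (1ℤ + + r)) (λ y → d * 𝟙 (not (inside y))) nb)
                  (cong₂ _+_ (trans (∑-+ (λ y → cnt (adj y) nb) (λ _ → 1ℤ + + r) nb) (cong (λ t → ∑ (λ y → cnt (adj y) nb) nb + t) (∑-const (1ℤ + + r) nb)))
                    (∑-* d (λ y → 𝟙 (not (inside y))) nb))) ⟩
          ∑ (λ y → cnt (adj y) nb) nb + d * (1ℤ + + r) + d * cnt (not ∘ inside) nb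
            ≤⟨ ℤ.+-monoʳ-≤ (∑ (λ y → cnt (adj y) nb) nb + d * (1ℤ + + r)) (ℤ.*-monoˡ-≤-nonNeg d few-outside) ⟩
          _ ∎
          where open ℤ.≤-Reasoning

      -- With a single fat neighbour, `local-edges` allows at most (2r + 1) d missing pairs, while
      -- sparseness demands (2r + 2) d of them, and d is positive.
      two-fats : + r + + r + + 2 < d →
        ∑ (λ y → cnt (adj y) nb) nb + (+ r + + r + + 2) * d ≤ d * d → + 2 ≤ cnt (near G n x) (fats G n)
      two-fats κ<d sparse = ℤ.≮⇒≥ λ few →
        -- The predicate `adj x` holds on the whole neighbourhood, so this merely finds one n-clique
        -- in it.
        let C₀ , C₀⊆ = clique-in (adj x) (ℤ.≤-trans (≤-by {d = (d - (+ r + + r + + 2)) + (+ r + + 2)}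
                         (0≤+ (gap (ℤ.<⇒≤ κ<d)) (+≤+ ℕ.z≤n))
                         (solve 2 (λ d r → (d :- (r :+ r :+ con (+ 2))) :+ (r :+ con (+ 2)) := d :- r) refl d (+ r)))
                       (ℤ.≤-reflexive (sym (cnt-all (adj x) nb nb-adj))))
            open Few (ℤ.i<j⇒i≤pred[j] {_} {+ 2} few) C₀ (λ y∈ → proj₁ (C₀⊆ y∈))
        in contradiction (subst (0ℤ ≤_)
             (solve 3 (λ d r a → (d :* d :- (a :+ (r :+ r :+ con (+ 2)) :* d)) :+ (a :+ d :* (con 1ℤ :+ r) :+ d :* r :- d :* d)
                  :+ (d :- (con 1ℤ :+ (r :+ r :+ con (+ 2)))) :+ (r :+ r :+ con (+ 2)) := con -1ℤ) refl
                d (+ r) (∑ (λ y → cnt (adj y) nb) nb))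
             (0≤+ (0≤+ (0≤+ (gap sparse) (gap local-edges)) (gap (ℤ.i<j⇒suc[i]≤j κ<d))) (+≤+ ℕ.z≤n)))
           λ ()

-- Embeddings of Hoffman graphs and special matrices of generated subgraphs

module Hoffman where
  open Sums hiding (Unique)
  open GraphForm using (allFin-unique)
  open import Data.Fin using (_≟_)
  open import Data.Fin.Subset using (Subset; _∈_; ∣_∣)
  open import Data.Fin.Subset.Properties using (_∈?_; x∈p∪q⁺; x∈p∪q⁻)
  open import Data.Integer using (ℤ; +_; 0ℤ; 1ℤ; _+_; _*_; -_; _-_)
  open import Data.Integer.Properties as ℤ hiding (_≟_)
  open import Data.List.Membership.Propositional renaming (_∈_ to _∈ₗ_) using ()
  open import Data.List.Membership.Propositional.Properties using (∈-lookup)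
  open import Data.Vec using (tabulate; []; _∷_)
  open import Function using (_↔_; Inverse; mk↔ₛ′)
  open import Relation.Nullary.Decidable using (dec-true; dec-false)
  open import Relation.Unary using (Decidable)

  lookup-distinct : ∀ {A B : Set} (q : A → B) {L} → AllPairs (λ x y → q x ≢ q y) L →
    ∀ i j → q (lookup L i) ≡ q (lookup L j) → i ≡ j
  lookup-distinct q (x≢ ∷ rel) zero    zero    eq = refl
  lookup-distinct q {x ∷ L} (x≢ ∷ rel) zero    (suc j) eq = contradiction eq (All.lookup x≢ (∈-lookup j))
  lookup-distinct q {x ∷ L} (x≢ ∷ rel) (suc i) zero    eq = contradiction (sym eq) (All.lookup x≢ (∈-lookup i))
  lookup-distinct q (x≢ ∷ rel) (suc i) (suc j) eq = cong suc (lookup-distinct q rel i j eq)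

  at-injective : ∀ {n} (W : Subset n) i j → at W i ≡ at W j → i ≡ j
  at-injective {n} W = lookup-distinct id (AllPairs.filter⁺ (_∈? W) (allFin-unique n))

  ∑-filter? : ∀ {A : Set} {P : A → Set} (P? : Decidable P) (f : A → ℤ) L →
    ∑ f (filter P? L) ≡ ∑ (λ x → 𝟙 (does (P? x)) * f x) L
  ∑-filter? P? f []      = refl
  ∑-filter? P? f (x ∷ L) with P? x
  ... | yes _ = cong₂ _+_ (sym (ℤ.*-identityˡ (f x))) (∑-filter? P? f L)
  ... | no _  = trans (∑-filter? P? f L) (sym (trans (cong (λ t → t + ∑ (λ x → 𝟙 (does (P? x)) * f x) L) (ℤ.*-zeroˡ (f x))) (ℤ.+-identityˡ _)))

  ∑-ℤ : ∀ {n} (f : Fin n → ℤ) → ∑ℤ f ≡ ∑ f (allFin n)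
  ∑-ℤ {zero}  f = refl
  ∑-ℤ {suc n} f = cong (λ t → f zero + t) (trans (∑-ℤ (f ∘ suc)) (sym (∑-tabulate f suc)))

  ∑-Index : ∀ {n} (W : Subset n) (f : Fin n → ℤ) → ∑ (f ∘ at W) (allFin _) ≡ ∑ (λ x → 𝟙 (does (x ∈? W)) * f x) (allFin n)
  ∑-Index {n} W f = trans (sym (∑-lookup f (elements W))) (∑-filter? (_∈? W) f (allFin n))

  does-∈ : ∀ {n} {P : Fin n → Set} (P? : Decidable P) x → does (x ∈? ⟪ P? ⟫) ≡ does (P? x)
  does-∈ P? x = decide (P? x)
    where
    decide : ∀ d → does (x ∈? ⟪ P? ⟫) ≡ does d
    decide (yes p) = dec-true (x ∈? ⟪ P? ⟫) (∈⟪⟫⁺ P? p)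
    decide (no ¬p) = dec-false (x ∈? ⟪ P? ⟫) (λ x∈ → ¬p (∈⟪⟫⁻ P? x∈))

  ∣tabulate∣ : ∀ {n} (b : Fin n → Bool) → + ∣ tabulate b ∣ ≡ cnt b (allFin n)
  ∣tabulate∣ {zero}  b = refl
  ∣tabulate∣ {suc n} b with b zero
  ... | true  = cong (λ t → 1ℤ + t) (trans (∣tabulate∣ (b ∘ suc)) (sym (∑-tabulate (𝟙 ∘ b) suc)))
  ... | false = trans (trans (∣tabulate∣ (b ∘ suc)) (sym (∑-tabulate (𝟙 ∘ b) suc))) (sym (ℤ.+-identityˡ _))

  enumeration : ∀ {m n} (φ : Fin m → Fin n) → (∀ {i j} → φ i ≡ φ j → i ≡ j) → (W : Subset n) →
    (∀ i → φ i ∈ W) → (∀ {x} → x ∈ W → ∃[ i ] φ i ≡ x) → Σ (Fin m ↔ Index W) λ f → ∀ i → at W (Inverse.to f i) ≡ φ i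
  enumeration {m} φ injective W φ∈ onto = mk↔ₛ′ to from to-from from-to , λ i → sym (proj₂ (at-surjective W (φ∈ i)))
    where
    to : Fin m → Index W
    to i = proj₁ (at-surjective W (φ∈ i))
    from : Index W → Fin m
    from j = proj₁ (onto (at-∈ W j))
    to-from : ∀ j → to (from j) ≡ j
    to-from j = at-injective W _ _ (trans (sym (proj₂ (at-surjective W (φ∈ (from j))))) (proj₂ (onto (at-∈ W j))))
    from-to : ∀ i → from (to i) ≡ i
    from-to i = injective (trans (proj₂ (onto (at-∈ W (to i)))) (sym (proj₂ (at-surjective W (φ∈ i)))))

  induced-≅ : ∀ (G H : Graph) (φ : Graph.V G → Graph.V H) → (∀ {i j} → φ i ≡ φ j → i ≡ j) →
    (∀ x y → Graph.adj G x y ≡ Graph.adj H (φ x) (φ y)) → (W : Subset (Graph.order H)) →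
    (∀ i → φ i ∈ W) → (∀ {x} → x ∈ W → ∃[ i ] φ i ≡ x) →
    Σ (G ≅ induced H W) λ f → ∀ i → at W (Inverse.to (_≅_.bijection f) i) ≡ φ i
  induced-≅ G H φ injective preserves W φ∈ onto =
    let f , at-f = enumeration φ injective W φ∈ onto
    in record { bijection = f
              ; preserves = λ x y → trans (preserves x y) (sym (cong₂ (Graph.adj H) (at-f x) (at-f y))) } , at-f

  module Embedding (𝔤 𝔥 : HoffmanGraph) (φ : HoffmanGraph.V 𝔤 → HoffmanGraph.V 𝔥)
    (injective : ∀ {i j} → φ i ≡ φ j → i ≡ j)
    (preserves : ∀ x y → HoffmanGraph.adj 𝔤 x y ≡ HoffmanGraph.adj 𝔥 (φ x) (φ y))
    (labels : ∀ x → HoffmanGraph.label 𝔤 x ≡ HoffmanGraph.label 𝔥 (φ x)) where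
    private
      module 𝔤 = HoffmanGraph 𝔤
      module 𝔥 = HoffmanGraph 𝔥

    inImage? : Decidable (λ w → ∃[ i ] φ i ≡ w)
    inImage? w = Fin.any? λ i → φ i ≟ w

    image : Subset 𝔥.order
    image = ⟪ inImage? ⟫

    φ∈image : ∀ i → φ i ∈ image
    φ∈image i = ∈⟪⟫⁺ inImage? (i , refl)

    image-inducing : Inducing 𝔥 image
    image-inducing x x∈ x-fat =
      let i , φi≡x = ∈⟪⟫⁻ inImage? x∈
          j , j-slim , i~j = 𝔤.fat-slim i (trans (labels i) (trans (cong 𝔥.label φi≡x) x-fat))
      in φ j , φ∈image j , trans (sym (labels j)) j-slim ,
         subst (λ x → 𝔥.Adj x (φ j)) φi≡x (subst T (preserves i j) i~j)

    isomorphic : 𝔤 ≅ᴴ inducedHoffman 𝔥 image image-inducing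
    isomorphic =
      let f , at-f = induced-≅ 𝔤.graph 𝔥.graph φ injective preserves image φ∈image (∈⟪⟫⁻ inImage?)
      in record { isomorphism = f ; preservesLabel = λ x → trans (labels x) (cong 𝔥.label (sym (at-f x))) }

    embeds : 𝔤 ≲ 𝔥
    embeds = image , image-inducing , isomorphic

  module _ (𝔥 : HoffmanGraph) where
    open HoffmanGraph 𝔥

    isFat : V → Bool
    isFat v = does (label v ≟ˡ fat)

    special-sum : ∀ x y → specialMatrix x y ≡ A-slim x y -
      ∑ (λ v → 𝟙 (isFat v) * (adjacencyMatrix (proj₁ x) v * adjacencyMatrix (proj₁ y) v)) (allFin order)
    special-sum (x , _) (y , _) = cong (λ t → adjacencyMatrix x y - t)
      (trans (∑-ℤ (λ F → adjacencyMatrix x (at fatVertices F) * adjacencyMatrix y (at fatVertices F)))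
        (trans (∑-Index fatVertices (λ v → adjacencyMatrix x v * adjacencyMatrix y v))
          (∑-cong (allFin order) λ v → cong (λ b → 𝟙 b * (adjacencyMatrix x v * adjacencyMatrix y v))
            (does-∈ (λ v → label v ≟ˡ fat) v))))

  module _ (𝔥 : HoffmanGraph) (W : Subset (HoffmanGraph.order 𝔥)) (W-slim : ∀ x → x ∈ W → HoffmanGraph.label 𝔥 x ≡ slim) where
    open HoffmanGraph 𝔥
    private
      S = generatedSet 𝔥 W
      component = generated 𝔥 W W-slim
      module 𝔠 = HoffmanGraph component

    generated-slim : ∀ {x} → x ∈ S → label x ≡ slim → x ∈ W
    generated-slim {x} x∈ x-slim with x∈p∪q⁻ W ⟪ fatNeighboursOf? 𝔥 W ⟫ x∈
    ... | inj₁ x∈W = x∈W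
    ... | inj₂ x∈N = contradiction (trans (sym x-slim) (proj₁ (∈⟪⟫⁻ (fatNeighboursOf? 𝔥 W) x∈N))) λ ()

    generated-fat : ∀ {k} → k ∈ S → label k ≡ fat → ∃[ x ] x ∈ W × Adj k x
    generated-fat {k} k∈ k-fat with x∈p∪q⁻ W ⟪ fatNeighboursOf? 𝔥 W ⟫ k∈
    ... | inj₁ k∈W = contradiction (trans (sym k-fat) (W-slim k k∈W)) λ ()
    ... | inj₂ k∈N = proj₂ (∈⟪⟫⁻ (fatNeighboursOf? 𝔥 W) k∈N)

    -- A fat vertex outside the generated subgraph is adjacent to no vertex of `W`, so leaving it
    -- out removes only zero terms. The diagonal blocks therefore agree for any partition; only the
    -- off-diagonal ones impose a condition.
    special-generated : ∀ (x y : 𝔠.Slim) →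
      specialMatrix (at S (proj₁ x) , proj₂ x) (at S (proj₁ y) , proj₂ y) ≡ 𝔠.specialMatrix x y
    special-generated (x , x-slim) (y , y-slim) = trans (special-sum 𝔥 (X , x-slim) (Y , y-slim))
      (trans (cong (λ t → adjacencyMatrix X Y - t) (trans (∑-cong (allFin order) λ v → sym (inside v (v ∈? S) (label v ≟ˡ fat)))
          (sym (∑-Index S (λ v → 𝟙 (isFat 𝔥 v) * (adjacencyMatrix X v * adjacencyMatrix Y v))))))
        (sym (special-sum component (x , x-slim) (y , y-slim))))
      where
      X = at S x
      Y = at S y
      X∈W : X ∈ W
      X∈W = generated-slim (at-∈ S x) x-slim
      inside : ∀ v (d : Dec (v ∈ S)) (f : Dec (label v ≡ fat)) →
        𝟙 (does d) * (𝟙 (does f) * (adjacencyMatrix X v * adjacencyMatrix Y v)) ≡ 𝟙 (does f) * (adjacencyMatrix X v * adjacencyMatrix Y v)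
      inside v (yes _) f       = ℤ.*-identityˡ (𝟙 (does f) * (adjacencyMatrix X v * adjacencyMatrix Y v))
      inside v (no _)  (no _)  = trans (ℤ.*-zeroˡ (0ℤ * (adjacencyMatrix X v * adjacencyMatrix Y v))) (sym (ℤ.*-zeroˡ (adjacencyMatrix X v * adjacencyMatrix Y v)))
      inside v (no v∉) (yes v-fat) = trans (ℤ.*-zeroˡ (1ℤ * (adjacencyMatrix X v * adjacencyMatrix Y v))) (sym (trans (ℤ.*-identityˡ (adjacencyMatrix X v * adjacencyMatrix Y v))
        (trans (cong (λ b → (if b then 1ℤ else 0ℤ) * adjacencyMatrix Y v) (¬T⇒≡ not-adjacent)) (ℤ.*-zeroˡ (adjacencyMatrix Y v)))))
        where
        not-adjacent : ¬ Adj X v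
        not-adjacent X~v = v∉ (x∈p∪q⁺ (inj₂ (∈⟪⟫⁺ (fatNeighboursOf? 𝔥 W)
          (v-fat , X , X∈W , subst T (symmetric X v) X~v))))

-- The Hoffman graph of an incidence relation and its decomposition

module Assemble where
  open Sums
  open GraphForm using (B; B-sym)
  open Repr
  open Hoffman
  open import Data.Fin using (splitAt; _↑ˡ_; _↑ʳ_; _≟_)
  open import Data.Fin.Subset using (Subset; _∈_; ∣_∣; _∩_)
  open import Data.Integer using (ℤ; +_; 0ℤ; 1ℤ; -1ℤ; _+_; _*_; -_; _-_; _≤_)
  open import Data.Integer.Properties as ℤ hiding (_≟_)
  open import Data.List.Membership.Propositional.Properties using (∈-allFin)
  open import Data.List.Membership.Propositional renaming (_∈_ to _∈ₗ_) using ()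
  open import Data.List.Relation.Unary.Any using (index)
  open import Data.List.Relation.Unary.Any.Properties using (lookup-index)
  open import Data.Vec as Vec using (Vec; tabulate)
  import Data.Vec.Properties as Vec
  open import Relation.Binary using (DecidableEquality)

  ∑-splitAt : ∀ m n (f : Fin (m ℕ.+ n) → ℤ) →
    ∑ f (allFin (m ℕ.+ n)) ≡ ∑ (λ i → f (i ↑ˡ n)) (allFin m) + ∑ (λ j → f (m ↑ʳ j)) (allFin n)
  ∑-splitAt zero    n f = sym (ℤ.+-identityˡ _)
  ∑-splitAt (suc m) n f = trans (cong (λ t → f zero + t) (trans (∑-tabulate f suc) (∑-splitAt m n (f ∘ suc))))
    (trans (sym (ℤ.+-assoc (f zero) _ _))
      (cong (λ t → f zero + t + ∑ (λ j → f (suc (m ↑ʳ j))) (allFin n)) (sym (∑-tabulate (λ i → f (i ↑ˡ n)) suc))))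

  ∩-tabulate : ∀ {n} (a b : Fin n → Bool) → tabulate a ∩ tabulate b ≡ tabulate (λ i → a i ∧ b i)
  ∩-tabulate {zero}  a b = refl
  ∩-tabulate {suc n} a b = cong (a zero ∧ b zero Vec.∷_) (∩-tabulate (a ∘ suc) (b ∘ suc))

  T-ext : ∀ {a b} → (T a → T b) → (T b → T a) → a ≡ b
  T-ext {true}  {true}  f g = refl
  T-ext {true}  {false} f g = contradiction (f _) λ ()
  T-ext {false} {true}  f g = contradiction (g _) λ ()
  T-ext {false} {false} f g = refl

  module _ (G : Graph) (K : ℕ) (inc : Graph.V G → Fin K → Bool) where
    open Graph G

    common : V → V → ℤ
    common x y = cnt (λ k → inc x k ∧ inc y k) (allFin K)

    special : V → V → ℤ
    special x y = B G x y - common x y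

    special-sym : ∀ x y → special x y ≡ special y x
    special-sym x y = cong₂ _-_ (B-sym G x y) (∑-cong (allFin K) λ k → cong 𝟙 (Bool.∧-comm (inc x k) (inc y k)))

    -- What one would read off if `special` were the Gram matrix of integral vectors of length 0 or
    -- 1: an entry 1 makes two rows equal, an entry -1 makes them opposite. The field `partner` is
    -- the exception; it is secured by the additional fat vertices.
    record Reduced : Set where
      field
        attached   : ∀ k → ∃[ x ] T (inc x k)
        fatness    : ∀ x → common x x ≡ + 2 ⊎ common x x ≡ + 3
        isolated   : ∀ x → common x x ≡ + 3 → ∀ y → x ≢ y → special x y ≡ 0ℤ
        partner    : ∀ x → common x x ≡ + 2 → ∃[ y ] special x y ≡ -1ℤ
        sign       : ∀ x y → special x y ≡ 0ℤ ⊎ special x y ≡ 1ℤ ⊎ special x y ≡ -1ℤ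
        transport⁺ : ∀ x y → special x y ≡ 1ℤ → ∀ z → special x z ≡ special y z
        transport⁻ : ∀ x y → special x y ≡ -1ℤ → ∀ z → special x z ≡ - special y z

    adj⊎ : V ⊎ Fin K → V ⊎ Fin K → Bool
    adj⊎ (inj₁ x) (inj₁ y) = adj x y
    adj⊎ (inj₁ x) (inj₂ k) = inc x k
    adj⊎ (inj₂ k) (inj₁ x) = inc x k
    adj⊎ (inj₂ _) (inj₂ _) = false

    label⊎ : V ⊎ Fin K → Label
    label⊎ (inj₁ _) = slim
    label⊎ (inj₂ _) = fat

    adj⊎-sym : ∀ u v → adj⊎ u v ≡ adj⊎ v u
    adj⊎-sym (inj₁ x) (inj₁ y) = symmetric x y
    adj⊎-sym (inj₁ x) (inj₂ k) = refl
    adj⊎-sym (inj₂ k) (inj₁ x) = refl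
    adj⊎-sym (inj₂ k) (inj₂ l) = refl

    adj⊎-irrefl : ∀ u → adj⊎ u u ≡ false
    adj⊎-irrefl (inj₁ x) = irreflexive x
    adj⊎-irrefl (inj₂ k) = refl

    adj⊎-fat : ∀ u v → label⊎ u ≡ fat → label⊎ v ≡ fat → ¬ T (adj⊎ u v)
    adj⊎-fat (inj₂ _) (inj₂ _) _ _ ()

    split : Fin (order ℕ.+ K) → V ⊎ Fin K
    split = splitAt order

    split-slim : ∀ x → split (x ↑ˡ K) ≡ inj₁ x
    split-slim x = Fin.splitAt-↑ˡ order x K

    split-fat : ∀ k → split (order ↑ʳ k) ≡ inj₂ k
    split-fat k = Fin.splitAt-↑ʳ order K k

    data View : Fin (order ℕ.+ K) → Set where
      slim-vertex : ∀ x → View (x ↑ˡ K)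
      fat-vertex  : ∀ k → View (order ↑ʳ k)

    view : ∀ u → View u
    view u = subst View (Fin.join-splitAt order K u) (cases (split u))
      where
      cases : ∀ s → View (Data.Fin.join order K s)
      cases (inj₁ x) = slim-vertex x
      cases (inj₂ k) = fat-vertex k

    module _ (attached : ∀ k → ∃[ x ] T (inc x k)) where
      hoffman : HoffmanGraph
      hoffman = record
        { graph = record
          { order       = order ℕ.+ K
          ; adj         = λ u v → adj⊎ (split u) (split v)
          ; symmetric   = λ u v → adj⊎-sym (split u) (split v)
          ; irreflexive = λ u → adj⊎-irrefl (split u)
          }
        ; label    = label⊎ ∘ split
        ; fat-fat  = λ u v → adj⊎-fat (split u) (split v)
        ; fat-slim = λ u → slim-neighbour (split u)
        }
        where
        slim-neighbour : ∀ s → label⊎ s ≡ fat → ∃[ v ] label⊎ (split v) ≡ slim × T (adj⊎ s (split v))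
        slim-neighbour (inj₂ k) _ = let x , x~k = attached k in
          x ↑ˡ K , cong label⊎ (split-slim x) , subst (λ t → T (adj⊎ (inj₂ k) t)) (sym (split-slim x)) x~k

      private
        module 𝔥 = HoffmanGraph hoffman

      adj-slim : ∀ x y → 𝔥.adj (x ↑ˡ K) (y ↑ˡ K) ≡ adj x y
      adj-slim x y = cong₂ adj⊎ (split-slim x) (split-slim y)

      adj-slim-fat : ∀ x k → 𝔥.adj (x ↑ˡ K) (order ↑ʳ k) ≡ inc x k
      adj-slim-fat x k = cong₂ adj⊎ (split-slim x) (split-fat k)

      adj-fat-slim : ∀ k x → 𝔥.adj (order ↑ʳ k) (x ↑ˡ K) ≡ inc x k
      adj-fat-slim k x = cong₂ adj⊎ (split-fat k) (split-slim x)

      adj-fat : ∀ k l → 𝔥.adj (order ↑ʳ k) (order ↑ʳ l) ≡ false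
      adj-fat k l = cong₂ adj⊎ (split-fat k) (split-fat l)

      label-slim : ∀ x → 𝔥.label (x ↑ˡ K) ≡ slim
      label-slim x = cong label⊎ (split-slim x)

      label-fat : ∀ k → 𝔥.label (order ↑ʳ k) ≡ fat
      label-fat k = cong label⊎ (split-fat k)

      two-fat : (∀ x → + 2 ≤ cnt (inc x) (allFin K)) → IsFat hoffman 2
      two-fat many u = fat-neighbours (view u)
        where
        fat-neighbours : ∀ {u} → View u → 𝔥.label u ≡ slim → 2 ℕ.≤ ∣ 𝔥.neighbours u ∩ 𝔥.fatVertices ∣
        fat-neighbours (fat-vertex k) k-slim = contradiction (trans (sym k-slim) (label-fat k)) λ ()
        fat-neighbours (slim-vertex x) _ = ℤ.drop‿+≤+ (subst (+ 2 ≤_) (sym eq) (many x))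
          where
          eq : + ∣ 𝔥.neighbours (x ↑ˡ K) ∩ 𝔥.fatVertices ∣ ≡ cnt (inc x) (allFin K)
          eq = trans (cong (λ W → + ∣ W ∣) (∩-tabulate (𝔥.adj (x ↑ˡ K)) (isFat hoffman)))
            (trans (∣tabulate∣ (λ v → 𝔥.adj (x ↑ˡ K) v ∧ isFat hoffman v))
              (trans (∑-splitAt order K (λ v → 𝟙 (𝔥.adj (x ↑ˡ K) v ∧ isFat hoffman v)))
                (trans (cong₂ _+_
                  (trans (∑-cong (allFin order) λ y → cong 𝟙 (trans (cong (λ l → 𝔥.adj (x ↑ˡ K) (y ↑ˡ K) ∧ does (l ≟ˡ fat)) (label-slim y)) (Bool.∧-zeroʳ _)))
                    (∑-zero (allFin order)))
                  (∑-cong (allFin K) λ k → cong 𝟙 (trans (cong₂ (λ a l → a ∧ does (l ≟ˡ fat)) (adj-slim-fat x k) (label-fat k)) (Bool.∧-identityʳ (inc x k)))))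
                  (ℤ.+-identityˡ _))))

      ↑ˡ-injective : ∀ {x y : V} → x ↑ˡ K ≡ y ↑ˡ K → x ≡ y
      ↑ˡ-injective {x} {y} = Fin.↑ˡ-injective K x y

      slim-graph : G ≅ slimGraph hoffman
      slim-graph = proj₁ (induced-≅ G 𝔥.graph (_↑ˡ K) ↑ˡ-injective (λ x y → sym (adj-slim x y)) 𝔥.slimVertices
        (λ x → ∈⟪⟫⁺ (λ v → 𝔥.label v ≟ˡ slim) (label-slim x)) (λ {u} u∈ → onto (view u) (∈⟪⟫⁻ (λ v → 𝔥.label v ≟ˡ slim) u∈)))
        where
        onto : ∀ {u} → View u → 𝔥.label u ≡ slim → ∃[ x ] x ↑ˡ K ≡ u
        onto (slim-vertex x) _      = x , refl
        onto (fat-vertex k)  k-slim = contradiction (trans (sym k-slim) (label-fat k)) λ ()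

      special-value : ∀ x y p q → 𝔥.specialMatrix (x ↑ˡ K , p) (y ↑ˡ K , q) ≡ adjacencyMatrix x y - common x y
      special-value x y p q = trans (special-sum hoffman (x ↑ˡ K , p) (y ↑ˡ K , q))
        (cong₂ _-_ (cong (λ b → if b then 1ℤ else 0ℤ) (adj-slim x y))
          (trans (∑-splitAt order K (λ v → 𝟙 (isFat hoffman v) * (𝔥.adjacencyMatrix (x ↑ˡ K) v * 𝔥.adjacencyMatrix (y ↑ˡ K) v)))
            (trans (cong₂ _+_
              (trans (∑-cong (allFin order) λ z → trans (cong (λ l → 𝟙 (does (l ≟ˡ fat)) * (𝔥.adjacencyMatrix (x ↑ˡ K) (z ↑ˡ K) * 𝔥.adjacencyMatrix (y ↑ˡ K) (z ↑ˡ K))) (label-slim z)) (ℤ.*-zeroˡ (𝔥.adjacencyMatrix (x ↑ˡ K) (z ↑ˡ K) * 𝔥.adjacencyMatrix (y ↑ˡ K) (z ↑ˡ K))))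
                (∑-zero (allFin order)))
              (∑-cong (allFin K) fat-term))
              (ℤ.+-identityˡ _))))
        where
        product : ∀ a b → 1ℤ * ((if a then 1ℤ else 0ℤ) * (if b then 1ℤ else 0ℤ)) ≡ 𝟙 (a ∧ b)
        product true  true  = refl
        product true  false = refl
        product false true  = refl
        product false false = refl
        fat-term : ∀ k → 𝟙 (isFat hoffman (order ↑ʳ k)) * (𝔥.adjacencyMatrix (x ↑ˡ K) (order ↑ʳ k) * 𝔥.adjacencyMatrix (y ↑ˡ K) (order ↑ʳ k))
                   ≡ 𝟙 (inc x k ∧ inc y k)
        fat-term k = trans (cong₂ (λ l (a , b) → 𝟙 (does (l ≟ˡ fat)) * ((if a then 1ℤ else 0ℤ) * (if b then 1ℤ else 0ℤ)))
          (label-fat k) (cong₂ _,_ (adj-slim-fat x k) (adj-slim-fat y k))) (product (inc x k) (inc y k))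

    δ-off : ∀ {x y} → x ≢ y → special x y ≡ adjacencyMatrix x y - common x y
    δ-off {x} {y} x≢y = cong (_- common x y) (trans (cong (λ d → adjacencyMatrix x y + + 3 * d) (δ-≢ _≟_ x≢y)) (ℤ.+-identityʳ (adjacencyMatrix x y)))

    -- Equality is included for reflexivity, since the diagonal entry of a vertex with three fat
    -- neighbours is zero.
    Linked : V → V → Set
    Linked x y = x ≡ y ⊎ special x y ≢ 0ℤ

    linked? : V → V → Bool
    linked? x y = does (x ≟ y) ∨ not (does (special x y ℤ.≟ 0ℤ))

    linked⁺ : ∀ {x y} → Linked x y → T (linked? x y)
    linked⁺ {x} {y} l with x ≟ y | special x y ℤ.≟ 0ℤ
    linked⁺ l        | yes _  | _      = _
    linked⁺ l        | no _   | no _   = _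
    linked⁺ (inj₁ e) | no x≢y | yes _  = contradiction e x≢y
    linked⁺ (inj₂ n) | no _   | yes z  = n z

    linked⁻ : ∀ {x y} → T (linked? x y) → Linked x y
    linked⁻ {x} {y} t with x ≟ y | special x y ℤ.≟ 0ℤ
    ... | yes e | _     = inj₁ e
    ... | no _  | no n  = inj₂ n
    ... | no _  | yes _ = contradiction t λ ()

    _≟ᵛ_ : DecidableEquality (Vec Bool order)
    _≟ᵛ_ = Vec.≡-dec Bool._≟_

    cell : V → Vec Bool order
    cell x = tabulate (linked? x)

    leaders : List V
    leaders = representatives _≟ᵛ_ cell (allFin order)

    inPart : V → V ⊎ Fin K → Bool
    inPart a (inj₁ x) = linked? a x
    inPart a (inj₂ _) = false

    partOf : V → Subset (order ℕ.+ K)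
    partOf a = ⟪ (λ u → T? (inPart a (split u))) ⟫

    partOf⁺ : ∀ {a x} → Linked a x → x ↑ˡ K ∈ partOf a
    partOf⁺ {a} {x} l = ∈⟪⟫⁺ (λ u → T? (inPart a (split u))) (subst (λ s → T (inPart a s)) (sym (split-slim x)) (linked⁺ l))

    partOf⁻ : ∀ {a x} → x ↑ˡ K ∈ partOf a → Linked a x
    partOf⁻ {a} {x} x∈ = linked⁻ (subst (λ s → T (inPart a s)) (split-slim x) (∈⟪⟫⁻ (λ u → T? (inPart a (split u))) x∈))

    partOf-fat : ∀ {a k} → ¬ (order ↑ʳ k ∈ partOf a)
    partOf-fat {a} {k} k∈ = subst (λ s → T (inPart a s)) (split-fat k) (∈⟪⟫⁻ (λ u → T? (inPart a (split u))) k∈)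

    module Decompose (reduced : Reduced) where
      open Reduced reduced

      linked-sym : ∀ {x y} → Linked x y → Linked y x
      linked-sym (inj₁ e) = inj₁ (sym e)
      linked-sym {x} {y} (inj₂ n) = inj₂ (n ∘ trans (special-sym x y))

      -- A nonzero entry at x y makes the rows of x and y equal up to sign, so a nonzero entry at y
      -- z reappears at x z.
      linked-trans : ∀ {x y z} → Linked x y → Linked y z → Linked x z
      linked-trans (inj₁ refl) l = l
      linked-trans (inj₂ n) (inj₁ refl) = inj₂ n
      linked-trans {x} {y} {z} (inj₂ n) (inj₂ m) with sign x y
      ... | inj₁ eq        = contradiction eq n
      ... | inj₂ (inj₁ eq) = inj₂ (m ∘ trans (sym (transport⁺ x y eq z)))
      ... | inj₂ (inj₂ eq) = inj₂ λ xz≡0 → m (trans (sym (ℤ.neg-involutive (special y z))) (cong -_ (trans (sym (transport⁻ x y eq z)) xz≡0)))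

      linked-cell : ∀ {x y} → Linked x y → cell x ≡ cell y
      linked-cell l = Vec.tabulate-cong λ z → T-ext
        (λ t → linked⁺ (linked-trans (linked-sym l) (linked⁻ t)))
        (λ t → linked⁺ (linked-trans l (linked⁻ t)))

      cell-linked : ∀ {x y} → cell x ≡ cell y → Linked x y
      cell-linked {x} {y} eq = linked⁻ (subst T (trans (sym (Vec.lookup∘tabulate (linked? y) y))
        (trans (cong (λ v → Vec.lookup v y) (sym eq)) (Vec.lookup∘tabulate (linked? x) y))) (linked⁺ {y} {y} (inj₁ refl)))

      H : HoffmanGraph
      H = hoffman attached

      private
        module 𝔥 = HoffmanGraph H

      leader : Fin (length leaders) → V
      leader = lookup leaders

      part : Fin (length leaders) → Subset (order ℕ.+ K)
      part i = partOf (leader i)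

      part-slim : ∀ i u → u ∈ part i → 𝔥.label u ≡ slim
      part-slim i u = slim-case (view u)
        where
        slim-case : ∀ {u} → View u → u ∈ part i → 𝔥.label u ≡ slim
        slim-case (slim-vertex x) _  = label-slim attached x
        slim-case (fat-vertex k)  k∈ = contradiction k∈ (partOf-fat {leader i})

      covered : ∀ x → ∃[ i ] Linked (leader i) x
      covered x =
        let y , y∈ , eq = representatives-cover _≟ᵛ_ cell (∈-allFin x)
        in index y∈ , subst (λ y → Linked y x) (lookup-index y∈) (linked-sym (cell-linked eq))

      disjoint-slim : ∀ i j x → Linked (leader i) x → Linked (leader j) x → i ≡ j
      disjoint-slim i j x l l′ = lookup-distinct cell (representatives-distinct _≟ᵛ_ cell (allFin order)) i j
        (linked-cell (linked-trans l (linked-sym l′)))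

      decomposition : Decomposition H
      decomposition = record
        { r         = length leaders
        ; part      = part
        ; part-slim = part-slim
        ; nonempty  = λ i → leader i ↑ˡ K , partOf⁺ {leader i} (inj₁ refl)
        ; covering  = λ u → covering (view u)
        ; disjoint  = λ i j u → disjoint i j (view u)
        ; diagonal-blocks = λ i → special-generated H (part i) (part-slim i)
        ; off-diagonal-blocks = λ i j i≢j (u , p) (v , q) → off-diagonal i j i≢j (view u) (view v) p q
        }
        where
        covering : ∀ {u} → View u → 𝔥.label u ≡ slim → ∃[ i ] u ∈ part i
        covering (slim-vertex x) _ = let i , l = covered x in i , partOf⁺ {leader i} l
        covering (fat-vertex k)  k-slim = contradiction (trans (sym k-slim) (label-fat attached k)) λ ()
        disjoint : ∀ i j {u} → View u → u ∈ part i → u ∈ part j → i ≡ j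
        disjoint i j (slim-vertex x) x∈ x∈′ = disjoint-slim i j x (partOf⁻ {leader i} x∈) (partOf⁻ {leader j} x∈′)
        disjoint i j (fat-vertex k)  k∈ _   = contradiction k∈ (partOf-fat {leader i})
        off-diagonal : ∀ i j → i ≢ j → ∀ {u v} → View u → View v → (p : 𝔥.label u ≡ slim) (q : 𝔥.label v ≡ slim) →
          u ∈ part i → v ∈ part j → 𝔥.specialMatrix (u , p) (v , q) ≡ 0ℤ
        off-diagonal i j i≢j (fat-vertex k) _ p q u∈ _ = contradiction u∈ (partOf-fat {leader i})
        off-diagonal i j i≢j (slim-vertex x) (fat-vertex k) p q _ v∈ = contradiction v∈ (partOf-fat {leader j})
        off-diagonal i j i≢j (slim-vertex x) (slim-vertex y) p q x∈ y∈ = trans (special-value attached x y p q) (vanish (x ≟ y) (special x y ℤ.≟ 0ℤ))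
          where
          l : Linked (leader i) x
          l = partOf⁻ {leader i} x∈
          l′ : Linked (leader j) y
          l′ = partOf⁻ {leader j} y∈
          unlinked : ¬ Linked x y
          unlinked xy = i≢j (disjoint-slim i j y (linked-trans l xy) l′)
          vanish : Dec (x ≡ y) → Dec (special x y ≡ 0ℤ) → adjacencyMatrix x y - common x y ≡ 0ℤ
          vanish (yes e) _       = contradiction (inj₁ e) unlinked
          vanish (no _)  (no n)  = contradiction (inj₂ n) unlinked
          vanish (no n)  (yes z) = trans (sym (δ-off n)) z

-- Recognition of the blocks inside 𝔣₁, 𝔣₂ and 𝔣₃

module Components where
  open Sums
  open GraphForm using (allFin-unique; ∑-allFin-δ)
  open Cliques using (B-refl)
  open TwoFat using (cnt-two)
  open Hoffman
  open Assemble
  open import Data.Fin using (_↑ˡ_; _↑ʳ_; _≟_)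
  open import Data.Fin.Subset using (Subset; _∈_)
  open import Data.Integer using (ℤ; +_; 0ℤ; 1ℤ; -1ℤ; _+_; _*_; -_; _-_; _≤_; +≤+)
  open import Data.Integer.Properties as ℤ hiding (_≟_)
  open import Data.Integer.Solver using (module +-*-Solver)
  open import Data.List.Membership.Propositional renaming (_∈_ to _∈ₗ_) using ()
  open import Data.List.Membership.Propositional.Properties using (∈-allFin; ∈-filter⁺; ∈-filter⁻)
  open +-*-Solver

  cnt-three : ∀ {n} (p : Fin n → Bool) {a b c} → a ≢ b → a ≢ c → b ≢ c → T (p a) → T (p b) → T (p c) →
    + 3 ≤ cnt p (allFin n)
  cnt-three {n} p {a} {b} {c} a≢b a≢c b≢c pa pb pc = subst (_≤ cnt p (allFin n)) total (∑-mono (allFin n) λ {i} _ → pointwise i)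
    where
    indicator : Fin n → Fin n → ℤ
    indicator x i = δ _≟_ i x * 1ℤ
    total : ∑ (λ i → indicator a i + indicator b i + indicator c i) (allFin n) ≡ + 3
    total = trans (∑-+ (λ i → indicator a i + indicator b i) (indicator c) (allFin n))
      (cong₂ _+_ (trans (∑-+ (indicator a) (indicator b) (allFin n)) (cong₂ _+_ (∑-allFin-δ (λ _ → 1ℤ) a) (∑-allFin-δ (λ _ → 1ℤ) b)))
        (∑-allFin-δ (λ _ → 1ℤ) c))
    one : ∀ {i} → T (p i) → 1ℤ ≤ 𝟙 (p i)
    one t = ℤ.≤-reflexive (sym (cong 𝟙 (T⇒≡ t)))
    pointwise : ∀ i → indicator a i + indicator b i + indicator c i ≤ 𝟙 (p i)
    pointwise i with i ≟ a | i ≟ b | i ≟ c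
    ... | yes refl | yes e    | _        = contradiction e a≢b
    ... | yes refl | no _     | yes e    = contradiction e a≢c
    ... | yes refl | no _     | no _     = one pa
    ... | no _     | yes refl | yes e    = contradiction e b≢c
    ... | no _     | yes refl | no _     = one pb
    ... | no _     | no _     | yes refl = one pc
    ... | no _     | no _     | no _     = 0≤𝟙 (p i)

  pair-of : ∀ {n} (p : Fin n → Bool) → cnt p (allFin n) ≡ + 2 →
    ∃[ k ] ∃[ l ] k ≢ l × T (p k) × T (p l) × (∀ j → T (p j) → j ≡ k ⊎ j ≡ l)
  pair-of {n} p two = extract (filter (T? ∘ p) (allFin n)) (AllPairs.filter⁺ (T? ∘ p) (allFin-unique n))
      (ℤ.+-injective (trans (length-filter p (allFin n)) two))
      (λ {j} j∈ → proj₂ (∈-filter⁻ (T? ∘ p) {xs = allFin n} j∈)) (λ j pj → ∈-filter⁺ (T? ∘ p) (∈-allFin j) pj)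
    where
    extract : ∀ L → Unique L → length L ≡ 2 → (∀ {j} → j ∈ₗ L → T (p j)) → (∀ j → T (p j) → j ∈ₗ L) →
      ∃[ k ] ∃[ l ] k ≢ l × T (p k) × T (p l) × (∀ j → T (p j) → j ≡ k ⊎ j ≡ l)
    extract (k ∷ l ∷ []) ((k≢l ∷ []) ∷ _) refl sound complete =
      k , l , k≢l , sound (here refl) , sound (there (here refl)) , λ j pj → locate (complete j pj)
      where
      locate : ∀ {j} → j ∈ₗ k ∷ l ∷ [] → j ≡ k ⊎ j ≡ l
      locate (here e)         = inj₁ e
      locate (there (here e)) = inj₂ e

  triple-of : ∀ {n} (p : Fin n → Bool) → cnt p (allFin n) ≡ + 3 →
    ∃[ k ] ∃[ l ] ∃[ m ] (∀ j → T (p j) → j ≡ k ⊎ j ≡ l ⊎ j ≡ m)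
  triple-of {n} p three = extract (filter (T? ∘ p) (allFin n))
      (ℤ.+-injective (trans (length-filter p (allFin n)) three)) (λ j pj → ∈-filter⁺ (T? ∘ p) (∈-allFin j) pj)
    where
    extract : ∀ L → length L ≡ 3 → (∀ j → T (p j) → j ∈ₗ L) → ∃[ k ] ∃[ l ] ∃[ m ] (∀ j → T (p j) → j ≡ k ⊎ j ≡ l ⊎ j ≡ m)
    extract (k ∷ l ∷ m ∷ []) refl complete = k , l , m , λ j pj → locate (complete j pj)
      where
      locate : ∀ {j} → j ∈ₗ k ∷ l ∷ m ∷ [] → j ≡ k ⊎ j ≡ l ⊎ j ≡ m
      locate (here e)                 = inj₁ e
      locate (there (here e))         = inj₂ (inj₁ e)
      locate (there (there (here e))) = inj₂ (inj₂ e)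

  T-∧ : ∀ {a b} → T a → T b → T (a ∧ b)
  T-∧ {true} {true} _ _ = _

  ∧-T : ∀ {a b} → T (a ∧ b) → T a × T b
  ∧-T {true} {true} _ = _ , _

  -- The arguments tell whether a fat vertex is the first or the second of the three at the block.
  -- The last value also serves as default for fat vertices elsewhere, which is why injectivity is
  -- claimed only among the three.
  code₁ : Bool → Bool → Fin 4
  code₁ true  _     = # 1
  code₁ false true  = # 2
  code₁ false false = # 3

  code₁-fat : ∀ b b′ → fat ≡ HoffmanGraph.label 𝔣₁ (code₁ b b′)
  code₁-fat true  _     = refl
  code₁-fat false true  = refl
  code₁-fat false false = refl

  code₁-adj : ∀ b b′ → true ≡ HoffmanGraph.adj 𝔣₁ (# 0) (code₁ b b′)
  code₁-adj true  _     = refl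
  code₁-adj false true  = refl
  code₁-adj false false = refl

  code₁-injective : ∀ {n} {j k l m m′ : Fin n} → m ≡ j ⊎ m ≡ k ⊎ m ≡ l → m′ ≡ j ⊎ m′ ≡ k ⊎ m′ ≡ l →
    code₁ (does (m ≟ j)) (does (m ≟ k)) ≡ code₁ (does (m′ ≟ j)) (does (m′ ≟ k)) → m ≡ m′
  code₁-injective {j = j} {k} {l} {m} {m′} m∈ m′∈ eq with m ≟ j | m ≟ k | m′ ≟ j | m′ ≟ k
  ... | yes e | _     | yes e′ | _      = trans e (sym e′)
  ... | yes e | _     | no _   | yes _  = contradiction eq λ ()
  ... | yes e | _     | no _   | no _   = contradiction eq λ ()
  ... | no _  | yes e | yes _  | _      = contradiction eq λ ()
  ... | no _  | yes e | no _   | yes e′ = trans e (sym e′)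
  ... | no _  | yes e | no _   | no _   = contradiction eq λ ()
  ... | no _  | no _  | yes _  | _      = contradiction eq λ ()
  ... | no _  | no _  | no _   | yes _  = contradiction eq λ ()
  ... | no n  | no o  | no n′  | no o′  = trans (last m∈ n o) (sym (last m′∈ n′ o′))
    where
    last : ∀ {x} → x ≡ j ⊎ x ≡ k ⊎ x ≡ l → x ≢ j → x ≢ k → x ≡ l
    last (inj₁ e)        n o = contradiction e n
    last (inj₂ (inj₁ e)) n o = contradiction e o
    last (inj₂ (inj₂ e)) n o = e

  -- The fat vertex F_ij of 𝔣₂ is recovered from its adjacency to x₁ (i = 1) and to y₁ (j = 1).
  code₂ : Bool → Bool → Fin 8
  code₂ true  true  = # 4
  code₂ true  false = # 5
  code₂ false true  = # 6
  code₂ false false = # 7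

  code₂-fat : ∀ b b′ → fat ≡ HoffmanGraph.label 𝔣₂ (code₂ b b′)
  code₂-fat true  true  = refl
  code₂-fat true  false = refl
  code₂-fat false true  = refl
  code₂-fat false false = refl

  code₂-injective : ∀ {a b a′ b′} → code₂ a b ≡ code₂ a′ b′ → a ≡ a′ × b ≡ b′
  code₂-injective {true}  {true}  {true}  {true}  _ = refl , refl
  code₂-injective {true}  {false} {true}  {false} _ = refl , refl
  code₂-injective {false} {true}  {false} {true}  _ = refl , refl
  code₂-injective {false} {false} {false} {false} _ = refl , refl
  code₂-injective {true}  {true}  {true}  {false} ()
  code₂-injective {true}  {true}  {false} {true}  ()
  code₂-injective {true}  {true}  {false} {false} ()
  code₂-injective {true}  {false} {true}  {true}  ()
  code₂-injective {true}  {false} {false} {true}  ()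
  code₂-injective {true}  {false} {false} {false} ()
  code₂-injective {false} {true}  {true}  {true}  ()
  code₂-injective {false} {true}  {true}  {false} ()
  code₂-injective {false} {true}  {false} {false} ()
  code₂-injective {false} {false} {true}  {true}  ()
  code₂-injective {false} {false} {true}  {false} ()
  code₂-injective {false} {false} {false} {true}  ()

  slim₂ : Fin 4 → Fin 8
  slim₂ zero                   = # 0
  slim₂ (suc zero)             = # 1
  slim₂ (suc (suc zero))       = # 2
  slim₂ (suc (suc (suc zero))) = # 3

  slim₂-slim : ∀ r → slim ≡ HoffmanGraph.label 𝔣₂ (slim₂ r)
  slim₂-slim zero                   = refl
  slim₂-slim (suc zero)             = refl
  slim₂-slim (suc (suc zero))       = refl
  slim₂-slim (suc (suc (suc zero))) = refl

  slim₂-injective : ∀ {r t} → slim₂ r ≡ slim₂ t → r ≡ t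
  slim₂-injective {r} {t} eq = subst₂ _≡_ (toRole-slim₂ r) (toRole-slim₂ t) (cong toRole eq)
    where
    toRole : Fin 8 → Fin 4
    toRole zero             = # 0
    toRole (suc zero)       = # 1
    toRole (suc (suc zero)) = # 2
    toRole _                = # 3
    toRole-slim₂ : ∀ r → toRole (slim₂ r) ≡ r
    toRole-slim₂ zero                   = refl
    toRole-slim₂ (suc zero)             = refl
    toRole-slim₂ (suc (suc zero))       = refl
    toRole-slim₂ (suc (suc (suc zero))) = refl

  -- Incidence in 𝔣₂, expressed by the incidence `a` with x₁ and `b` with y₁: x₂ has the fat
  -- neighbours that x₁ lacks, and y₂ those that y₁ lacks.
  row₂ : Fin 4 → Bool → Bool → Bool
  row₂ zero                   a b = a
  row₂ (suc zero)             a b = not a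
  row₂ (suc (suc zero))       a b = b
  row₂ (suc (suc (suc zero))) a b = not b

  row₂-adj : ∀ r a b → row₂ r a b ≡ HoffmanGraph.adj 𝔣₂ (slim₂ r) (code₂ a b)
  row₂-adj zero                   true  true  = refl
  row₂-adj zero                   true  false = refl
  row₂-adj zero                   false true  = refl
  row₂-adj zero                   false false = refl
  row₂-adj (suc zero)             true  true  = refl
  row₂-adj (suc zero)             true  false = refl
  row₂-adj (suc zero)             false true  = refl
  row₂-adj (suc zero)             false false = refl
  row₂-adj (suc (suc zero))       true  true  = refl
  row₂-adj (suc (suc zero))       true  false = refl
  row₂-adj (suc (suc zero))       false true  = refl
  row₂-adj (suc (suc zero))       false false = refl
  row₂-adj (suc (suc (suc zero))) true  true  = refl
  row₂-adj (suc (suc (suc zero))) true  false = refl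
  row₂-adj (suc (suc (suc zero))) false true  = refl
  row₂-adj (suc (suc (suc zero))) false false = refl

  complementary : ∀ {a b} → (T a → ¬ T b) → (¬ T a → T b) → b ≡ not a
  complementary {true}  {true}  f g = contradiction _ (f _)
  complementary {true}  {false} f g = refl
  complementary {false} {true}  f g = refl
  complementary {false} {false} f g = contradiction (g id) id

  adjacent-value : ∀ a {c} → 0ℤ ≤ c → (if a then 1ℤ else 0ℤ) - c ≡ 1ℤ → T a × c ≡ 0ℤ
  adjacent-value true  {c} c≥0 eq = _ , trans (solve 1 (λ c → c := con 1ℤ :- (con 1ℤ :- c)) refl c) (cong (λ t → 1ℤ - t) eq)
  adjacent-value false {c} c≥0 eq = contradiction (subst (0ℤ ≤_)
    (trans (solve 1 (λ c → c := con 0ℤ :- (con 0ℤ :- c)) refl c) (cong (λ t → 0ℤ - t) eq)) c≥0) λ ()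

  -- The two outcomes separate the target graphs: the adjacent pair is that of 𝔣₃, the nonadjacent
  -- one a pair x_i, y_j of 𝔣₂.
  negative-value : ∀ a {c} → (if a then 1ℤ else 0ℤ) - c ≡ -1ℤ → (T a × c ≡ + 2) ⊎ (a ≡ false × c ≡ 1ℤ)
  negative-value true  {c} eq = inj₁ (_ , trans (solve 1 (λ c → c := con 1ℤ :- (con 1ℤ :- c)) refl c) (cong (λ t → 1ℤ - t) eq))
  negative-value false {c} eq = inj₂ (refl , trans (solve 1 (λ c → c := con 0ℤ :- (con 0ℤ :- c)) refl c) (cong (λ t → 0ℤ - t) eq))

  module _ (G : Graph) (K : ℕ) (inc : Graph.V G → Fin K → Bool) (reduced : Reduced G K inc) where
    open Graph G
    open Reduced reduced
    open Decompose G K inc reduced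

    private
      s c : V → V → ℤ
      s = special G K inc
      c = common G K inc

    I : V → Fin K → Set
    I x k = T (inc x k)

    Meet : V → V → Set
    Meet x y = ∃[ k ] I x k × I y k

    c≥0 : ∀ x y → 0ℤ ≤ c x y
    c≥0 x y = cnt-nonneg (λ k → inc x k ∧ inc y k) (allFin K)

    meet⁻ : ∀ {x y} → c x y ≡ 0ℤ → ¬ Meet x y
    meet⁻ {x} {y} eq (k , xk , yk) = contradiction
      (subst (1ℤ ≤_) eq (cnt-member (λ k → inc x k ∧ inc y k) (∈-allFin k) (T-∧ xk yk))) λ { (+≤+ ()) }

    meet⁺ : ∀ {x y} → 1ℤ ≤ c x y → Meet x y
    meet⁺ {x} {y} le = let k , _ , t = cnt-witness (λ k → inc x k ∧ inc y k) (allFin K) le in k , ∧-T t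

    meet-once : ∀ {x y k l} → c x y ≡ 1ℤ → I x k → I y k → I x l → I y l → k ≡ l
    meet-once {x} {y} {k} {l} eq xk yk xl yl = decide (k ≟ l)
      where
      decide : Dec (k ≡ l) → k ≡ l
      decide (yes e)  = e
      decide (no k≢l) = contradiction (subst (+ 2 ≤_) eq
        (cnt-two (λ k → inc x k ∧ inc y k) (∈-allFin k) (∈-allFin l) k≢l (T-∧ xk yk) (T-∧ xl yl))) λ { (+≤+ (ℕ.s≤s ())) }

    fats-of : ∀ x → c x x ≡ cnt (inc x) (allFin K)
    fats-of x = ∑-cong (allFin K) λ k → cong 𝟙 (Bool.∧-idem (inc x k))

    no-three : ∀ {x j k l} → c x x ≡ + 2 → I x j → I x k → I x l → j ≢ k → j ≢ l → k ≡ l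
    no-three {x} {j} {k} {l} two xj xk xl j≢k j≢l = decide (k ≟ l)
      where
      decide : Dec (k ≡ l) → k ≡ l
      decide (yes e)  = e
      decide (no k≢l) = contradiction (subst (+ 3 ≤_) (trans (sym (fats-of x)) two)
        (cnt-three (inc x) j≢k j≢l k≢l xj xk xl)) λ { (+≤+ (ℕ.s≤s (ℕ.s≤s ()))) }

    s-diagonal : ∀ x → s x x ≡ + 3 - c x x
    s-diagonal x = cong (_- c x x) (B-refl G x)

    two-fats-of : ∀ {x y} → x ≢ y → s x y ≢ 0ℤ → c x x ≡ + 2
    two-fats-of {x} {y} x≢y s≢0 = [ id , (λ three → contradiction (isolated x three y x≢y) s≢0) ]′ (fatness x)

    s≡-1⇒≢ : ∀ {x y} → s x y ≡ -1ℤ → x ≢ y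
    s≡-1⇒≢ {x} eq refl = [ (λ two → contradiction (trans (sym eq) (trans (s-diagonal x) (cong (λ t → + 3 - t) two))) λ ())
                         , (λ three → contradiction (trans (sym eq) (trans (s-diagonal x) (cong (λ t → + 3 - t) three))) λ ()) ]′ (fatness x)

    positive : ∀ {x y} → x ≢ y → s x y ≡ 1ℤ → Adj x y × c x y ≡ 0ℤ
    positive {x} {y} x≢y eq = adjacent-value (adj x y) (c≥0 x y) (trans (sym (δ-off G K inc x≢y)) eq)

    negative : ∀ {x y} → s x y ≡ -1ℤ → (Adj x y × c x y ≡ + 2) ⊎ (adj x y ≡ false × c x y ≡ 1ℤ)
    negative {x} {y} eq = negative-value (adj x y) (trans (sym (δ-off G K inc (s≡-1⇒≢ eq))) eq)

    s-sym : ∀ {x y t} → s x y ≡ t → s y x ≡ t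
    s-sym {x} {y} eq = trans (special-sym G K inc y x) eq

    -one≢0 : ∀ {t} → t ≡ -1ℤ → t ≢ 0ℤ
    -one≢0 refl ()

    nonzero-sign : ∀ {x y} → s x y ≢ 0ℤ → s x y ≡ 1ℤ ⊎ s x y ≡ -1ℤ
    nonzero-sign {x} {y} n = [ (λ z → contradiction z n) , id ]′ (sign x y)

    linked-sign : ∀ {x y} → Linked G K inc x y → x ≡ y ⊎ s x y ≡ 1ℤ ⊎ s x y ≡ -1ℤ
    linked-sign (inj₁ e) = inj₁ e
    linked-sign (inj₂ n) = inj₂ (nonzero-sign n)

    opposite : ∀ {x y z} → s x y ≡ -1ℤ → s x z ≡ 1ℤ → s y z ≡ -1ℤ
    opposite {x} {y} {z} xy xz = trans (sym (ℤ.neg-involutive (s y z))) (cong -_ (trans (sym (transport⁻ x y xy z)) xz))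

    opposite′ : ∀ {x y z} → s x y ≡ -1ℤ → s x z ≡ -1ℤ → s y z ≡ 1ℤ
    opposite′ {x} {y} {z} xy xz = trans (sym (ℤ.neg-involutive (s y z))) (cong -_ (trans (sym (transport⁻ x y xy z)) xz))

    c-sym : ∀ x y → c x y ≡ c y x
    c-sym x y = ∑-cong (allFin K) λ k → cong 𝟙 (Bool.∧-comm (inc x k) (inc y k))

    meet-negative : ∀ {x y} → s x y ≡ -1ℤ → Meet x y
    meet-negative {x} {y} eq = [ (λ (_ , two) → meet⁺ (subst (1ℤ ≤_) (sym two) (+≤+ (ℕ.s≤s ℕ.z≤n))))
                               , (λ (_ , one) → meet⁺ (ℤ.≤-reflexive (sym one))) ]′ (negative eq)

    two-fats-left : ∀ {x y} → s x y ≡ -1ℤ → c x x ≡ + 2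
    two-fats-left eq = two-fats-of (s≡-1⇒≢ eq) (-one≢0 eq)

    -- An end of a negative pair has exactly two fat neighbours, so two common ones exhaust those of
    -- `p`.
    shared : ∀ {p q k} → s p q ≡ -1ℤ → c p q ≡ + 2 → I p k → I q k
    shared {p} {q} {k} pq both pk =
      let j , l , j≢l , tj , tl , _ = pair-of (λ k → inc p k ∧ inc q k) both
      in decide j l j≢l (∧-T tj) (∧-T tl) (k ≟ j) (k ≟ l)
      where
      decide : ∀ j l → j ≢ l → I p j × I q j → I p l × I q l → Dec (k ≡ j) → Dec (k ≡ l) → I q k
      decide j l _ (_ , qj) _ (yes refl) _ = qj
      decide j l _ _ (_ , ql) _ (yes refl) = ql
      decide j l j≢l (pj , _) (pl , _) (no k≢j) (no k≢l) =
        contradiction (no-three (two-fats-left pq) pk pj pl k≢j k≢l) j≢l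

    -- A third vertex z would have entry 1 with one of p, q and -1 with the other. It would then
    -- share a fat vertex with one of them and none with the other, although p and q have the same
    -- fat neighbours.
    adjacent-pair : ∀ {p q z} → s p q ≡ -1ℤ → c p q ≡ + 2 → Linked G K inc p z → p ≡ z ⊎ q ≡ z
    adjacent-pair {p} {q} {z} pq both l = [ inj₁ , (λ sgn → decide sgn (p ≟ z) (q ≟ z)) ]′ (linked-sign l)
      where
      decide : s p z ≡ 1ℤ ⊎ s p z ≡ -1ℤ → Dec (p ≡ z) → Dec (q ≡ z) → p ≡ z ⊎ q ≡ z
      decide _ (yes e) _ = inj₁ e
      decide _ _ (yes e) = inj₂ e
      decide (inj₁ pz) (no p≢z) (no q≢z) =
        let k , qk , zk = meet-negative (opposite pq pz)
        in contradiction (k , shared (s-sym pq) (trans (c-sym q p) both) qk , zk) (meet⁻ (proj₂ (positive p≢z pz)))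
      decide (inj₂ pz) (no p≢z) (no q≢z) =
        let k , pk , zk = meet-negative pz
        in contradiction (k , shared pq both pk , zk) (meet⁻ (proj₂ (positive q≢z (opposite′ pq pz))))

    Thin : V → Set
    Thin a = ∀ {p q} → Linked G K inc a p → s p q ≡ -1ℤ → adj p q ≡ false × c p q ≡ 1ℤ

    -- A negative pair with two common fat neighbours exhausts its block by `adjacent-pair`. Here it
    -- would have to be the pair a, b, which is not adjacent.
    thin : ∀ {a b} → s a b ≡ -1ℤ → adj a b ≡ false → Thin a
    thin {a} {b} ab a≁b {p} {q} ap pq = [ (λ (p~q , both) → contradiction p~q (decide
        (adjacent-pair pq both (linked-sym ap)) (adjacent-pair pq both (linked-trans (linked-sym ap) (inj₂ (-one≢0 ab)))))) , id ]′ (negative pq)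
      where
      a≢b : a ≢ b
      a≢b = s≡-1⇒≢ ab
      decide : p ≡ a ⊎ q ≡ a → p ≡ b ⊎ q ≡ b → ¬ Adj p q
      decide (inj₁ refl) (inj₁ refl) = contradiction refl a≢b
      decide (inj₁ refl) (inj₂ refl) = subst T a≁b
      decide (inj₂ refl) (inj₁ refl) = subst T (trans (symmetric p q) a≁b)
      decide (inj₂ refl) (inj₂ refl) = contradiction refl a≢b

    -- The two fat neighbours of b are shared with two of the pairwise disjoint vertices a, z, w.
    unique-positive : ∀ {a b z w} → s a b ≡ -1ℤ → a ≢ z → s a z ≡ 1ℤ → a ≢ w → s a w ≡ 1ℤ → z ≡ w
    unique-positive {a} {b} {z} {w} ab a≢z az a≢w aw = decide (z ≟ w)
      where
      decide : Dec (z ≡ w) → z ≡ w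
      decide (yes e)  = e
      decide (no z≢w) =
        let k₁ , bk₁ , ak₁ = meet-negative (s-sym ab)
            k₂ , bk₂ , zk₂ = meet-negative (opposite ab az)
            k₃ , bk₃ , wk₃ = meet-negative (opposite ab aw)
            k₂≡k₃ = no-three (two-fats-left (s-sym ab)) bk₁ bk₂ bk₃
              (λ e → meet⁻ (proj₂ (positive a≢z az)) (k₁ , ak₁ , subst (I z) (sym e) zk₂))
              (λ e → meet⁻ (proj₂ (positive a≢w aw)) (k₁ , ak₁ , subst (I w) (sym e) wk₃))
        in contradiction (k₂ , zk₂ , subst (I w) (sym k₂≡k₃) wk₃)
             (meet⁻ (proj₂ (positive z≢w (trans (sym (transport⁺ a z az w)) aw))))

    -- The vertex w differs from a, since k is not at a. If its entry with a is 1, it is z.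
    -- Otherwise it is opposite to both a and z and shares a fat vertex with each; these two are
    -- distinct, because a and z have none in common, so they are all that w has. As k is not at a,
    -- it is the one shared with z.
    complement : ∀ {a b z} → s a b ≡ -1ℤ → a ≢ z → s a z ≡ 1ℤ →
      ∀ {w k} → Linked G K inc a w → I w k → ¬ I a k → I z k
    complement {a} {b} {z} ab a≢z az {w} {k} aw wk ¬ak =
        [ (λ { refl → contradiction wk ¬ak }) , (λ sgn → decide sgn (a ≟ w)) ]′ (linked-sign aw)
      where
      decide : s a w ≡ 1ℤ ⊎ s a w ≡ -1ℤ → Dec (a ≡ w) → I z k
      decide _ (yes refl) = contradiction wk ¬ak
      decide (inj₁ aw≡1) (no a≢w) = subst (λ x → I x k) (sym (unique-positive ab a≢z az a≢w aw≡1)) wk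
      decide (inj₂ aw≡-1) (no a≢w) =
        let k₁ , ak₁ , wk₁ = meet-negative aw≡-1
            k₂ , zk₂ , wk₂ = meet-negative (trans (sym (transport⁺ a z az w)) aw≡-1)
            k≡k₂ = no-three (two-fats-left (s-sym aw≡-1)) wk₁ wk wk₂
              (λ e → ¬ak (subst (I a) e ak₁))
              (λ e → meet⁻ (proj₂ (positive a≢z az)) (k₁ , ak₁ , subst (I z) (sym e) zk₂))
        in subst (I z) (sym k≡k₂) zk₂

    private
      module 𝔇 = Decomposition decomposition

    module Component (i : Fin 𝔇.r) where
      a : V
      a = leader i

      S : Subset (order ℕ.+ K)
      S = generatedSet H (part i)

      BlockFat : Fin K → Set
      BlockFat k = ∃[ x ] Linked G K inc a x × I x k

      private
        module 𝔥 = HoffmanGraph H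

      slim-member : ∀ {x} → x ↑ˡ K ∈ S → Linked G K inc a x
      slim-member {x} x∈ = partOf⁻ G K inc {a} (generated-slim H (part i) (part-slim i) x∈ (label-slim G K inc attached x))

      fat-member : ∀ {k} → order ↑ʳ k ∈ S → BlockFat k
      fat-member {k} k∈ =
        let u , u∈ , k~u = generated-fat H (part i) (part-slim i) k∈ (label-fat G K inc attached k)
        in incident (view G K inc u) u∈ k~u
        where
        incident : ∀ {u} → View G K inc u → u ∈ part i → 𝔥.Adj (order ↑ʳ k) u → BlockFat k
        incident (slim-vertex x) x∈ k~x = x , partOf⁻ G K inc {a} x∈ , subst T (adj-fat-slim G K inc attached k x) k~x
        incident (fat-vertex l)  l∈ _   = contradiction l∈ (partOf-fat G K inc {a})

      module _ (𝔤 : HoffmanGraph) where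
        private
          module 𝔤 = HoffmanGraph 𝔤

        -- The maps are total on vertices and fat vertices of the whole graph, which avoids indexing
        -- by the block; apart from labels, they are constrained only within the block.
        embed : (σ : V → 𝔤.V) (τ : Fin K → 𝔤.V) →
          (∀ x → slim ≡ 𝔤.label (σ x)) → (∀ k → fat ≡ 𝔤.label (τ k)) →
          (∀ {x y} → Linked G K inc a x → Linked G K inc a y → adj x y ≡ 𝔤.adj (σ x) (σ y)) →
          (∀ {x k} → Linked G K inc a x → BlockFat k → inc x k ≡ 𝔤.adj (σ x) (τ k)) →
          (∀ {x y} → Linked G K inc a x → Linked G K inc a y → σ x ≡ σ y → x ≡ y) →
          (∀ {k l} → BlockFat k → BlockFat l → τ k ≡ τ l → k ≡ l) →
          𝔇.component i ≲ 𝔤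
        embed σ τ σ-slim τ-fat σσ στ σ-inj τ-inj = Embedding.embeds (𝔇.component i) 𝔤 φ
          (λ {u} {v} eq → at-injective S u v (injective (view G K inc (at S u)) (view G K inc (at S v)) (at-∈ S u) (at-∈ S v) eq))
          (λ u v → preserves (view G K inc (at S u)) (view G K inc (at S v)) (at-∈ S u) (at-∈ S v))
          (λ u → labels (view G K inc (at S u)))
          where
          φ⊎ : V ⊎ Fin K → 𝔤.V
          φ⊎ = [ σ , τ ]′
          φ₀ : Fin (order ℕ.+ K) → 𝔤.V
          φ₀ u = φ⊎ (split G K inc u)
          φ : Index S → 𝔤.V
          φ u = φ₀ (at S u)
          φ-slim : ∀ x → φ₀ (x ↑ˡ K) ≡ σ x
          φ-slim x = cong φ⊎ (split-slim G K inc x)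
          φ-fat : ∀ k → φ₀ (order ↑ʳ k) ≡ τ k
          φ-fat k = cong φ⊎ (split-fat G K inc k)
          labels : ∀ {u} → View G K inc u → 𝔥.label u ≡ 𝔤.label (φ₀ u)
          labels (slim-vertex x) = trans (label-slim G K inc attached x) (trans (σ-slim x) (cong 𝔤.label (sym (φ-slim x))))
          labels (fat-vertex k)  = trans (label-fat G K inc attached k) (trans (τ-fat k) (cong 𝔤.label (sym (φ-fat k))))
          distinct-labels : ∀ {x k} → ¬ (φ₀ (x ↑ˡ K) ≡ φ₀ (order ↑ʳ k))
          distinct-labels {x} {k} eq = contradiction
            (trans (sym (label-slim G K inc attached x)) (trans (labels (slim-vertex x)) (trans (cong 𝔤.label eq)
              (trans (sym (labels (fat-vertex k))) (label-fat G K inc attached k))))) λ ()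
          injective : ∀ {u v} → View G K inc u → View G K inc v → u ∈ S → v ∈ S → φ₀ u ≡ φ₀ v → u ≡ v
          injective (slim-vertex x) (slim-vertex y) u∈ v∈ eq = cong (_↑ˡ K) (σ-inj (slim-member u∈) (slim-member v∈)
            (trans (sym (φ-slim x)) (trans eq (φ-slim y))))
          injective (slim-vertex x) (fat-vertex k)  u∈ v∈ eq = contradiction eq distinct-labels
          injective (fat-vertex k)  (slim-vertex x) u∈ v∈ eq = contradiction (sym eq) distinct-labels
          injective (fat-vertex k)  (fat-vertex l)  u∈ v∈ eq = cong (order ↑ʳ_) (τ-inj (fat-member u∈) (fat-member v∈)
            (trans (sym (φ-fat k)) (trans eq (φ-fat l))))
          preserves : ∀ {u v} → View G K inc u → View G K inc v → u ∈ S → v ∈ S → 𝔥.adj u v ≡ 𝔤.adj (φ₀ u) (φ₀ v)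
          preserves (slim-vertex x) (slim-vertex y) u∈ v∈ = trans (adj-slim G K inc attached x y)
            (trans (σσ (slim-member u∈) (slim-member v∈)) (sym (cong₂ 𝔤.adj (φ-slim x) (φ-slim y))))
          preserves (slim-vertex x) (fat-vertex k)  u∈ v∈ = trans (adj-slim-fat G K inc attached x k)
            (trans (στ (slim-member u∈) (fat-member v∈)) (sym (cong₂ 𝔤.adj (φ-slim x) (φ-fat k))))
          preserves (fat-vertex k)  (slim-vertex x) u∈ v∈ = trans (adj-fat-slim G K inc attached k x)
            (trans (στ (slim-member v∈) (fat-member u∈)) (trans (𝔤.symmetric (σ x) (τ k)) (sym (cong₂ 𝔤.adj (φ-fat k) (φ-slim x)))))
          preserves (fat-vertex k)  (fat-vertex l)  u∈ v∈ = trans (adj-fat G K inc attached k l)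
            (sym (trans (cong₂ 𝔤.adj (φ-fat k) (φ-fat l)) (¬T⇒≡ (𝔤.fat-fat (τ k) (τ l) (sym (τ-fat k)) (sym (τ-fat l))))))

      private
        Block : V → Set
        Block = Linked G K inc a

      embed-𝔣₁ : c a a ≡ + 3 → 𝔇.component i ≲ 𝔣₁
      embed-𝔣₁ three = embedding (triple-of (inc a) (trans (sym (fats-of a)) three))
        where
        only : ∀ {x} → Block x → a ≡ x
        only {x} l = decide l (a ≟ x)
          where
          decide : Block x → Dec (a ≡ x) → a ≡ x
          decide _        (yes e) = e
          decide (inj₁ e) (no _)  = e
          decide (inj₂ n) (no a≢) = contradiction (isolated a three x a≢) n
        at-a : ∀ {k} → BlockFat k → I a k
        at-a {k} (x , l , xk) = subst (λ x → I x k) (sym (only l)) xk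
        embedding : (∃[ j ] ∃[ k ] ∃[ l ] (∀ m → T (inc a m) → m ≡ j ⊎ m ≡ k ⊎ m ≡ l)) → 𝔇.component i ≲ 𝔣₁
        embedding (j , k , l , all) = embed 𝔣₁ (λ _ → # 0) (λ m → code₁ (does (m ≟ j)) (does (m ≟ k)))
          (λ _ → refl) (λ m → code₁-fat (does (m ≟ j)) (does (m ≟ k)))
          (λ {x} {y} lx ly → trans (cong (adj x) (trans (sym (only ly)) (only lx))) (irreflexive x))
          (λ {x} {m} lx bm → trans (T⇒≡ (subst (λ x → I x m) (only lx) (at-a bm))) (code₁-adj (does (m ≟ j)) (does (m ≟ k))))
          (λ lx ly _ → trans (sym (only lx)) (only ly))
          (λ {m} {m′} bm bm′ → code₁-injective (all m (at-a bm)) (all m′ (at-a bm′)))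

      embed-𝔣₃ : ∀ {b} → s a b ≡ -1ℤ → Adj a b → c a b ≡ + 2 → 𝔇.component i ≲ 𝔣₃
      embed-𝔣₃ {b} ab a~b both = embedding (pair-of (inc a) (trans (sym (fats-of a)) (two-fats-left ab)))
        where
        at-a : ∀ {k} → BlockFat k → I a k
        at-a {k} (x , l , xk) = [ (λ { refl → xk }) , (λ { refl → shared (s-sym ab) (trans (c-sym b a) both) xk }) ]′ (adjacent-pair ab both l)
        at-b : ∀ {k} → BlockFat k → I b k
        at-b bk = shared ab both (at-a bk)
        σ : V → Fin 4
        σ x = if does (a ≟ x) then # 0 else # 1
        σ-slim : ∀ d → slim ≡ HoffmanGraph.label 𝔣₃ (if d then # 0 else # 1)
        σ-slim true  = refl
        σ-slim false = refl
        σ-adj : ∀ {x y} (d : Dec (a ≡ x)) (e : Dec (a ≡ y)) → a ≡ x ⊎ b ≡ x → a ≡ y ⊎ b ≡ y →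
          adj x y ≡ HoffmanGraph.adj 𝔣₃ (if does d then # 0 else # 1) (if does e then # 0 else # 1)
        σ-adj (yes refl) (yes refl) _ _ = irreflexive a
        σ-adj (yes refl) (no n) _ (inj₁ e)    = contradiction e n
        σ-adj (yes refl) (no n) _ (inj₂ refl) = T⇒≡ a~b
        σ-adj (no n) _ (inj₁ e) _ = contradiction e n
        σ-adj (no n) (yes refl) (inj₂ refl) _ = trans (symmetric b a) (T⇒≡ a~b)
        σ-adj (no n) (no m) (inj₂ refl) (inj₁ e) = contradiction e m
        σ-adj (no n) (no m) (inj₂ refl) (inj₂ refl) = irreflexive b
        σ-inj : ∀ {x y} (d : Dec (a ≡ x)) (e : Dec (a ≡ y)) → a ≡ x ⊎ b ≡ x → a ≡ y ⊎ b ≡ y →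
          _≡_ {A = Fin 4} (if does d then # 0 else # 1) (if does e then # 0 else # 1) → x ≡ y
        σ-inj (yes refl) (yes refl) _ _ _ = refl
        σ-inj (yes _) (no _) _ _ ()
        σ-inj (no _) (yes _) _ _ ()
        σ-inj (no n) (no m) (inj₁ e) _ _ = contradiction e n
        σ-inj (no n) (no m) (inj₂ _) (inj₁ e) _ = contradiction e m
        σ-inj (no n) (no m) (inj₂ refl) (inj₂ refl) _ = refl
        τ-fat : ∀ d → fat ≡ HoffmanGraph.label 𝔣₃ (if d then # 2 else # 3)
        τ-fat true  = refl
        τ-fat false = refl
        στ-adj : ∀ d e → true ≡ HoffmanGraph.adj 𝔣₃ (if d then # 0 else # 1) (if e then # 2 else # 3)
        στ-adj true  true  = refl
        στ-adj true  false = refl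
        στ-adj false true  = refl
        στ-adj false false = refl
        τ-inj : ∀ {k l m m′} (d : Dec (m ≡ k)) (e : Dec (m′ ≡ k)) → m ≡ k ⊎ m ≡ l → m′ ≡ k ⊎ m′ ≡ l →
          _≡_ {A = Fin 4} (if does d then # 2 else # 3) (if does e then # 2 else # 3) → m ≡ m′
        τ-inj (yes refl) (yes refl) _ _ _ = refl
        τ-inj (yes _) (no _) _ _ ()
        τ-inj (no _) (yes _) _ _ ()
        τ-inj (no n) (no m) (inj₁ e) _ _ = contradiction e n
        τ-inj (no n) (no m) (inj₂ _) (inj₁ e) _ = contradiction e m
        τ-inj (no n) (no m) (inj₂ refl) (inj₂ refl) _ = refl
        embedding : (∃[ k ] ∃[ l ] k ≢ l × T (inc a k) × T (inc a l) × (∀ m → T (inc a m) → m ≡ k ⊎ m ≡ l)) → 𝔇.component i ≲ 𝔣₃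
        embedding (k , l , _ , _ , _ , all) = embed 𝔣₃ σ (λ m → if does (m ≟ k) then # 2 else # 3)
          (λ x → σ-slim (does (a ≟ x))) (λ m → τ-fat (does (m ≟ k)))
          (λ {x} {y} lx ly → σ-adj (a ≟ x) (a ≟ y) (adjacent-pair ab both lx) (adjacent-pair ab both ly))
          (λ {x} {m} lx bm → trans (T⇒≡ ([ (λ { refl → at-a bm }) , (λ { refl → at-b bm }) ]′ (adjacent-pair ab both lx)))
            (στ-adj (does (a ≟ x)) (does (m ≟ k))))
          (λ {x} {y} lx ly → σ-inj (a ≟ x) (a ≟ y) (adjacent-pair ab both lx) (adjacent-pair ab both ly))
          (λ {m} {m′} bm bm′ → τ-inj (m ≟ k) (m′ ≟ k) (all m (at-a bm)) (all m′ (at-a bm′)))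

      module Cross {b} (ab : s a b ≡ -1ℤ) (a≁b : adj a b ≡ false) (once : c a b ≡ 1ℤ) where
        ba : s b a ≡ -1ℤ
        ba = s-sym ab

        a-thin : Thin a
        a-thin = thin ab a≁b

        linked-b : ∀ {x} → Block x → Linked G K inc b x
        linked-b = linked-trans (inj₂ (-one≢0 ba))

        -- The roles are x₁, x₂, y₁, y₂ in this order: `a` is x₁, `b` is y₁, and x₂ and y₂ are the
        -- vertices with entry 1 to `a` and to `b`. A role may stay vacant; the block is then a
        -- proper induced subgraph of 𝔣₂.
        Role : Fin 4 → V → Set
        Role zero                   x = a ≡ x
        Role (suc zero)             x = a ≢ x × s a x ≡ 1ℤ
        Role (suc (suc zero))       x = b ≡ x
        Role (suc (suc (suc zero))) x = b ≢ x × s b x ≡ 1ℤ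

        role : V → Fin 4
        role x = if does (a ≟ x) then # 0 else if does (b ≟ x) then # 2 else if does (s a x ℤ.≟ 1ℤ) then # 1 else # 3

        role-Role : ∀ {x} → Block x → Role (role x) x
        role-Role {x} l = decide (a ≟ x) (b ≟ x) (s a x ℤ.≟ 1ℤ)
          where
          decide : (d : Dec (a ≡ x)) (e : Dec (b ≡ x)) (f : Dec (s a x ≡ 1ℤ)) →
            Role (if does d then # 0 else if does e then # 2 else if does f then # 1 else # 3) x
          decide (yes e) _ _ = e
          decide (no _) (yes e) _ = e
          decide (no n) (no _) (yes e) = n , e
          -- The entry with `a` is nonzero and not 1, hence -1, and two vertices opposite to `a`
          -- have entry 1 with each other.
          decide (no n) (no m) (no o) = m , [ (λ e → contradiction e n) , [ (λ e → contradiction e o) , opposite′ ab ]′ ]′ (linked-sign l)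

        Role-unique : ∀ r {x y} → Role r x → Role r y → x ≡ y
        Role-unique zero                   refl refl = refl
        Role-unique (suc zero)             (n , e) (m , f) = unique-positive ab n e m f
        Role-unique (suc (suc zero))       refl refl = refl
        Role-unique (suc (suc (suc zero))) (n , e) (m , f) = unique-positive ba n e m f

        same-role : ∀ r {x y} → Role r x → Role r y → adj x y ≡ false
        same-role r {x} p q = trans (cong (adj x) (sym (Role-unique r p q))) (irreflexive x)

        nonadjacent : ∀ {x y} → Block x → s x y ≡ -1ℤ → adj x y ≡ false
        nonadjacent l e = proj₁ (a-thin l e)

        adjacent : ∀ {x y} → x ≢ y → s x y ≡ 1ℤ → adj x y ≡ true
        adjacent n e = T⇒≡ (proj₁ (positive n e))

        Role-adj : ∀ r t {x y} → Block x → Block y → Role r x → Role t y → adj x y ≡ HoffmanGraph.adj 𝔣₂ (slim₂ r) (slim₂ t)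
        Role-adj zero zero _ _ p q = same-role zero p q
        Role-adj zero (suc zero) _ _ refl (n , e) = adjacent n e
        Role-adj zero (suc (suc zero)) _ _ refl refl = a≁b
        Role-adj zero (suc (suc (suc zero))) lx _ refl (n , e) = nonadjacent lx (opposite ba e)
        Role-adj (suc zero) zero _ _ (n , e) refl = trans (symmetric _ a) (adjacent n e)
        Role-adj (suc zero) (suc zero) _ _ p q = same-role (suc zero) p q
        Role-adj (suc zero) (suc (suc zero)) lx _ (n , e) refl = nonadjacent lx (s-sym (opposite ab e))
        Role-adj (suc zero) (suc (suc (suc zero))) {x} {y} lx _ (n , e) (m , f) =
          nonadjacent lx (trans (sym (transport⁺ a x e y)) (opposite ba f))
        Role-adj (suc (suc zero)) zero _ _ refl refl = trans (symmetric b a) a≁b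
        Role-adj (suc (suc zero)) (suc zero) lx _ refl (n , e) = nonadjacent lx (opposite ab e)
        Role-adj (suc (suc zero)) (suc (suc zero)) _ _ p q = same-role (suc (suc zero)) p q
        Role-adj (suc (suc zero)) (suc (suc (suc zero))) _ _ refl (n , e) = adjacent n e
        Role-adj (suc (suc (suc zero))) zero lx ly (n , e) refl = nonadjacent lx (s-sym (opposite ba e))
        Role-adj (suc (suc (suc zero))) (suc zero) {x} {y} lx _ (n , e) (m , f) =
          nonadjacent lx (trans (sym (transport⁺ b x e y)) (opposite ab f))
        Role-adj (suc (suc (suc zero))) (suc (suc zero)) _ _ (n , e) refl = trans (symmetric _ b) (adjacent n e)
        Role-adj (suc (suc (suc zero))) (suc (suc (suc zero))) _ _ p q = same-role (suc (suc (suc zero))) p q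

        -- For x₂ and y₂ the fat neighbours are complementary to those of `a` and `b` within the
        -- block: disjointness comes from the entry 1, covering from `complement`.
        Role-incidence : ∀ r {x k} → Role r x → BlockFat k → inc x k ≡ row₂ r (inc a k) (inc b k)
        Role-incidence zero refl _ = refl
        Role-incidence (suc zero) {x} {k} (n , e) (w , l , wk) = complementary
          (λ ak xk → meet⁻ (proj₂ (positive n e)) (k , ak , xk)) (complement ab n e l wk)
        Role-incidence (suc (suc zero)) refl _ = refl
        Role-incidence (suc (suc (suc zero))) {x} {k} (n , e) (w , l , wk) = complementary
          (λ bk xk → meet⁻ (proj₂ (positive n e)) (k , bk , xk)) (complement ba n e (linked-b l) wk)

        -- Of the two fat neighbours of x, one is shared with y, which leaves at most one that
        -- avoids y.
        unique-fat : ∀ {x y k l} → s x y ≡ -1ℤ → I x k → I x l → ¬ I y k → ¬ I y l → k ≡ l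
        unique-fat {x} {y} {k} {l} xy xk xl ¬yk ¬yl =
          let j , xj , yj = meet-negative xy
          in no-three (two-fats-left xy) xj xk xl (λ e → ¬yk (subst (I y) e yj)) (λ e → ¬yl (subst (I y) e yj))

        -- A fat vertex at both a and b is their only common one; one at exactly one of them is
        -- settled by `unique-fat`.
        fat-unique : ∀ {k l} → BlockFat k → BlockFat l → inc a k ≡ inc a l → inc b k ≡ inc b l → k ≡ l
        fat-unique {k} {l} (w , aw , wk) (w′ , aw′ , w′l) ea eb = decide (T? (inc a k)) (T? (inc b k))
          where
          -- A fat vertex off both a and b sits at w, which must be x₂ or y₂. By `complement` the
          -- second fat vertex sits at w too, and w is opposite to b or to a respectively, so
          -- `unique-fat` applies.
          elsewhere : ∀ r → Role r w → ¬ I a k → ¬ I b k → k ≡ l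
          elsewhere zero refl ¬ak _ = contradiction wk ¬ak
          elsewhere (suc zero) (n , e) ¬ak ¬bk = unique-fat (s-sym (opposite ab e)) wk
            (complement ab n e aw′ w′l (¬ak ∘ subst T (sym ea))) ¬bk (¬bk ∘ subst T (sym eb))
          elsewhere (suc (suc zero)) refl _ ¬bk = contradiction wk ¬bk
          elsewhere (suc (suc (suc zero))) (n , e) ¬ak ¬bk = unique-fat (s-sym (opposite ba e)) wk
            (complement ba n e (linked-b aw′) w′l (¬bk ∘ subst T (sym eb))) ¬ak (¬ak ∘ subst T (sym ea))
          decide : Dec (I a k) → Dec (I b k) → k ≡ l
          decide (yes ak) (yes bk) = meet-once once ak bk (subst T ea ak) (subst T eb bk)
          decide (yes ak) (no ¬bk) = unique-fat ab ak (subst T ea ak) ¬bk (¬bk ∘ subst T (sym eb))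
          decide (no ¬ak) (yes bk) = unique-fat ba bk (subst T eb bk) ¬ak (¬ak ∘ subst T (sym ea))
          decide (no ¬ak) (no ¬bk) = elsewhere (role w) (role-Role aw) ¬ak ¬bk

        embed-𝔣₂ : 𝔇.component i ≲ 𝔣₂
        embed-𝔣₂ = embed 𝔣₂ (slim₂ ∘ role) (λ k → code₂ (inc a k) (inc b k))
          (λ x → slim₂-slim (role x)) (λ k → code₂-fat (inc a k) (inc b k))
          (λ {x} {y} lx ly → Role-adj (role x) (role y) lx ly (role-Role lx) (role-Role ly))
          (λ {x} {k} lx bk → trans (Role-incidence (role x) (role-Role lx) bk) (row₂-adj (role x) (inc a k) (inc b k)))
          (λ {x} {y} lx ly eq → Role-unique (role x) (role-Role lx)
            (subst (λ r → Role r y) (sym (slim₂-injective {role x} {role y} eq)) (role-Role ly)))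
          (λ {k} {l} bk bl eq → fat-unique bk bl (proj₁ (code₂-injective {inc a k} {inc b k} {inc a l} {inc b l} eq)) (proj₂ (code₂-injective {inc a k} {inc b k} {inc a l} {inc b l} eq)))

      embeds : ∃[ j ] 𝔇.component i ≲ 𝔣 j
      embeds = [ (λ two → let b , ab = partner a two in
                   [ (λ (a~b , both) → # 2 , embed-𝔣₃ ab a~b both) , (λ (a≁b , once) → # 1 , Cross.embed-𝔣₂ ab a≁b once) ]′ (negative ab))
               , (λ three → # 0 , embed-𝔣₁ three) ]′ (fatness a)

    -- The additional fat vertices are already part of `H`, so `H` can serve as its own extension
    -- 𝔥′.
    isLine : IsLineHoffmanGraph 𝔣 H
    isLine = record
      { 𝔥′            = H
      ; W             = Identity.image
      ; inducing      = Identity.image-inducing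
      ; subgraph      = Identity.isomorphic
      ; sameSlimGraph = λ x _ → Identity.φ∈image x
      ; decomposition = decomposition
      ; components    = Component.embeds
      }
      where
      module Identity = Embedding H H id id (λ _ _ → refl) (λ _ → refl)

-- Additional fat vertices for the classes without an entry -1

module Extras where
  open Sums
  open Forms
  open GraphForm using (B)
  open Cliques using (B-refl)
  open Repr
  open Assemble
  open import Data.Fin using (splitAt; _↑ˡ_; _↑ʳ_; _≟_)
  open import Data.Integer using (ℤ; +_; -[1+_]; 0ℤ; 1ℤ; -1ℤ; _+_; _*_; -_; _-_; _≤_; +≤+; -≤-)
  open import Data.Integer.Properties as ℤ hiding (_≟_)
  open import Data.Integer.Solver using (module +-*-Solver)
  open import Data.List.Membership.Propositional renaming (_∈_ to _∈ₗ_) using ()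
  open import Data.List.Membership.Propositional.Properties using (∈-allFin; ∈-filter⁺; ∈-filter⁻; ∈-map⁺)
  open import Data.Vec as Vec using (Vec; tabulate)
  import Data.Vec.Properties as Vec
  open import Relation.Nullary.Decidable using (_×-dec_; _⊎-dec_; ¬?; dec-true; dec-false)
  open +-*-Solver

  sign-cases : ∀ {t} → t ≤ 1ℤ → -1ℤ ≤ t → t ≡ 0ℤ ⊎ t ≡ 1ℤ ⊎ t ≡ -1ℤ
  sign-cases {+ 0}             _ _ = inj₁ refl
  sign-cases {+ 1}             _ _ = inj₂ (inj₁ refl)
  sign-cases {+ suc (suc n)}   (+≤+ (ℕ.s≤s ())) _
  sign-cases { -[1+ 0 ]}       _ _ = inj₂ (inj₂ refl)
  sign-cases { -[1+ suc n ]}   _ (-≤- ())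

  -- The bounds are the form at x + y and x - y, with e the sum of two diagonal entries; |2t| ≤ e ≤
  -- 2 leaves three integers.
  bounded-sign : ∀ {e t} → e ≤ + 2 → 0ℤ ≤ e + + 2 * t → 0ℤ ≤ e - + 2 * t → t ≡ 0ℤ ⊎ t ≡ 1ℤ ⊎ t ≡ -1ℤ
  bounded-sign {e} {t} e≤2 lo hi = sign-cases
    (ℤ.≮⇒≥ λ 1<t → contradiction (subst (0ℤ ≤_)
      (solve 2 (λ e t → (e :- con (+ 2) :* t) :+ (con (+ 2) :- e) :+ con (+ 2) :* (t :- con (+ 2)) := con -[1+ 1 ]) refl e t)
      (0≤+ (0≤+ hi (gap e≤2)) (0≤* {+ 2} (+≤+ ℕ.z≤n) (gap (ℤ.i<j⇒suc[i]≤j 1<t))))) λ ())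
    (ℤ.≮⇒≥ λ t<-1 → contradiction (subst (0ℤ ≤_)
      (solve 2 (λ e t → (e :+ con (+ 2) :* t) :+ (con (+ 2) :- e) :+ con (+ 2) :* (con -[1+ 1 ] :- t) := con -[1+ 1 ]) refl e t)
      (0≤+ (0≤+ lo (gap e≤2)) (0≤* {+ 2} (+≤+ ℕ.z≤n) (gap (ℤ.i<j⇒i≤pred[j] t<-1))))) λ ())

  bounded-zero : ∀ {e t} → e ≤ 1ℤ → 0ℤ ≤ e + + 2 * t → 0ℤ ≤ e - + 2 * t → t ≡ 0ℤ
  bounded-zero {e} {t} e≤1 lo hi = [ id , [ (λ { refl → contradiction (subst (0ℤ ≤_)
        (solve 1 (λ e → (e :- con (+ 2)) :+ (con 1ℤ :- e) := con -1ℤ) refl e) (0≤+ hi (gap e≤1))) λ () })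
      , (λ { refl → contradiction (subst (0ℤ ≤_)
        (solve 1 (λ e → (e :+ con -[1+ 1 ]) :+ (con 1ℤ :- e) := con -1ℤ) refl e) (0≤+ lo (gap e≤1))) λ () }) ]′ ]′
    (bounded-sign (ℤ.≤-trans e≤1 (+≤+ (ℕ.s≤s ℕ.z≤n))) lo hi)

  module Completion (G : Graph) (K₀ : ℕ) (inc₀ : Graph.V G → Fin K₀ → Bool)
    (attached₀ : ∀ k → ∃[ x ] T (inc₀ x k))
    (fatness₀ : ∀ x → common G K₀ inc₀ x x ≡ + 2 ⊎ common G K₀ inc₀ x x ≡ + 3)
    (nonneg : ∀ w → weight w ≤ + 5 → 0ℤ ≤ form (special G K₀ inc₀) w w) where
    open Graph G

    s₀ c₀ : V → V → ℤ
    s₀ = special G K₀ inc₀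
    c₀ = common G K₀ inc₀

    s₀-sym : ∀ x y → s₀ x y ≡ s₀ y x
    s₀-sym = special-sym G K₀ inc₀

    diagonal : ∀ {x t} → c₀ x x ≡ t → s₀ x x ≡ + 3 - t
    diagonal {x} eq = cong₂ _-_ (B-refl G x) eq

    diagonal≤1 : ∀ x → s₀ x x ≤ 1ℤ
    diagonal≤1 x = [ (λ e → ℤ.≤-reflexive (diagonal e)) , (λ e → subst (_≤ 1ℤ) (sym (diagonal e)) (+≤+ ℕ.z≤n)) ]′ (fatness₀ x)

    pair-lower : ∀ x y → 0ℤ ≤ (s₀ x x + s₀ y y) + + 2 * s₀ x y
    pair-lower x y = subst (0ℤ ≤_) (trans
      (cong (λ t → (1ℤ * s₀ x x + (1ℤ * s₀ x y + 0ℤ)) + ((1ℤ * t + (1ℤ * s₀ y y + 0ℤ)) + 0ℤ)) (s₀-sym y x))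
      (solve 3 (λ a b t → (con 1ℤ :* a :+ (con 1ℤ :* t :+ con 0ℤ)) :+ ((con 1ℤ :* t :+ (con 1ℤ :* b :+ con 0ℤ)) :+ con 0ℤ)
         := (a :+ b) :+ con (+ 2) :* t) refl (s₀ x x) (s₀ y y) (s₀ x y)))
      (nonneg ((1ℤ , x) ∷ (1ℤ , y) ∷ []) (+≤+ (ℕ.m≤m+n 2 3)))

    pair-upper : ∀ x y → 0ℤ ≤ (s₀ x x + s₀ y y) - + 2 * s₀ x y
    pair-upper x y = subst (0ℤ ≤_) (trans
      (cong (λ t → (1ℤ * s₀ x x + (-1ℤ * s₀ x y + 0ℤ)) + ((-1ℤ * t + (1ℤ * s₀ y y + 0ℤ)) + 0ℤ)) (s₀-sym y x))
      (solve 3 (λ a b t → (con 1ℤ :* a :+ (con -1ℤ :* t :+ con 0ℤ)) :+ ((con -1ℤ :* t :+ (con 1ℤ :* b :+ con 0ℤ)) :+ con 0ℤ)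
         := (a :+ b) :- con (+ 2) :* t) refl (s₀ x x) (s₀ y y) (s₀ x y)))
      (nonneg ((1ℤ , x) ∷ (-1ℤ , y) ∷ []) (+≤+ (ℕ.m≤m+n 2 3)))

    sign₀ : ∀ x y → s₀ x y ≡ 0ℤ ⊎ s₀ x y ≡ 1ℤ ⊎ s₀ x y ≡ -1ℤ
    sign₀ x y = bounded-sign (ℤ.+-mono-≤ (diagonal≤1 x) (diagonal≤1 y)) (pair-lower x y) (pair-upper x y)

    isolated₀ : ∀ x → c₀ x x ≡ + 3 → ∀ y → s₀ x y ≡ 0ℤ
    isolated₀ x eq y = bounded-zero (ℤ.+-mono-≤ (ℤ.≤-reflexive (diagonal eq)) (diagonal≤1 y)) (pair-lower x y) (pair-upper x y)

    two-fats₀ : ∀ {x y} → s₀ x y ≢ 0ℤ → s₀ x x ≡ 1ℤ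
    two-fats₀ {x} {y} n = [ diagonal , (λ e → contradiction (isolated₀ x e y) n) ]′ (fatness₀ x)

    -- If s x y = σ = ±1 then x - σ y is a null vector of the form, hence orthogonal to every z.
    module _ (σ : ℤ) (x y z : V) where
      triple : ∀ β → weight ((1ℤ , x) ∷ (- σ , y) ∷ (β , z) ∷ []) ≤ + 5 →
        0ℤ ≤ (s₀ x x + σ * σ * s₀ y y - + 2 * σ * s₀ x y) + (β * β * s₀ z z + + 2 * (β * (s₀ x z - σ * s₀ y z)))
      triple β small = subst (0ℤ ≤_) (trans
        (cong₂ (λ t (u , v) → row 1ℤ (s₀ x x) (s₀ x y) (s₀ x z) + (row (- σ) t (s₀ y y) (s₀ y z) + (row β u v (s₀ z z) + 0ℤ)))
          (s₀-sym y x) (cong₂ _,_ (s₀-sym z x) (s₀-sym z y)))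
        (solve 8 (λ σ β xx yy zz xy xz yz →
            (con 1ℤ :* con 1ℤ :* xx :+ (con 1ℤ :* (:- σ) :* xy :+ (con 1ℤ :* β :* xz :+ con 0ℤ)))
            :+ (((:- σ) :* con 1ℤ :* xy :+ ((:- σ) :* (:- σ) :* yy :+ ((:- σ) :* β :* yz :+ con 0ℤ)))
            :+ ((β :* con 1ℤ :* xz :+ (β :* (:- σ) :* yz :+ (β :* β :* zz :+ con 0ℤ))) :+ con 0ℤ))
            := (xx :+ σ :* σ :* yy :- con (+ 2) :* σ :* xy) :+ (β :* β :* zz :+ con (+ 2) :* (β :* (xz :- σ :* yz)))) refl
          σ β (s₀ x x) (s₀ y y) (s₀ z z) (s₀ x y) (s₀ x z) (s₀ y z)))
        (nonneg ((1ℤ , x) ∷ (- σ , y) ∷ (β , z) ∷ []) small)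
        where
        row : ℤ → ℤ → ℤ → ℤ → ℤ
        row α p q r = α * 1ℤ * p + (α * (- σ) * q + (α * β * r + 0ℤ))

      -- Adding z or -z to the null vector gives the values s₀ z z ± 2 u, where u is the difference
      -- to be shown zero. Both are nonnegative and s₀ z z is at most 1, so the integer u vanishes.
      orthogonal : (∀ β → (β ≡ 1ℤ ⊎ β ≡ -1ℤ) → weight ((1ℤ , x) ∷ (- σ , y) ∷ (β , z) ∷ []) ≤ + 5) →
        σ * σ ≡ 1ℤ → s₀ x y ≡ σ → σ ≢ 0ℤ → s₀ x z ≡ σ * s₀ y z
      orthogonal small σσ≡1 xy σ≢0 = trans (solve 2 (λ a b → a := (a :- b) :+ b) refl (s₀ x z) (σ * s₀ y z))
        (trans (cong (_+ σ * s₀ y z) (bounded-zero (diagonal≤1 z)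
          (subst (0ℤ ≤_) (trans (cong (λ t → t + (1ℤ * 1ℤ * s₀ z z + + 2 * (1ℤ * (s₀ x z - σ * s₀ y z)))) null) (solve 2 (λ z u → con 0ℤ :+ (con 1ℤ :* con 1ℤ :* z :+ con (+ 2) :* (con 1ℤ :* u)) := z :+ con (+ 2) :* u) refl (s₀ z z) (s₀ x z - σ * s₀ y z)))
            (triple 1ℤ (small 1ℤ (inj₁ refl))))
          (subst (0ℤ ≤_) (trans (cong (λ t → t + (-1ℤ * -1ℤ * s₀ z z + + 2 * (-1ℤ * (s₀ x z - σ * s₀ y z)))) null) (solve 2 (λ z u → con 0ℤ :+ (con -1ℤ :* con -1ℤ :* z :+ con (+ 2) :* (con -1ℤ :* u)) := z :- con (+ 2) :* u) refl (s₀ z z) (s₀ x z - σ * s₀ y z)))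
            (triple -1ℤ (small -1ℤ (inj₂ refl))))))
          (ℤ.+-identityˡ (σ * s₀ y z)))
        where
        nonzero : s₀ x y ≢ 0ℤ
        nonzero = σ≢0 ∘ trans (sym xy)
        null : s₀ x x + σ * σ * s₀ y y - + 2 * σ * s₀ x y ≡ 0ℤ
        null = trans (cong₂ (λ p q → p + σ * σ * q - + 2 * σ * s₀ x y) (two-fats₀ nonzero) (two-fats₀ (nonzero ∘ trans (s₀-sym x y))))
          (trans (cong (λ t → 1ℤ + σ * σ * 1ℤ - + 2 * σ * t) xy)
            (trans (solve 1 (λ σ → con 1ℤ :+ σ :* σ :* con 1ℤ :- con (+ 2) :* σ :* σ := con 1ℤ :- σ :* σ) refl σ)
              (cong (λ t → 1ℤ - t) σσ≡1)))

    transport₀⁺ : ∀ x y → s₀ x y ≡ 1ℤ → ∀ z → s₀ x z ≡ s₀ y z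
    transport₀⁺ x y eq z = trans (orthogonal 1ℤ x y z (λ { _ (inj₁ refl) → +≤+ (ℕ.m≤m+n 3 2) ; _ (inj₂ refl) → +≤+ (ℕ.m≤m+n 3 2) })
      refl eq (λ ())) (ℤ.*-identityˡ _)

    transport₀⁻ : ∀ x y → s₀ x y ≡ -1ℤ → ∀ z → s₀ x z ≡ - s₀ y z
    transport₀⁻ x y eq z = trans (orthogonal -1ℤ x y z (λ { _ (inj₁ refl) → +≤+ (ℕ.m≤m+n 3 2) ; _ (inj₂ refl) → +≤+ (ℕ.m≤m+n 3 2) })
      refl eq (λ ())) (ℤ.-1*i≡-i (s₀ y z))

    Alike : V → V → Set
    Alike x y = x ≡ y ⊎ s₀ x y ≡ 1ℤ

    alike? : ∀ x y → Dec (Alike x y)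
    alike? x y = (x ≟ y) ⊎-dec (s₀ x y ℤ.≟ 1ℤ)

    alike : V → V → Bool
    alike x y = does (alike? x y)

    alike⁺ : ∀ {x y} → Alike x y → alike x y ≡ true
    alike⁺ {x} {y} = dec-true (alike? x y)

    alike⁻ : ∀ {x y} → ¬ Alike x y → alike x y ≡ false
    alike⁻ {x} {y} = dec-false (alike? x y)

    alike-sym : ∀ {x y} → Alike x y → Alike y x
    alike-sym (inj₁ e) = inj₁ (sym e)
    alike-sym {x} {y} (inj₂ e) = inj₂ (trans (s₀-sym y x) e)

    alike-trans : ∀ {x y z} → Alike x y → Alike y z → Alike x z
    alike-trans (inj₁ refl) l = l
    alike-trans (inj₂ e) (inj₁ refl) = inj₂ e
    alike-trans {x} {y} {z} (inj₂ e) (inj₂ f) = inj₂ (trans (transport₀⁺ x y e z) f)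

    Lonely : V → Set
    Lonely x = c₀ x x ≡ + 2 × ¬ (∃[ y ] s₀ x y ≡ -1ℤ)

    lonely? : ∀ x → Dec (Lonely x)
    lonely? x = (c₀ x x ℤ.≟ + 2) ×-dec ¬? (Fin.any? λ y → s₀ x y ℤ.≟ -1ℤ)

    lonely-alike : ∀ {x y} → Lonely x → Alike x y → Lonely y
    lonely-alike l (inj₁ refl) = l
    lonely-alike {x} {y} (_ , none) (inj₂ e) =
      [ id , (λ three → contradiction (trans (sym (trans (s₀-sym y x) e)) (isolated₀ y three x)) λ ()) ]′ (fatness₀ y)
      , λ (z , yz) → none (z , trans (transport₀⁺ x y e z) yz)

    _≟ᶜ_ : (u v : Vec Bool order) → Dec (u ≡ v)
    _≟ᶜ_ = Vec.≡-dec Bool._≟_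

    group : V → Vec Bool order
    group x = tabulate (alike x)

    lookup-group : ∀ x y → Vec.lookup (group x) y ≡ alike x y
    lookup-group x y = Vec.lookup∘tabulate (alike x) y

    group-≡ : ∀ {x y} → Alike x y → group x ≡ group y
    group-≡ {x} {y} a = Vec.tabulate-cong λ z → decide z (alike? x z)
      where
      decide : ∀ z → Dec (Alike x z) → alike x z ≡ alike y z
      decide z (yes b) = trans (alike⁺ b) (sym (alike⁺ (alike-trans (alike-sym a) b)))
      decide z (no n)  = trans (alike⁻ n) (sym (alike⁻ (n ∘ alike-trans a)))

    group-alike : ∀ {x y} → group x ≡ group y → Alike x y
    group-alike {x} {y} eq = decide (alike? x y)
      where
      decide : Dec (Alike x y) → Alike x y
      decide (yes a) = a
      decide (no n)  = contradiction (trans (sym (alike⁻ n)) (trans (sym (lookup-group x y))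
        (trans (cong (λ v → Vec.lookup v y) eq) (trans (lookup-group y y) (alike⁺ (inj₁ refl)))))) λ ()

    leaders₁ : List V
    leaders₁ = representatives _≟ᶜ_ group (filter lonely? (allFin order))

    leader-lonely : ∀ {r} → r ∈ₗ leaders₁ → Lonely r
    leader-lonely r∈ = proj₂ (∈-filter⁻ lonely? {xs = allFin order} (representatives-⊆ _≟ᶜ_ group r∈))

    K₁ : ℕ
    K₁ = length leaders₁

    K : ℕ
    K = K₀ ℕ.+ K₁

    inc : V → Fin K → Bool
    inc x k = [ inc₀ x , (λ j → alike (lookup leaders₁ j) x) ]′ (splitAt K₀ k)

    inc-old : ∀ x k → inc x (k ↑ˡ K₁) ≡ inc₀ x k
    inc-old x k = cong [ inc₀ x , (λ j → alike (lookup leaders₁ j) x) ]′ (Fin.splitAt-↑ˡ K₀ k K₁)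

    inc-new : ∀ x j → inc x (K₀ ↑ʳ j) ≡ alike (lookup leaders₁ j) x
    inc-new x j = cong [ inc₀ x , (λ j → alike (lookup leaders₁ j) x) ]′ (Fin.splitAt-↑ʳ K₀ K₁ j)

    extra : V → V → ℤ
    extra x y = cnt (λ r → alike r x ∧ alike r y) leaders₁

    common-split : ∀ x y → common G K inc x y ≡ c₀ x y + extra x y
    common-split x y = trans (∑-splitAt K₀ K₁ (λ k → 𝟙 (inc x k ∧ inc y k)))
      (cong₂ _+_ (∑-cong (allFin K₀) λ k → cong 𝟙 (cong₂ _∧_ (inc-old x k) (inc-old y k)))
        (trans (∑-cong (allFin K₁) λ j → cong 𝟙 (cong₂ _∧_ (inc-new x j) (inc-new y j)))
          (sym (∑-lookup (λ r → 𝟙 (alike r x ∧ alike r y)) leaders₁))))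

    extra-busy : ∀ {x} y → ¬ Lonely x → extra x y ≡ 0ℤ
    extra-busy {x} y busy = trans (∑-cong-∈ leaders₁ λ {r} r∈ → cong (λ b → 𝟙 (b ∧ alike r y))
      (alike⁻ (busy ∘ lonely-alike (leader-lonely r∈)))) (∑-zero leaders₁)

    -- Among the leaders exactly one has the group of x, so the sum collapses to the term of that
    -- leader, whose incidence with y is that of x.
    extra-lonely : ∀ {x} y → Lonely x → extra x y ≡ 𝟙 (alike x y)
    extra-lonely {x} y lonely =
      let r , r∈ , eq = representatives-cover _≟ᶜ_ group (∈-filter⁺ lonely? (∈-allFin x) lonely)
      in trans (trans (∑-cong leaders₁ term) (sym (∑-map (λ v → δ _≟ᶜ_ v (group x) * 𝟙 (Vec.lookup v y)) group leaders₁)))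
           (trans (∑-δ _≟ᶜ_ (λ v → 𝟙 (Vec.lookup v y))
             (AllPairs.map⁺ (representatives-distinct _≟ᶜ_ group (filter lonely? (allFin order))))
             (subst (_∈ₗ map group leaders₁) (sym eq) (∈-map⁺ group r∈)))
             (cong 𝟙 (lookup-group x y)))
      where
      term : ∀ r → 𝟙 (alike r x ∧ alike r y) ≡ δ _≟ᶜ_ (group r) (group x) * 𝟙 (Vec.lookup (group r) y)
      term r = trans (𝟙-∧ (alike r x) (alike r y)) (cong₂ _*_ (decide (alike? r x)) (cong 𝟙 (sym (lookup-group r y))))
        where
        decide : Dec (Alike r x) → 𝟙 (alike r x) ≡ δ _≟ᶜ_ (group r) (group x)
        decide (yes a) = trans (cong 𝟙 (alike⁺ a)) (sym (trans (cong (λ v → δ _≟ᶜ_ v (group x)) (group-≡ a)) (δ-refl _≟ᶜ_ (group x))))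
        decide (no n)  = trans (cong 𝟙 (alike⁻ n)) (sym (δ-≢ _≟ᶜ_ (n ∘ group-alike)))

    s : V → V → ℤ
    s = special G K inc

    s-split : ∀ x y → s x y ≡ s₀ x y - extra x y
    s-split x y = trans (cong (λ t → B G x y - t) (common-split x y))
      (solve 3 (λ b c e → b :- (c :+ e) := b :- c :- e) refl (B G x y) (c₀ x y) (extra x y))

    s-busy : ∀ {x} y → ¬ Lonely x → s x y ≡ s₀ x y
    s-busy {x} y busy = trans (s-split x y) (trans (cong (λ t → s₀ x y - t) (extra-busy y busy)) (ℤ.+-identityʳ (s₀ x y)))

    -- The row of a lonely vertex contains only 0 and 1, with 1 exactly at the vertices alike to it.
    -- These are the ones with which it shares one new fat vertex, and that subtracts the 1.
    s-lonely : ∀ {x} y → Lonely x → s x y ≡ 0ℤ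
    s-lonely {x} y lonely@(two , none) = trans (s-split x y) (trans (cong (λ t → s₀ x y - t) (extra-lonely y lonely)) (decide (x ≟ y) (sign₀ x y)))
      where
      decide : Dec (x ≡ y) → s₀ x y ≡ 0ℤ ⊎ s₀ x y ≡ 1ℤ ⊎ s₀ x y ≡ -1ℤ → s₀ x y - 𝟙 (alike x y) ≡ 0ℤ
      decide (yes refl) _ = cong₂ (λ t b → t - 𝟙 b) (diagonal two) (alike⁺ (inj₁ refl))
      decide (no n) (inj₁ e) = cong₂ (λ t b → t - 𝟙 b) e (alike⁻ [ n , (λ f → contradiction (trans (sym e) f) λ ()) ]′)
      decide (no n) (inj₂ (inj₁ e)) = cong₂ (λ t b → t - 𝟙 b) e (alike⁺ (inj₂ e))
      decide (no n) (inj₂ (inj₂ e)) = contradiction (y , e) none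

    common-busy : ∀ {x} → ¬ Lonely x → common G K inc x x ≡ c₀ x x
    common-busy {x} busy = trans (common-split x x) (trans (cong (λ t → c₀ x x + t) (extra-busy x busy)) (ℤ.+-identityʳ (c₀ x x)))

    common-lonely : ∀ {x} → Lonely x → common G K inc x x ≡ + 3
    common-lonely {x} lonely = trans (common-split x x) (cong₂ _+_ (proj₁ lonely)
      (trans (extra-lonely x lonely) (cong 𝟙 (alike⁺ (inj₁ refl)))))

    busy-left : ∀ {x y} → s x y ≢ 0ℤ → ¬ Lonely x
    busy-left {y = y} n lonely = n (s-lonely y lonely)

    busy-right : ∀ {x y} → s x y ≢ 0ℤ → ¬ Lonely y
    busy-right {x} {y} n = busy-left (n ∘ trans (special-sym G K inc x y))

    nonzero⁺ : ∀ {t} → t ≡ 1ℤ → t ≢ 0ℤ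
    nonzero⁺ refl ()

    nonzero⁻ : ∀ {t} → t ≡ -1ℤ → t ≢ 0ℤ
    nonzero⁻ refl ()

    -- Rows of lonely vertices have become zero and all other rows are unchanged, so the sign and
    -- transport laws carry over from `s₀`. A vertex that still has two fat neighbours is not
    -- lonely, which supplies its partner.
    reduced : Reduced G K inc
    reduced = record
      { attached   = λ k → attached k (splitAt K₀ k) refl
      ; fatness    = λ x → fatness x (lonely? x)
      ; isolated   = λ x three y _ → isolated x y three (lonely? x)
      ; partner    = λ x two → partner x two (lonely? x) (Fin.any? λ y → s₀ x y ℤ.≟ -1ℤ)
      ; sign       = λ x y → sign x y (lonely? x)
      ; transport⁺ = λ x y e z → trans (s-busy z (busy-left (nonzero⁺ e)))
          (trans (transport₀⁺ x y (trans (sym (s-busy y (busy-left (nonzero⁺ e)))) e) z) (sym (s-busy z (busy-right (nonzero⁺ e)))))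
      ; transport⁻ = λ x y e z → trans (s-busy z (busy-left (nonzero⁻ e)))
          (trans (transport₀⁻ x y (trans (sym (s-busy y (busy-left (nonzero⁻ e)))) e) z) (cong -_ (sym (s-busy z (busy-right (nonzero⁻ e))))))
      }
      where
      attached : ∀ k t → splitAt K₀ k ≡ t → ∃[ x ] T (inc x k)
      attached k (inj₁ j) eq = let x , x~j = attached₀ j in
        x , subst T (sym (cong [ inc₀ x , (λ j → alike (lookup leaders₁ j) x) ]′ eq)) x~j
      attached k (inj₂ j) eq = lookup leaders₁ j , subst T (sym (trans
        (cong [ inc₀ (lookup leaders₁ j) , (λ i → alike (lookup leaders₁ i) (lookup leaders₁ j)) ]′ eq) (alike⁺ (inj₁ refl)))) _
      fatness : ∀ x → Dec (Lonely x) → common G K inc x x ≡ + 2 ⊎ common G K inc x x ≡ + 3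
      fatness x (yes l) = inj₂ (common-lonely l)
      fatness x (no b)  = [ inj₁ ∘ trans (common-busy b) , inj₂ ∘ trans (common-busy b) ]′ (fatness₀ x)
      isolated : ∀ x y → common G K inc x x ≡ + 3 → Dec (Lonely x) → s x y ≡ 0ℤ
      isolated x y _     (yes l) = s-lonely y l
      isolated x y three (no b)  = trans (s-busy y b) (isolated₀ x (trans (sym (common-busy b)) three) y)
      partner : ∀ x → common G K inc x x ≡ + 2 → Dec (Lonely x) → Dec (∃[ y ] s₀ x y ≡ -1ℤ) → ∃[ y ] s x y ≡ -1ℤ
      partner x two (yes l) _            = contradiction (trans (sym (common-lonely l)) two) λ ()
      partner x two (no b)  (yes (y , e)) = y , trans (s-busy y b) e
      partner x two (no b)  (no none)     = contradiction (trans (sym (common-busy b)) two , none) b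
      sign : ∀ x y → Dec (Lonely x) → s x y ≡ 0ℤ ⊎ s x y ≡ 1ℤ ⊎ s x y ≡ -1ℤ
      sign x y (yes l) = inj₁ (s-lonely y l)
      sign x y (no b)  = subst (λ t → t ≡ 0ℤ ⊎ t ≡ 1ℤ ⊎ t ≡ -1ℤ) (sym (s-busy y b)) (sign₀ x y)

-- The average degree condition and the conclusion

module Main where
  open Sums
  open Forms using (form; form-cong; weight)
  open GraphForm using (B; K; form-nonneg)
  open FatCliques using (near; fats; fats-≤3; special-nonneg; member-near)
  open TwoFat using (ramsey; neighbourList; two-fats; some-member)
  open Hoffman using (∣tabulate∣)
  open Assemble using (common; special; hoffman; two-fat; slim-graph; Reduced)
  open Components using (isLine; fats-of)
  open Extras using (module Completion)
  open Spectral using (ι-+; ι-*; ι-≃; ι-cancel-≤; num)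
  open import Data.Integer as ℤ using (ℤ; +_; -[1+_]; 0ℤ; _+_; _*_; +≤+; +<+)
  import Data.Integer.Properties as ℤ
  import Data.List.Properties as List
  open import Data.Fin.Subset.Properties using (_∈?_)
  open import Data.Rational as ℚ using (ℚ; _≤_; _-_; _/_; nonNegative)
  import Data.Rational.Properties as ℚ
  open import Data.Rational.Solver renaming (module +-*-Solver to ℚ-Solver)
  import Data.Rational.Unnormalised as ℚᵘ
  import Data.Rational.Unnormalised.Properties as ℚᵘ

  ∑-ℕ : ∀ {n} (f : Fin n → ℕ) → + ∑ℕ f ≡ ∑ (λ i → + f i) (allFin n)
  ∑-ℕ {zero}  f = refl
  ∑-ℕ {suc n} f = cong (λ t → + f zero + t) (trans (∑-ℕ (f ∘ suc)) (sym (∑-tabulate (λ i → + f i) suc)))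

  abstract
    quotient-* : ∀ s n → (+ s / suc n) ℚ.* num (suc n) ≡ num s
    quotient-* s n = ℚ.toℚᵘ-injective (ℚᵘ.≃-trans (ℚ.toℚᵘ-homo-* (+ s / suc n) (num (suc n)))
      (ℚᵘ.≃-trans (ℚᵘ.*-cong (ℚ.toℚᵘ-fromℚᵘ (ℚᵘ.mkℚᵘ (+ s) n)) (ι-≃ (+ suc n)))
        (ℚᵘ.≃-trans (ℚᵘ.*≡* (trans (ℤ.*-identityʳ (+ s * + suc n)) (cong (λ k → + s * + suc k) (sym (ℕ.*-identityʳ n)))))
          (ℚᵘ.≃-sym (ι-≃ (+ s))))))

  -- Matching on the order opens `averageDegree`; positivity of the order excludes its conventional
  -- value for the empty graph.
  ∑-degree-bound : ∀ H q → averageDegree H ≤ q → 0 ℕ.< Graph.order H → num (∑ℕ (Graph.degree H)) ≤ q ℚ.* num (Graph.order H)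
  ∑-degree-bound H q le pos with Graph.order H | ∑ℕ (Graph.degree H)
  ... | suc n | s = subst (_≤ q ℚ.* num (suc n)) (quotient-* s n)
    (ℚ.*-monoʳ-≤-nonNeg (num (suc n)) ⦃ nonNegative (Spectral.num≥0 (suc n)) ⦄ le)

  module _ (G : Graph) where
    open Graph G

    elements-neighbours : ∀ x → elements (neighbours x) ≡ neighbourList G x
    elements-neighbours x = List.filter-≐ (_∈? neighbours x) (T? ∘ adj x)
      (∈⟪⟫⁻ (T? ∘ adj x) , ∈⟪⟫⁺ (T? ∘ adj x)) (allFin order)

    degree-length : ∀ x → + degree x ≡ ∣ neighbourList G x ∣ₗ
    degree-length x = trans (∣tabulate∣ (adj x)) (sym (length-filter (adj x) (allFin order)))

    local-degrees : ∀ x → + ∑ℕ (Graph.degree (localGraph G x)) ≡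
      ∑ (λ y → cnt (adj y) (neighbourList G x)) (neighbourList G x)
    local-degrees x = trans (∑-ℕ (Graph.degree (localGraph G x)))
      (trans (∑-cong (allFin _) λ i → trans (∣tabulate∣ (λ j → adj (at W i) (at W j))) (sym (∑-lookup (𝟙 ∘ adj (at W i)) (elements W))))
        (trans (sym (∑-lookup (λ y → cnt (adj y) (elements W)) (elements W)))
          (cong (λ L → ∑ (λ y → cnt (adj y) L) L) (elements-neighbours x))))
      where W = neighbours x

    -- Condition (ii) multiplied by d(x), the order of the local graph, and pulled back from the
    -- rationals to the integers.
    sparse : ∀ κ x → κ ℕ.< degree x → averageDegree (localGraph G x) ≤ fromℕ (degree x) - fromℕ κ →
      ∑ (λ y → cnt (adj y) (neighbourList G x)) (neighbourList G x) + + κ * ∣ neighbourList G x ∣ₗ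
        ℤ.≤ ∣ neighbourList G x ∣ₗ * ∣ neighbourList G x ∣ₗ
    sparse κ x κ<d average = subst₂ (λ s d → s + + κ * d ℤ.≤ d * d) (local-degrees x) (degree-length x)
      (ι-cancel-≤ {+ e + + κ * + d} {+ d * + d} (subst₂ _≤_
        (sym (trans (ι-+ (+ e) (+ κ * + d)) (cong (num e ℚ.+_) (ι-* (+ κ) (+ d)))))
        (trans (ℚ-Solver.solve 2 (λ d k → (d ℚ-Solver.:- k) ℚ-Solver.:* d ℚ-Solver.:+ k ℚ-Solver.:* d ℚ-Solver.:= d ℚ-Solver.:* d) refl (num d) (num κ))
          (sym (ι-* (+ d) (+ d))))
        (ℚ.+-monoˡ-≤ (num κ ℚ.* num d) bound)))
      where
      d = degree x
      e = ∑ℕ (Graph.degree (localGraph G x))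
      order≡d : Graph.order (localGraph G x) ≡ d
      order≡d = ℤ.+-injective (trans (cong ∣_∣ₗ (elements-neighbours x)) (sym (degree-length x)))
      bound : num e ≤ (num d - num κ) ℚ.* num d
      bound = subst (λ k → num e ≤ (num d - num κ) ℚ.* num k) order≡d
        (∑-degree-bound (localGraph G x) (num d - num κ) average (subst (0 ℕ.<_) (sym order≡d) (ℕ.≤-<-trans ℕ.z≤n κ<d)))

  two-or-three : ∀ {t} → + 2 ℤ.≤ t → t ℤ.≤ + 3 → t ≡ + 2 ⊎ t ≡ + 3
  two-or-three {+ 2} _ _ = inj₁ refl
  two-or-three {+ 3} _ _ = inj₂ refl
  two-or-three {+ 0} (+≤+ ()) _
  two-or-three {+ 1} (+≤+ (ℕ.s≤s ())) _
  two-or-three {+ suc (suc (suc (suc n)))} _ (+≤+ (ℕ.s≤s (ℕ.s≤s (ℕ.s≤s ()))))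

  ≥2 : ∀ {t} → t ≡ + 2 ⊎ t ≡ + 3 → + 2 ℤ.≤ t
  ≥2 (inj₁ refl) = ℤ.≤-refl
  ≥2 (inj₂ refl) = +≤+ (ℕ.s≤s (ℕ.s≤s ℕ.z≤n))

  -- One more than the average deficit 2r + 1 that a single fat neighbour would permit, where r is
  -- the Ramsey bound for an n-clique or a coclique of the excluded size 10.
  threshold : ℕ → ℕ
  threshold n = ramsey n 10 ℕ.+ ramsey n 10 ℕ.+ 2

  module _ (n : ℕ) (n-large : + 15600 ℤ.< + n) (G : Graph)
    (large : ∀ x → threshold n ℕ.< Graph.degree G x)
    (average : ∀ x → averageDegree (localGraph G x) ≤ fromℕ (Graph.degree G x) - fromℕ (threshold n))
    (nonneg : ∀ w → 0ℤ ℤ.≤ form (K G) w w) where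
    open Graph G

    incidence : V → Fin (length (fats G n)) → Bool
    incidence x k = near G n x (lookup (fats G n) k)

    common-fats : ∀ x y → FatCliques.common G n n-large nonneg x y ≡ common G (length (fats G n)) incidence x y
    common-fats x y = ∑-lookup (λ F → 𝟙 (near G n x F ∧ near G n y F)) (fats G n)

    fatness : ∀ x → common G (length (fats G n)) incidence x x ≡ + 2 ⊎ common G (length (fats G n)) incidence x x ≡ + 3
    fatness x = subst (λ t → t ≡ + 2 ⊎ t ≡ + 3)
      (trans (∑-cong (fats G n) λ F → cong 𝟙 (sym (Bool.∧-idem (near G n x F)))) (common-fats x x))
      (two-or-three
        (two-fats G n n-large nonneg x (subst (+ threshold n ℤ.<_) (degree-length G x) (+<+ (large x))) (sparse G (threshold n) x (large x) (average x)))
        (fats-≤3 G n n-large nonneg x))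

    incident : ∀ k → ∃[ x ] T (incidence x k)
    incident k = let x , x∈ = some-member G n-large (lookup (fats G n) k) in x , member-near G n {x} {lookup (fats G n) k} x∈

    special-fats : ∀ w → weight w ℤ.≤ + 5 → 0ℤ ℤ.≤ form (special G (length (fats G n)) incidence) w w
    special-fats w small = subst (0ℤ ℤ.≤_) (form-cong w w λ x y → cong (λ t → B G x y ℤ.- t) (common-fats x y))
      (special-nonneg G n n-large nonneg w small)

    private
      module 𝔠 = Completion G (length (fats G n)) incidence incident fatness special-fats

    line-hoffman-graph : ∃[ 𝔥 ] IsFat 𝔥 2 × IsLineHoffmanGraph 𝔣 𝔥 × G ≅ slimGraph 𝔥
    line-hoffman-graph = hoffman G 𝔠.K 𝔠.inc attached
      , two-fat G 𝔠.K 𝔠.inc attached (λ x → subst (+ 2 ℤ.≤_) (fats-of G 𝔠.K 𝔠.inc 𝔠.reduced x) (≥2 (Reduced.fatness 𝔠.reduced x)))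
      , isLine G 𝔠.K 𝔠.inc 𝔠.reduced
      , slim-graph G 𝔠.K 𝔠.inc attached
      where attached = Reduced.attached 𝔠.reduced

  line-hoffman-graphs : ∀ n → + 15600 ℤ.< + n →
      ∃[ κ ] 0 ℕ.< κ ×
        ((G : Graph) →
          (∀ x → κ ℕ.< Graph.degree G x) →
          (∀ x → averageDegree (localGraph G x) ≤ fromℕ (Graph.degree G x) - fromℕ κ) →
          (∃[ μ ] IsλMin G μ × fromℤ (-[1+ 2 ]) ≤ᵣ μ) →
          ∃[ 𝔥 ] IsFat 𝔥 2 × IsLineHoffmanGraph 𝔣 𝔥 × G ≅ slimGraph 𝔥)
  line-hoffman-graphs n n-large = threshold n , ℕ.≤-trans (ℕ.s≤s ℕ.z≤n) (ℕ.m≤n+m 2 (ramsey n 10 ℕ.+ ramsey n 10))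
    , λ G large average (μ , isμ , -3≤μ) → line-hoffman-graph n n-large G large average (form-nonneg G μ isμ -3≤μ)

open import Data.Fin using (Fin)
open import Data.Integer using (-[1+_]; +<+)
open import Data.Nat using (ℕ; _<_)
open import Data.Nat.Properties using (n<1+n)
open import Data.Product using (∃-syntax; _×_)
open import Data.Rational using (_≤_; _-_)

theorem1p5 : ∃[ κ ] 0 < κ ×
    ((G : Graph) →
    (∀ x → κ < Graph.degree G x) →
    (∀ x → averageDegree (localGraph G x) ≤ fromℕ (Graph.degree G x) - fromℕ κ) →
    (∃[ μ ] IsλMin G μ × fromℤ (-[1+ 2 ]) ≤ᵣ μ) →
    ∃[ 𝔥 ] IsFat 𝔥 2 × IsLineHoffmanGraph 𝔣 𝔥 × G ≅ slimGraph 𝔥)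
theorem1p5 = Main.line-hoffman-graphs 15601 (+<+ (n<1+n 15600))
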